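{- The following problem is decidable: given a class automaton, decide whether it accepts some bipartite data tree. Consequently, the following problem is also decidable: given an (Extended Regular) XPath query (boolean or unary) over data trees, decide whether it is satisfied in some bipartite data tree (for a unary query: whether it selects at least one node in some bipartite data tree).
   Context: Trees are finite, unranked, sibling-ordered, with nodes labeled by a finite alphabet. A data tree over $\Sigma$ is a pair $(t,\sim)$ where $t$ is a tree labeled by $\Sigma$ and $\sim$ is an equivalence relation on the nodes of $t$; a class is an equivalence class of $\sim$. A data tree is bipartite if its nodes can be split into two sets $X,Y$, each connected with respect to the child relation, such that every class has at most one node in $X$ and at most one node in $Y$. If $t,s$ are trees over $\Sigma,\Gamma$ with the same nodes, $t\otimes s$ is the tree over $\Sigma\times\Gamma$ with the same nodes, where each node carries its pair of labels; for a set $X$ of nodes of $t$, $t\otimes X$ is the tree over $\Sigma\times\{0,1\}$ obtained by adding the characteristic function of $X$ as second coordinate. A nondeterministic letter-to-letter transducer $f$ from $\Sigma$ to $\Gamma$ is a regular language of trees over $\Sigma\times\Gamma$; one writes $s\in f(t)$ when $t,s$ have the same nodes and $t\otimes s$ belongs to this language. A class automaton consists of an input alphabet $\Sigma$, a finite work alphabet $\Gamma$, a nondeterministic letter-to-letter transducer $f$ from $\Sigma$ to $\Gamma$, and a regular language of trees over $\Gamma\times\{0,1\}$ called the class condition (regular languages are given, e.g., by tree automata). It accepts a data tree $(t,\sim)$ over $\Sigma$ if there is some $s\in f(t)$ such that for every class $X$ of $\sim$ the tree $s\otimes X$ belongs to the class condition. Extended Regular XPath (called XPath for short) is defined inductively.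 (i) Let $\Gamma$ be a finite set of already defined unary XPath queries (empty in the induction base), and let $\varphi[x_1,\dots,x_m]$ be a formula of monadic second-order logic (with quantification over nodes and sets of nodes) that uses the queries of $\Gamma$ as unary predicates, unary predicates for the letters of the alphabet, and the binary child and next-sibling predicates, but does not use $\sim$ (other than inside the queries of $\Gamma$). Then $\varphi$ is an $m$-ary XPath query (boolean if $m=0$, unary if $m=1$). (ii) If $\varphi[x,y_1,y_2]$ is a ternary XPath query, then $\exists y_1\exists y_2\ (y_1\sim y_2\wedge\varphi[x,y_1,y_2])$ and $\exists y_1\exists y_2\ (y_1\not\sim y_2\wedge\varphi[x,y_1,y_2])$ are unary XPath queries (with free variable $x$). -}

module Defs where

open import Data.Bool using (Bool; T; not)
open import Data.Fin using (Fin)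
open import Data.List using (List; []; _∷_; _++_; map; tabulate)
open import Data.List.Membership.Propositional using (_∈_)
open import Data.Nat using (ℕ; suc)
open import Data.Product using (Σ; ∃; ∃-syntax; _×_; _,_)
open import Data.Sum using (_⊎_)
open import Data.Vec using (Vec; []; _∷_; lookup)
open import Data.Vec.Functional using (Vector)
open import Level using (0ℓ)
open import Relation.Binary using (Rel; IsDecEquivalence)
open import Relation.Binary.Construct.Closure.Equivalence using (EqClosure)
open import Relation.Binary.PropositionalEquality using (_≡_)
open import Relation.Nullary using (¬_; does)

-- A labelled tree is a shape together with a labelling of its nodes, so
-- that "trees with the same nodes" are labellings of one shape.

data Shape : Set where
  branch : ∀ {n} → Vector Shape n → Shape

data Node : Shape → Set where
  root  : ∀ {s} → Node s
  below : ∀ {n} {f : Vector Shape n} (i : Fin n) → Node (f i) → Node (branch f)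

-- Children are listed in sibling order.
children : ∀ {s} → Node s → List (Node s)
children {branch f} root        = tabulate (λ i → below i root)
children            (below i v) = map (below i) (children v)

Child : ∀ {s} → Node s → Node s → Set
Child v w = w ∈ children v

NextSibling : ∀ {s} → Node s → Node s → Set
NextSibling v w = ∃[ u ] ∃[ vs ] ∃[ ws ] children u ≡ vs ++ v ∷ w ∷ ws

Labelling : Set → Shape → Set
Labelling A s = Node s → A

NodeSet : Shape → Set
NodeSet s = Node s → Bool

_⊗_ : ∀ {A B s} → Labelling A s → Labelling B s → Labelling (A × B) s
(ℓ ⊗ ℓ′) v = ℓ v , ℓ′ v

-- The alphabet with σ letters is Fin σ.  Decidability of ∼ makes its classes
-- Bool-valued node sets; on finite trees it excludes nothing classically.
record DataTree (σ : ℕ) : Set₁ where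
  infix 4 _∼_
  field
    shape            : Shape
    label            : Labelling (Fin σ) shape
    _∼_              : Rel (Node shape) 0ℓ
    isDecEquivalence : IsDecEquivalence _∼_

  open IsDecEquivalence isDecEquivalence public using (_≟_)

  class : Node shape → NodeSet shape
  class v w = does (v ≟ w)

-- X induces a connected subgraph of the undirected child graph; the empty
-- set counts as connected.
Connected : ∀ {s} → NodeSet s → Set
Connected X = ∀ v w → T (X v) → T (X w) →
  EqClosure (λ x y → T (X x) × T (X y) × Child x y) v w

Bipartite : ∀ {σ} → DataTree σ → Set
Bipartite t = ∃[ X ] Part X × Part (λ v → not (X v))
  where
  open DataTree t
  Part : NodeSet shape → Set
  Part X = Connected X × (∀ v w → v ∼ w → T (X v) → T (X w) → v ≡ w)

record WordAutomaton (A : Set) : Set where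
  field
    states  : ℕ
    initial : Fin states → Bool
    step    : Fin states → A → Fin states → Bool
    final   : Fin states → Bool

  AcceptsFrom : Fin states → List A → Set
  AcceptsFrom q []      = T (final q)
  AcceptsFrom q (a ∷ w) = ∃[ q′ ] T (step q a q′) × AcceptsFrom q′ w

  AcceptsWord : List A → Set
  AcceptsWord w = ∃[ q ] T (initial q) × AcceptsFrom q w

-- Nondeterministic automata on unranked trees: the states of the children of
-- a node, in sibling order, form a word in a regular horizontal language
-- determined by the letter and the state of that node.
record TreeAutomaton (A : Set) : Set where
  field
    states     : ℕ
    accepting  : Fin states → Bool
    horizontal : A → Fin states → WordAutomaton (Fin states)

  IsRun : ∀ {s} → Labelling A s → Labelling (Fin states) s → Set
  IsRun ℓ ρ = ∀ v →
    WordAutomaton.AcceptsWord (horizontal (ℓ v) (ρ v)) (map ρ (children v))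

  AcceptsTree : ∀ {s} → Labelling A s → Set
  AcceptsTree ℓ = ∃[ ρ ] IsRun ℓ ρ × T (accepting (ρ root))

Transducer : ℕ → ℕ → Set
Transducer σ γ = TreeAutomaton (Fin σ × Fin γ)

record ClassAutomaton (σ : ℕ) : Set where
  field
    γ              : ℕ
    transducer     : Transducer σ γ
    classCondition : TreeAutomaton (Fin γ × Bool)

  Accepts : DataTree σ → Set
  Accepts t = Σ (Labelling (Fin γ) shape) λ ℓ →
      TreeAutomaton.AcceptsTree transducer (label ⊗ ℓ)
    × (∀ v → TreeAutomaton.AcceptsTree classCondition (ℓ ⊗ class v))
    where open DataTree t

-- MSO σ g m k: formulas over σ letters and g further unary predicates,
-- with m free node variables and k free set variables (de Bruijn indices,
-- the innermost binder being zero).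

data MSO (σ g : ℕ) (m k : ℕ) : Set where
  letter      : Fin σ → Fin m → MSO σ g m k
  pred        : Fin g → Fin m → MSO σ g m k
  child       : Fin m → Fin m → MSO σ g m k
  nextSibling : Fin m → Fin m → MSO σ g m k
  equal       : Fin m → Fin m → MSO σ g m k
  member      : Fin m → Fin k → MSO σ g m k
  neg         : MSO σ g m k → MSO σ g m k
  and or      : MSO σ g m k → MSO σ g m k → MSO σ g m k
  ex all      : MSO σ g (suc m) k → MSO σ g m k
  exSet allSet : MSO σ g m (suc k) → MSO σ g m k

module _ {σ g s} (ℓ : Labelling (Fin σ) s) (P : Fin g → Node s → Set) where

  Sat : ∀ {m k} → MSO σ g m k → Vec (Node s) m → Vec (NodeSet s) k → Set
  Sat (letter a x)      ν μ = ℓ (lookup ν x) ≡ a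
  Sat (pred i x)        ν μ = P i (lookup ν x)
  Sat (child x y)       ν μ = Child (lookup ν x) (lookup ν y)
  Sat (nextSibling x y) ν μ = NextSibling (lookup ν x) (lookup ν y)
  Sat (equal x y)       ν μ = lookup ν x ≡ lookup ν y
  Sat (member x X)      ν μ = T (lookup μ X (lookup ν x))
  Sat (neg φ)           ν μ = ¬ Sat φ ν μ
  Sat (and φ ψ)         ν μ = Sat φ ν μ × Sat ψ ν μ
  Sat (or φ ψ)          ν μ = Sat φ ν μ ⊎ Sat ψ ν μ
  Sat (ex φ)            ν μ = ∃[ v ] Sat φ (v ∷ ν) μ
  Sat (all φ)           ν μ = ∀ v → Sat φ (v ∷ ν) μ
  Sat (exSet φ)         ν μ = ∃[ X ] Sat φ ν (X ∷ μ)
  Sat (allSet φ)        ν μ = ∀ X → Sat φ ν (X ∷ μ)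

-- In mso Γ φ the predicates of φ are interpreted by the queries in Γ.
data XPath (σ : ℕ) : ℕ → Set where
  mso     : ∀ {g m} → Vector (XPath σ 1) g → MSO σ g m 0 → XPath σ m
  exSame  : XPath σ 3 → XPath σ 1
  exOther : XPath σ 3 → XPath σ 1

-- The variables x, y₁, y₂ of a ternary query are 0, 1, 2 respectively.
Holds : ∀ {σ m} (t : DataTree σ) → XPath σ m → Vec (Node (DataTree.shape t)) m → Set
Holds t (mso Γ φ)   ν        = Sat (DataTree.label t) (λ i v → Holds t (Γ i) (v ∷ [])) φ ν []
Holds t (exSame φ)  (x ∷ []) = ∃[ y₁ ] ∃[ y₂ ] y₁ ∼ y₂ × Holds t φ (x ∷ y₁ ∷ y₂ ∷ [])
  where open DataTree t
Holds t (exOther φ) (x ∷ []) = ∃[ y₁ ] ∃[ y₂ ] ¬ y₁ ∼ y₂ × Holds t φ (x ∷ y₁ ∷ y₂ ∷ [])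
  where open DataTree t

{-# OPTIONS --safe #-}
module Submission where

-- In a bipartite data tree the two parts are a full subtree and its complement, and the
-- equivalence relation is a partial matching between them.  Whether φ(x, y, z) holds for x, y in
-- one part and z in the other depends on z only through a type from a finite set, namely the
-- behaviour of a tree automaton for φ on the part of z with z marked.  Colour every matched
-- node by the types of both nodes of its class.  Then y ∼ z may be replaced by equality of
-- colours inside ∃ y z (y ∼ z ∧ φ), and y ≁ z similarly, so a query becomes a formula of
-- monadic second-order logic about the coloured tree.  Conversely, a colouring comes from a
-- matching if and only if every colour occurs equally often on the matched nodes of both parts.
-- It remains to decide whether a regular tree language contains a tree in which certain letter
-- counts agree.  Unranked trees are curried into binary trees whose leaves are the nodes, so that
-- tree automata become context-free grammars and the letter counts form a semilinear set by
-- Parikh's theorem; the equations between counts are eliminated one at a time.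

open import Defs
open import Algebra using (CommutativeMonoid)
open import Data.Bool using (Bool; true; false; T; not; _∧_; _∨_; if_then_else_)
import Data.Bool.Properties as Bool
open import Data.Empty using (⊥; ⊥-elim)
open import Data.Fin as Fin using (Fin; zero; suc; toℕ; _↑ˡ_; _↑ʳ_)
open import Data.Fin.Patterns using (0F; 1F; 2F; 3F)
import Data.Fin.Properties as Fin
open import Data.List as List using (List; []; _∷_; _++_)
open import Data.List.Membership.Propositional using (_∈_)
import Data.List.Membership.Propositional.Properties as ∈
import Data.List.Properties as List
open import Data.List.Relation.Unary.All as All using (All; []; _∷_)
open import Data.List.Relation.Unary.Any as Any using (here; there)
import Data.List.Relation.Unary.Any.Properties as Any
open import Data.Nat as ℕ using (ℕ; zero; suc; _+_; _∸_; _≤_; _<_; s≤s)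
import Data.Nat.Properties as ℕ
open import Data.Product using (Σ; ∃; ∃-syntax; _×_; _,_; proj₁; proj₂)
import Data.Product.Properties as Product
open import Data.Sum using (_⊎_; inj₁; inj₂; [_,_]′)
import Data.Sum.Properties as Sum
open import Data.Unit using (⊤; tt)
open import Data.Vec as Vec using (Vec; []; _∷_; lookup)
import Data.Vec.Properties as Vec
import Data.Vec.Relation.Unary.All as VecAll
import Data.Vec.Relation.Unary.All.Properties as VecAll
open import Function using (_∘_; id; _⇔_; mk⇔; Equivalence)
open import Function.Construct.Composition using () renaming (_⇔-∘_ to _⇔∘_)
open import Function.Construct.Identity using (⇔-id)
open import Function.Construct.Symmetry using (⇔-sym)
open import Level using (0ℓ)
open import Relation.Binary using (Rel; IsDecEquivalence)
import Relation.Binary.Construct.Closure.Equivalence as Eq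
open import Relation.Binary.Construct.Closure.Equivalence using (EqClosure)
open import Relation.Binary.Definitions using (DecidableEquality)
open import Relation.Binary.PropositionalEquality hiding ([_]; isDecEquivalence)
open import Relation.Nullary using (¬_; Dec; yes; no; does)
open import Relation.Nullary.Decidable using
  (map; map′; _×-dec_; _⊎-dec_; _→-dec_; ¬?; T?; decidable-stable; dec-false)

open Equivalence using () renaming (to to ⇒; from to ⇐)

-- Regular expressions over the commutative monoid of weights

-- The relation ∼ is lost when a tree is encoded: equal counts only guarantee that some matching
-- fits the colours, and it may differ from the original one. So the coloured tree must fix the
-- value of a query under every matching that fits. This is why `Capture` demands correctness for
-- all proper colourings, and why validity asserts only that alike nodes are interchangeable, which
-- can be said without ∼, and never that colours are the actual types. The exchange works because y
-- and z, when distinct and equivalent, lie on opposite sides: x shares the side of one of them, and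
-- the other can be replaced across the cut. Nested queries are handled by induction: the automaton
-- of an outer query reads the colours of the inner ones, and the types that it yields are added to
-- these colours. Class automata fit the same scheme, since a rejected class of two nodes is a
-- witness of ∃ y z (y ∼ z ∧ φ). The reasoning is constructive; classical steps are licensed by the
-- decidability of truth in a given tree, which the automata provide.

private variable
  d g k m m′ n σ : ℕ
  A L L′ V W X Y : Set

-- Each coordinate keeps both counts that are to be compared, instead of their difference, so that
-- natural numbers suffice and no subtraction enters the monoid.
Weight : ℕ → Set
Weight = Vec (ℕ × ℕ)

addPair : ℕ × ℕ → ℕ × ℕ → ℕ × ℕ
addPair (a , b) (c , d) = a + c , b + d

infixl 6 _⊕_
_⊕_ : ∀ {d} → Weight d → Weight d → Weight d
_⊕_ = Vec.zipWith addPair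

𝟘 : ∀ {d} → Weight d
𝟘 = Vec.replicate _ (0 , 0)

⊕-commutativeMonoid : ℕ → CommutativeMonoid 0ℓ 0ℓ
⊕-commutativeMonoid d = record
  { Carrier = Weight d ; _≈_ = _≡_ ; _∙_ = _⊕_ ; ε = 𝟘
  ; isCommutativeMonoid = record
    { isMonoid = record
      { isSemigroup = record
        { isMagma = isMagma _⊕_
        ; assoc = Vec.zipWith-assoc λ (a , b) (c , d) (e , f) →
            cong₂ _,_ (ℕ.+-assoc a c e) (ℕ.+-assoc b d f) }
      ; identity = Vec.zipWith-identityˡ (λ _ → refl)
                 , Vec.zipWith-identityʳ λ (a , b) → cong₂ _,_ (ℕ.+-identityʳ a) (ℕ.+-identityʳ b) }
    ; comm = Vec.zipWith-comm λ (a , b) (c , d) → cong₂ _,_ (ℕ.+-comm a c) (ℕ.+-comm b d) } }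

module _ {d : ℕ} where
  open CommutativeMonoid (⊕-commutativeMonoid d) public
    using () renaming (assoc to ⊕-assoc; comm to ⊕-comm; identityˡ to ⊕-identityˡ; identityʳ to ⊕-identityʳ)
  open import Algebra.Properties.CommutativeSemigroup
    (CommutativeMonoid.commutativeSemigroup (⊕-commutativeMonoid d)) public
    using () renaming (interchange to ⊕-interchange; x∙yz≈y∙xz to ⊕-left-comm; xy∙z≈xz∙y to ⊕-right-comm)

Subset : ℕ → Set₁
Subset d = Weight d → Set

infix 4 _⊑_
_⊑_ : ∀ {d} → Subset d → Subset d → Set
P ⊑ Q = ∀ {v} → P v → Q v

infixr 5 _∷⟨_⟩_
-- The sum is carried by an equation because an index of the form `u ⊕ w` would block unification
-- when membership proofs are matched.
data Star {d} (P : Subset d) : Subset d where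
  []     : Star P 𝟘
  _∷⟨_⟩_ : ∀ {u v w} → P u → v ≡ u ⊕ w → Star P w → Star P v

_⊙_ : ∀ {d} → Subset d → Subset d → Subset d
(P ⊙ Q) v = ∃[ u ] ∃[ w ] v ≡ u ⊕ w × P u × Q w

Star-map : ∀ {d} {P Q : Subset d} → P ⊑ Q → Star P ⊑ Star Q
Star-map f []             = []
Star-map f (p ∷⟨ e ⟩ ps) = f p ∷⟨ e ⟩ Star-map f ps

Star-++ : ∀ {d} {P : Subset d} {u w} → Star P u → Star P w → Star P (u ⊕ w)
Star-++ {w = w} []             qs = subst (Star _) (sym (⊕-identityˡ w)) qs
Star-++ (p ∷⟨ refl ⟩ ps) qs = p ∷⟨ ⊕-assoc _ _ _ ⟩ Star-++ ps qs

Star-[_] : ∀ {d} {P : Subset d} → P ⊑ Star P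
Star-[ p ] = p ∷⟨ sym (⊕-identityʳ _) ⟩ []

infixl 6 _∪_
infixl 7 _·_
data RE (d : ℕ) (V : Set) : Set where
  ∅       : RE d V
  con     : Weight d → RE d V
  var     : V → RE d V
  _∪_ _·_ : RE d V → RE d V → RE d V
  _*      : RE d V → RE d V

⟦_⟧ᴿ : ∀ {d V} → RE d V → (V → Subset d) → Subset d
⟦ ∅ ⟧ᴿ     ρ v = ⊥
⟦ con u ⟧ᴿ ρ v = v ≡ u
⟦ var x ⟧ᴿ ρ v = ρ x v
⟦ E ∪ F ⟧ᴿ ρ v = ⟦ E ⟧ᴿ ρ v ⊎ ⟦ F ⟧ᴿ ρ v
⟦ E · F ⟧ᴿ ρ   = ⟦ E ⟧ᴿ ρ ⊙ ⟦ F ⟧ᴿ ρ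
⟦ E * ⟧ᴿ   ρ   = Star (⟦ E ⟧ᴿ ρ)


⟦⟧ᴿ-mono : (E : RE d V) {ρ ρ′ : V → Subset d} → (∀ x → ρ x ⊑ ρ′ x) → ⟦ E ⟧ᴿ ρ ⊑ ⟦ E ⟧ᴿ ρ′
⟦⟧ᴿ-mono (con _) h p = p
⟦⟧ᴿ-mono (var x) h p = h x p
⟦⟧ᴿ-mono (E ∪ F) h (inj₁ p) = inj₁ (⟦⟧ᴿ-mono E h p)
⟦⟧ᴿ-mono (E ∪ F) h (inj₂ p) = inj₂ (⟦⟧ᴿ-mono F h p)
⟦⟧ᴿ-mono (E · F) h (_ , _ , e , p , q) = _ , _ , e , ⟦⟧ᴿ-mono E h p , ⟦⟧ᴿ-mono F h q
⟦⟧ᴿ-mono (E *) h p = Star-map (⟦⟧ᴿ-mono E h) p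

_[_] : RE d V → (V → RE d W) → RE d W
∅       [ σ ] = ∅
con u   [ σ ] = con u
var x   [ σ ] = σ x
(E ∪ F) [ σ ] = (E [ σ ]) ∪ (F [ σ ])
(E · F) [ σ ] = (E [ σ ]) · (F [ σ ])
(E *)   [ σ ] = (E [ σ ]) *

module _ {σ : V → RE d W} {ρ : W → Subset d} where
  subst⇒ : ∀ E → ⟦ E [ σ ] ⟧ᴿ ρ ⊑ ⟦ E ⟧ᴿ (λ x → ⟦ σ x ⟧ᴿ ρ)
  subst⇒ (con _) p = p
  subst⇒ (var x) p = p
  subst⇒ (E ∪ F) (inj₁ p) = inj₁ (subst⇒ E p)
  subst⇒ (E ∪ F) (inj₂ p) = inj₂ (subst⇒ F p)
  subst⇒ (E · F) (_ , _ , e , p , q) = _ , _ , e , subst⇒ E p , subst⇒ F q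
  subst⇒ (E *) p = Star-map (subst⇒ E) p

  subst⇐ : ∀ E → ⟦ E ⟧ᴿ (λ x → ⟦ σ x ⟧ᴿ ρ) ⊑ ⟦ E [ σ ] ⟧ᴿ ρ
  subst⇐ (con _) p = p
  subst⇐ (var x) p = p
  subst⇐ (E ∪ F) (inj₁ p) = inj₁ (subst⇐ E p)
  subst⇐ (E ∪ F) (inj₂ p) = inj₂ (subst⇐ F p)
  subst⇐ (E · F) (_ , _ , e , p , q) = _ , _ , e , subst⇐ E p , subst⇐ F q
  subst⇐ (E *) p = Star-map (subst⇐ E) p

infixr 5 _▸_
_▸_ : ∀ {a} {A : Set a} → A → (Fin n → A) → Fin (suc n) → A
(x ▸ f) zero    = x
(x ▸ f) (suc i) = f i

-- Modulo commutativity, E = E [ x := ∅ ] ∪ ∂ E · x for the variable x = zero.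
∂ : RE d (Fin (suc n)) → RE d (Fin (suc n))
∂ ∅             = ∅
∂ (con _)       = ∅
∂ (var zero)    = con 𝟘
∂ (var (suc _)) = ∅
∂ (E ∪ F)       = ∂ E ∪ ∂ F
∂ (E · F)       = ∂ E · F ∪ ∂ F · E
∂ (E *)         = E * · ∂ E

constant : RE d (Fin (suc n)) → RE d (Fin n)
constant E = E [ ∅ ▸ var ]

module _ {ρ : Fin n → Subset d} {X : Subset d} where
  ∂-sound : ∀ E → ⟦ ∂ E ⟧ᴿ (X ▸ ρ) ⊙ X ⊑ ⟦ E ⟧ᴿ (X ▸ ρ)
  ∂-sound (var zero) (_ , w , refl , refl , q) = subst X (sym (⊕-identityˡ w)) q
  ∂-sound (E ∪ F) (_ , _ , e , inj₁ p , q) = inj₁ (∂-sound E (_ , _ , e , p , q))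
  ∂-sound (E ∪ F) (_ , _ , e , inj₂ p , q) = inj₂ (∂-sound F (_ , _ , e , p , q))
  ∂-sound (E · F) (_ , _ , refl , inj₁ (a , b , refl , p , p′) , q) =
    _ , _ , ⊕-right-comm a b _ , ∂-sound E (_ , _ , refl , p , q) , p′
  ∂-sound (E · F) (_ , _ , refl , inj₂ (a , b , refl , p , p′) , q) =
    _ , _ , trans (cong (_⊕ _) (⊕-comm a b)) (⊕-assoc b a _) , p′ , ∂-sound F (_ , _ , refl , p , q)
  ∂-sound (E *) (_ , _ , refl , (a , b , refl , p , p′) , q) =
    subst (Star _) (sym (⊕-assoc a b _)) (Star-++ p Star-[ ∂-sound E (_ , _ , refl , p′ , q) ])

  constant-sound : ∀ E → ⟦ constant E ⟧ᴿ ρ ⊑ ⟦ E ⟧ᴿ (X ▸ ρ)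
  constant-sound E p = ⟦⟧ᴿ-mono E (λ { zero () ; (suc _) → id }) (subst⇒ E p)

  -- If a derivation uses the variable at all, one of its occurrences commutes to the end; what
  -- remains is derived from `∂ E`, in which the variable may occur again. `decompose*` is separate
  -- because it recurs on the derivation of the star while the expression stays the same.
  decompose : ∀ E → ⟦ E ⟧ᴿ (X ▸ ρ) ⊑ λ v → ⟦ constant E ⟧ᴿ ρ v ⊎ (⟦ ∂ E ⟧ᴿ (X ▸ ρ) ⊙ X) v
  decompose* : ∀ E → ⟦ E * ⟧ᴿ (X ▸ ρ) ⊑ λ v → ⟦ constant (E *) ⟧ᴿ ρ v ⊎ (⟦ ∂ (E *) ⟧ᴿ (X ▸ ρ) ⊙ X) v
  decompose (con _) p = inj₁ p
  decompose (var zero) p = inj₂ (_ , _ , sym (⊕-identityˡ _) , refl , p)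
  decompose (var (suc _)) p = inj₁ p
  decompose (E ∪ F) (inj₁ p) with decompose E p
  ... | inj₁ q = inj₁ (inj₁ q)
  ... | inj₂ (_ , _ , e , q , r) = inj₂ (_ , _ , e , inj₁ q , r)
  decompose (E ∪ F) (inj₂ p) with decompose F p
  ... | inj₁ q = inj₁ (inj₂ q)
  ... | inj₂ (_ , _ , e , q , r) = inj₂ (_ , _ , e , inj₂ q , r)
  decompose (E · F) (_ , _ , e , p , p′) with decompose E p | decompose F p′
  decompose (E · F) (_ , _ , e , p , p′) | inj₁ q | inj₁ q′ = inj₁ (_ , _ , e , q , q′)
  decompose (E · F) (_ , _ , refl , p , p′) | inj₂ (a , b , refl , q , r) | _ =
    inj₂ (_ , _ , ⊕-right-comm a b _ , inj₁ (_ , _ , refl , q , p′) , r)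
  decompose (E · F) (_ , _ , refl , p , p′) | inj₁ _ | inj₂ (a , b , refl , q , r) =
    inj₂ (_ , _ , trans (sym (⊕-assoc _ a b)) (cong (_⊕ b) (⊕-comm _ a)) , inj₂ (_ , _ , refl , q , p) , r)
  decompose (E *) p = decompose* E p
  decompose* E [] = inj₁ []
  decompose* E (p ∷⟨ e ⟩ ps) with decompose E p | decompose* E ps
  decompose* E (p ∷⟨ e ⟩ ps) | inj₁ q | inj₁ qs = inj₁ (q ∷⟨ e ⟩ qs)
  decompose* E (p ∷⟨ refl ⟩ ps) | inj₂ (a , b , refl , q , r) | _ =
    inj₂ (_ , _ , trans (⊕-right-comm a b _) (cong (_⊕ b) (⊕-comm a _)) , (_ , _ , refl , ps , q) , r)
  decompose* E (p ∷⟨ refl ⟩ ps) | inj₁ _ | inj₂ (_ , b , refl , (a , c , refl , qs , q) , r) =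
    inj₂ (_ , _ , trans (sym (⊕-assoc _ _ b)) (cong (_⊕ b) (sym (⊕-assoc _ a c)))
             , (_ , _ , refl , p ∷⟨ refl ⟩ qs , q) , r)

-- Least solution (Pilling): x = A ∪ B(x) · x is solved by A · B(A)*.
solve₁ : RE d (Fin (suc n)) → RE d (Fin n)
solve₁ E = constant E · (∂ E [ constant E ▸ var ]) *

module _ {ρ : Fin n → Subset d} where

  ▸-subst⇐ : ∀ (F : RE d (Fin n)) → ∀ x → (⟦ F ⟧ᴿ ρ ▸ ρ) x ⊑ ⟦ (F ▸ var) x ⟧ᴿ ρ
  ▸-subst⇐ F zero    = id
  ▸-subst⇐ F (suc _) = id

  -- Write A for `constant E` and B for `∂ E`. A closed `X` contains A, so B at A lies below B at
  -- `X` by monotonicity, and every further factor of the star is absorbed into `X` by `∂-sound` and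
  -- closedness.
  solve₁-least : ∀ E {X} → ⟦ E ⟧ᴿ (X ▸ ρ) ⊑ X → ⟦ solve₁ E ⟧ᴿ ρ ⊑ X
  solve₁-least E {X} closed (_ , _ , refl , a , bs) = go bs
    where
    A⊑X : ⟦ constant E ⟧ᴿ ρ ⊑ X
    A⊑X p = closed (constant-sound E p)
    B⊑ : ⟦ ∂ E [ constant E ▸ var ] ⟧ᴿ ρ ⊑ ⟦ ∂ E ⟧ᴿ (X ▸ ρ)
    B⊑ p = ⟦⟧ᴿ-mono (∂ E) (λ { zero → A⊑X ; (suc _) → id }) (subst⇒ (∂ E) p)
    go : ∀ {w} → Star (⟦ ∂ E [ constant E ▸ var ] ⟧ᴿ ρ) w → X (_ ⊕ w)
    go []              = subst X (sym (⊕-identityʳ _)) (A⊑X a)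
    go (b ∷⟨ refl ⟩ bs) = subst X (⊕-left-comm _ _ _)
      (closed (∂-sound E (_ , _ , refl , B⊑ b , go bs)))

  -- This is where commutativity makes Pilling's formula a solution: every occurrence of the
  -- variable brings its own factor from `Star S`, and all these factors move to the end and merge
  -- into a single one.
  absorb : ∀ {A S : Subset d} (G : RE d (Fin (suc n))) →
    ⟦ G ⟧ᴿ ((A ⊙ Star S) ▸ ρ) ⊑ ⟦ G ⟧ᴿ (A ▸ ρ) ⊙ Star S
  absorb (con _) p = _ , _ , sym (⊕-identityʳ _) , p , []
  absorb (var zero) p = p
  absorb (var (suc _)) p = _ , _ , sym (⊕-identityʳ _) , p , []
  absorb (E ∪ F) (inj₁ p) with absorb E p
  ... | _ , _ , e , q , s = _ , _ , e , inj₁ q , s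
  absorb (E ∪ F) (inj₂ p) with absorb F p
  ... | _ , _ , e , q , s = _ , _ , e , inj₂ q , s
  absorb (E · F) (_ , _ , refl , p , p′) with absorb E p | absorb F p′
  ... | _ , _ , refl , q , s | _ , _ , refl , q′ , s′ =
    _ , _ , ⊕-interchange _ _ _ _ , (_ , _ , refl , q , q′) , Star-++ s s′
  absorb (E *) [] = _ , _ , sym (⊕-identityʳ _) , [] , []
  absorb (E *) (p ∷⟨ refl ⟩ ps) with absorb E p | absorb (E *) ps
  ... | _ , _ , refl , q , s | _ , _ , refl , q′ , s′ =
    _ , _ , ⊕-interchange _ _ _ _ , q ∷⟨ refl ⟩ q′ , Star-++ s s′

  solve₁-closed : ∀ E → ⟦ E ⟧ᴿ (⟦ solve₁ E ⟧ᴿ ρ ▸ ρ) ⊑ ⟦ solve₁ E ⟧ᴿ ρ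
  solve₁-closed E p with decompose E p
  ... | inj₁ a = _ , _ , sym (⊕-identityʳ _) , a , []
  ... | inj₂ (_ , _ , refl , b , (_ , _ , refl , a , s)) with absorb (∂ E) b
  ...   | _ , _ , refl , g , s′ = _ , _ , ⊕-left-comm _ _ _ , a ,
    Star-++ (Star-++ Star-[ subst⇐ (∂ E) (⟦⟧ᴿ-mono (∂ E) (▸-subst⇐ (constant E)) g) ] s′) s

∅ᵉ : ⊥ → Subset d
∅ᵉ ()

System : ℕ → Set → Set
System d V = V → RE d V

Closed : System d V → (V → Subset d) → Set
Closed E ρ = ∀ x → ⟦ E x ⟧ᴿ ρ ⊑ ρ x

-- Leastness ranges over arbitrary predicates and not only over those given by expressions. It
-- thereby serves as the induction principle of the system: `Run` and `Yield` below are such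
-- predicates.
record LeastSolution (E : System d V) : Set₁ where
  field
    solution : V → RE d ⊥
  value : V → Subset d
  value x = ⟦ solution x ⟧ᴿ ∅ᵉ
  field
    closed   : Closed E value
    least    : ∀ {ρ} → Closed E ρ → ∀ x → value x ⊑ ρ x

-- Gaussian elimination: the first equation is solved with the other variables as parameters, its
-- solution is substituted into the remaining equations, and their solution is substituted back.
solveFin : ∀ n (E : System d (Fin n)) → LeastSolution E
solveFin zero    E = record { solution = λ () ; closed = λ () ; least = λ _ () }
solveFin {d} (suc n) E = record { solution = F₀ ▸ solution rest ; closed = λ { zero → closed₀ ; (suc i) → closedₛ i } ; least = leastₛ }
  where
  open LeastSolution
  F : RE d (Fin n)
  F = solve₁ (E zero)
  E′ : System d (Fin n)
  E′ i = E (suc i) [ F ▸ var ]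
  rest : LeastSolution E′
  rest = solveFin n E′
  F₀ : RE d ⊥
  F₀ = F [ solution rest ]
  val : Fin (suc n) → Subset d
  val x = ⟦ (F₀ ▸ solution rest) x ⟧ᴿ ∅ᵉ
  val⊑ : ∀ x → val x ⊑ (⟦ F ⟧ᴿ (value rest) ▸ value rest) x
  val⊑ zero    = subst⇒ F
  val⊑ (suc _) = id
  closed₀ : ⟦ E zero ⟧ᴿ val ⊑ val zero
  closed₀ p = subst⇐ F (solve₁-closed (E zero) (⟦⟧ᴿ-mono (E zero) val⊑ p))
  closedₛ : ∀ i → ⟦ E (suc i) ⟧ᴿ val ⊑ val (suc i)
  closedₛ i p = closed rest i (subst⇐ (E (suc i)) (⟦⟧ᴿ-mono (E (suc i)) (▸-subst⇐ F) (⟦⟧ᴿ-mono (E (suc i)) val⊑ p)))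
  leastₛ : ∀ {ρ} → Closed E ρ → ∀ x → val x ⊑ ρ x
  leastₛ {ρ} h = λ { zero p → F⊑ (⟦⟧ᴿ-mono F rest⊑ (subst⇒ F p)) ; (suc i) → rest⊑ i }
    where
    F⊑ : ⟦ F ⟧ᴿ (ρ ∘ suc) ⊑ ρ zero
    F⊑ = solve₁-least (E zero) λ p → h zero (⟦⟧ᴿ-mono (E zero) (λ { zero → id ; (suc _) → id }) p)
    rest⊑ : ∀ i → value rest i ⊑ ρ (suc i)
    rest⊑ = least rest λ i p → h (suc i) (⟦⟧ᴿ-mono (E (suc i))
      (λ { zero q → F⊑ q ; (suc _) → id }) (subst⇒ (E (suc i)) p))

-- Semilinear sets and balanced weights

-- The list may contain repetitions, so `index` is only a section of `at`; the type is a retract of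
-- `Fin size`.
record Finite (A : Set) : Set where
  infix 4 _≟_
  field
    elements : List A
    complete : ∀ x → x ∈ elements
    _≟_      : DecidableEquality A

  size : ℕ
  size = List.length elements

  index : A → Fin size
  index x = Any.index (complete x)

  at : Fin size → A
  at = List.lookup elements

  at-index : ∀ x → at (index x) ≡ x
  at-index x = sym (Any.lookup-index (complete x))

  ∃? : ∀ {P : A → Set} → (∀ x → Dec (P x)) → Dec (∃ P)
  ∃? P? = map′ Any.satisfied (λ (x , p) → Any.map (λ { refl → p }) (complete x)) (Any.any? P? elements)


module _ (fin : Finite V) (E : System d V) where
  open Finite fin
  open LeastSolution

  solve : LeastSolution E
  solve = record
    { solution = solution indexed ∘ index
    ; closed = closed′
    ; least = λ {ρ} h x p → subst (λ y → ρ y _) (at-index x) (least indexed (least′ ρ h) (index x) p) }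
    where
    E′ : System d (Fin size)
    E′ i = E (at i) [ var ∘ index ]
    indexed : LeastSolution E′
    indexed = solveFin size E′
    closed′ : Closed E (value indexed ∘ index)
    closed′ x p = closed indexed (index x) (subst⇐ (E (at (index x)))
      (subst (λ y → ⟦ E y ⟧ᴿ (value indexed ∘ index) _) (sym (at-index x)) p))
    least′ : ∀ ρ → Closed E ρ → Closed E′ (ρ ∘ at)
    least′ ρ h i p = h (at i) (⟦⟧ᴿ-mono (E (at i)) (λ x → subst (λ y → ρ y _) (at-index x)) (subst⇒ (E (at i)) p))

Fin-finite : ∀ n → Finite (Fin n)
Fin-finite n = record { elements = List.allFin n ; complete = ∈.∈-allFin ; _≟_ = Fin._≟_ }

⋃ : ∀ {I : Set} → List I → (I → RE d V) → RE d V
⋃ []       f = ∅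
⋃ (i ∷ is) f = f i ∪ ⋃ is f

guard : ∀ {P : Set} → Dec P → RE d V → RE d V
guard (yes _) E = E
guard (no _)  E = ∅

module _ {ρ : V → Subset d} {v : Weight d} where
  ⋃⁺ : ∀ {I : Set} {is : List I} {f i} → i ∈ is → ⟦ f i ⟧ᴿ ρ v → ⟦ ⋃ is f ⟧ᴿ ρ v
  ⋃⁺ (here refl) p = inj₁ p
  ⋃⁺ (there i∈)  p = inj₂ (⋃⁺ i∈ p)

  ⋃⁻ : ∀ {I : Set} (is : List I) {f} → ⟦ ⋃ is f ⟧ᴿ ρ v → ∃[ i ] i ∈ is × ⟦ f i ⟧ᴿ ρ v
  ⋃⁻ (i ∷ is) (inj₁ p) = i , here refl , p
  ⋃⁻ (i ∷ is) (inj₂ p) with ⋃⁻ is p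
  ... | j , j∈ , q = j , there j∈ , q

  guard⁺ : ∀ {P : Set} {P? : Dec P} {E} → P → ⟦ E ⟧ᴿ ρ v → ⟦ guard P? E ⟧ᴿ ρ v
  guard⁺ {P? = yes _} p q = q
  guard⁺ {P? = no ¬p} p q = ⊥-elim (¬p p)

  guard⁻ : ∀ {P : Set} {P? : Dec P} {E} → ⟦ guard P? E ⟧ᴿ ρ v → P × ⟦ E ⟧ᴿ ρ v
  guard⁻ {P? = yes p} q = p , q

-- (b , P) represents the linear set b + P*.
Linear : ℕ → Set
Linear d = Weight d × List (Weight d)

⟦_⟧ᴸ : Linear d → Subset d
⟦ b , P ⟧ᴸ = (_≡ b) ⊙ Star (_∈ P)

⟦_⟧ˢ : List (Linear d) → Subset d
⟦ S ⟧ˢ v = ∃[ l ] l ∈ S × ⟦ l ⟧ᴸ v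

_⊕ᴸ_ : Linear d → Linear d → Linear d
(b , P) ⊕ᴸ (c , Q) = b ⊕ c , P ++ Q

-- (b + P*)* = 0 ∪ (b + {b} ∪ P)*, and stars distribute over unions.
starˢ : List (Linear d) → List (Linear d)
starˢ []            = (𝟘 , []) ∷ []
starˢ ((b , P) ∷ S) = starˢ S ++ List.map ((b , b ∷ P) ⊕ᴸ_) (starˢ S)

semilinear : RE d ⊥ → List (Linear d)
semilinear ∅       = []
semilinear (con u) = (u , []) ∷ []
semilinear (E ∪ F) = semilinear E ++ semilinear F
semilinear (E · F) = List.cartesianProductWith _⊕ᴸ_ (semilinear E) (semilinear F)
semilinear (E *)   = starˢ (semilinear E)

Star-split : ∀ {P Q R : Subset d} → (∀ {v} → P v → Q v ⊎ R v) → Star P ⊑ Star Q ⊙ Star R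
Star-split f [] = _ , _ , sym (⊕-identityˡ _) , [] , []
Star-split f (p ∷⟨ refl ⟩ ps) with f p | Star-split f ps
... | inj₁ q | _ , _ , refl , qs , rs = _ , _ , sym (⊕-assoc _ _ _) , q ∷⟨ refl ⟩ qs , rs
... | inj₂ r | _ , _ , refl , qs , rs = _ , _ , ⊕-left-comm _ _ _ , qs , r ∷⟨ refl ⟩ rs

⊕ᴸ⁻ : ∀ (l m : Linear d) → ⟦ l ⊕ᴸ m ⟧ᴸ ⊑ ⟦ l ⟧ᴸ ⊙ ⟦ m ⟧ᴸ
⊕ᴸ⁻ (b , P) (c , Q) (_ , _ , refl , refl , s) with Star-split (∈.∈-++⁻ P) s
... | _ , _ , refl , p , q = _ , _ , ⊕-interchange _ _ _ _ , (_ , _ , refl , refl , p) , (_ , _ , refl , refl , q)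

⊕ᴸ⁺ : ∀ (l m : Linear d) → ⟦ l ⟧ᴸ ⊙ ⟦ m ⟧ᴸ ⊑ ⟦ l ⊕ᴸ m ⟧ᴸ
⊕ᴸ⁺ (b , P) (c , Q) (_ , _ , refl , (_ , _ , refl , refl , p) , (_ , _ , refl , refl , q)) =
  _ , _ , ⊕-interchange _ _ _ _ , refl , Star-++ (Star-map ∈.∈-++⁺ˡ p) (Star-map (∈.∈-++⁺ʳ P) q)

starˢ⁻ : ∀ (S : List (Linear d)) → ⟦ starˢ S ⟧ˢ ⊑ Star ⟦ S ⟧ˢ
starˢ⁻ [] (_ , here refl , (_ , _ , e , refl , [])) = subst (Star _) (sym (trans e (⊕-identityˡ _))) []
starˢ⁻ ((b , P) ∷ S) (l , l∈ , p) with ∈.∈-++⁻ (starˢ S) l∈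
... | inj₁ l∈S = Star-map (λ (m , m∈ , q) → m , there m∈ , q) (starˢ⁻ S (l , l∈S , p))
... | inj₂ l∈m with ∈.∈-map⁻ ((b , b ∷ P) ⊕ᴸ_) l∈m
...   | m , m∈ , refl with ⊕ᴸ⁻ (b , b ∷ P) m p
...     | _ , _ , refl , (_ , _ , refl , refl , s) , q =
  Star-++ (Star-map (λ r → (b , P) , here refl , r) (unfold (_ , _ , sym (⊕-identityʳ b) , refl , []) s))
          (Star-map (λ (m , m∈ , q) → m , there m∈ , q) (starˢ⁻ S (m , m∈ , q)))
  where
  -- The element `u` is the block under construction: a period `b` closes it and opens a new block,
  -- whereas a period from `P` is added to it.
  unfold : ∀ {u w} → ⟦ b , P ⟧ᴸ u → Star (_∈ b ∷ P) w → Star ⟦ b , P ⟧ᴸ (u ⊕ w)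
  unfold p [] = p ∷⟨ refl ⟩ []
  unfold p (here refl ∷⟨ refl ⟩ s) = p ∷⟨ refl ⟩ unfold (_ , _ , sym (⊕-identityʳ b) , refl , []) s
  unfold (_ , _ , refl , refl , q) (there x ∷⟨ refl ⟩ s) = subst (Star _) (⊕-assoc _ _ _)
    (unfold (_ , _ , ⊕-assoc _ _ _ , refl , Star-++ q Star-[ x ]) s)

starˢ⁺ : ∀ (S : List (Linear d)) → Star ⟦ S ⟧ˢ ⊑ ⟦ starˢ S ⟧ˢ
starˢ⁺ [] [] = _ , here refl , (_ , _ , sym (⊕-identityˡ _) , refl , [])
starˢ⁺ [] ((_ , () , _) ∷⟨ _ ⟩ _)
starˢ⁺ ((b , P) ∷ S) s with Star-split (λ { (_ , here refl , q) → inj₁ q ; (m , there m∈ , q) → inj₂ (m , m∈ , q) }) s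
... | _ , _ , refl , s₁ , s₂ with starˢ⁺ S s₂
...   | l , l∈ , q with collect s₁
  where
  -- In a nonempty sum of blocks, one copy of `b` is the base and all other copies count as periods.
  collect : Star ⟦ b , P ⟧ᴸ ⊑ λ v → v ≡ 𝟘 ⊎ ⟦ b , b ∷ P ⟧ᴸ v
  collect [] = inj₁ refl
  collect ((_ , _ , refl , refl , p) ∷⟨ refl ⟩ ps) with collect ps
  ... | inj₁ refl = inj₂ (_ , _ , ⊕-identityʳ _ , refl , Star-map there p)
  ... | inj₂ (_ , _ , refl , refl , q) =
    inj₂ (_ , _ , ⊕-assoc _ _ _ , refl , Star-++ (Star-map there p) (here refl ∷⟨ refl ⟩ q))
...     | inj₁ refl = l , ∈.∈-++⁺ˡ l∈ , subst ⟦ l ⟧ᴸ (sym (⊕-identityˡ _)) q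
...     | inj₂ p = _ , ∈.∈-++⁺ʳ (starˢ S) (∈.∈-map⁺ _ l∈) , ⊕ᴸ⁺ (b , b ∷ P) l (_ , _ , refl , p , q)

semilinear⁻ : ∀ (E : RE d ⊥) → ⟦ semilinear E ⟧ˢ ⊑ ⟦ E ⟧ᴿ ∅ᵉ
semilinear⁻ (con u) (_ , here refl , (_ , _ , e , refl , [])) = trans e (⊕-identityʳ u)
semilinear⁻ (con u) (_ , here refl , (_ , _ , e , refl , (() ∷⟨ _ ⟩ _)))
semilinear⁻ (E ∪ F) (l , l∈ , p) with ∈.∈-++⁻ (semilinear E) l∈
... | inj₁ l∈E = inj₁ (semilinear⁻ E (l , l∈E , p))
... | inj₂ l∈F = inj₂ (semilinear⁻ F (l , l∈F , p))
semilinear⁻ (E · F) (_ , l∈ , p) with ∈.∈-cartesianProductWith⁻ _⊕ᴸ_ (semilinear E) (semilinear F) l∈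
... | l , m , l∈E , m∈F , refl with ⊕ᴸ⁻ l m p
...   | _ , _ , e , q , r = _ , _ , e , semilinear⁻ E (l , l∈E , q) , semilinear⁻ F (m , m∈F , r)
semilinear⁻ (E *) p = Star-map (semilinear⁻ E) (starˢ⁻ (semilinear E) p)

semilinear⁺ : ∀ (E : RE d ⊥) → ⟦ E ⟧ᴿ ∅ᵉ ⊑ ⟦ semilinear E ⟧ˢ
semilinear⁺ (con u) p = _ , here refl , (_ , _ , trans p (sym (⊕-identityʳ u)) , refl , [])
semilinear⁺ (E ∪ F) (inj₁ p) with semilinear⁺ E p
... | l , l∈ , q = l , ∈.∈-++⁺ˡ l∈ , q
semilinear⁺ (E ∪ F) (inj₂ p) with semilinear⁺ F p
... | l , l∈ , q = l , ∈.∈-++⁺ʳ (semilinear E) l∈ , q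
semilinear⁺ (E · F) (_ , _ , e , p , q) with semilinear⁺ E p | semilinear⁺ F q
... | l , l∈ , p′ | m , m∈ , q′ = _ , ∈.∈-cartesianProductWith⁺ _⊕ᴸ_ l∈ m∈ , ⊕ᴸ⁺ l m (_ , _ , e , p′ , q′)
semilinear⁺ (E *) p = starˢ⁺ (semilinear E) (Star-map (semilinear⁺ E) p)

-- Elimination of one equation between counts

gain loss : Weight (suc d) → ℕ
gain ((a , _) ∷ _) = a
loss ((_ , b) ∷ _) = b

rest : Weight (suc d) → Weight d
rest (_ ∷ w) = w

gain-⊕ : ∀ (u w : Weight (suc d)) → gain (u ⊕ w) ≡ gain u + gain w
gain-⊕ (_ ∷ _) (_ ∷ _) = refl

loss-⊕ : ∀ (u w : Weight (suc d)) → loss (u ⊕ w) ≡ loss u + loss w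
loss-⊕ (_ ∷ _) (_ ∷ _) = refl

rest-⊕ : ∀ (u w : Weight (suc d)) → rest (u ⊕ w) ≡ rest u ⊕ rest w
rest-⊕ (_ ∷ _) (_ ∷ _) = refl

total : List (Weight d) → Weight d
total = List.foldr _⊕_ 𝟘

module _ {P : Subset d} where
  toList : ∀ {v} → Star P v → ∃[ us ] All P us × v ≡ total us
  toList [] = [] , [] , refl
  toList (p ∷⟨ refl ⟩ ps) with toList ps
  ... | us , qs , refl = _ ∷ us , p ∷ qs , refl

  fromList : ∀ {us} → All P us → Star P (total us)
  fromList []       = []
  fromList (p ∷ ps) = p ∷⟨ refl ⟩ fromList ps

  pick : ∀ {Q : Subset d} → (∀ u → Dec (Q u)) → ∀ us → All P us →
    (∃[ u ] ∃[ us′ ] P u × Q u × All P us′ × total us ≡ u ⊕ total us′ × List.length us ≡ suc (List.length us′))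
    ⊎ All (λ u → ¬ Q u) us
  pick Q? [] [] = inj₂ []
  pick Q? (u ∷ us) (p ∷ ps) with Q? u
  ... | yes q = inj₁ (u , us , p , q , ps , refl , refl)
  ... | no ¬q with pick Q? us ps
  ...   | inj₁ (w , ws , p′ , q , ps′ , e , l) =
    inj₁ (w , u ∷ ws , p′ , q , p ∷ ps′ , trans (cong (u ⊕_) e) (⊕-left-comm _ _ _) , cong suc l)
  ...   | inj₂ ¬qs = inj₂ (¬q ∷ ¬qs)

total-≤ : ∀ {us : List (Weight (suc d))} → All (λ u → gain u ≤ loss u) us → gain (total us) ≤ loss (total us)
total-≤ [] = ℕ.≤-refl
total-≤ {us = u ∷ us} (p ∷ ps) rewrite gain-⊕ u (total us) | loss-⊕ u (total us) = ℕ.+-mono-≤ p (total-≤ ps)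

total-≥ : ∀ {us : List (Weight (suc d))} → All (λ u → loss u ≤ gain u) us → loss (total us) ≤ gain (total us)
total-≥ [] = ℕ.≤-refl
total-≥ {us = u ∷ us} (p ∷ ps) rewrite gain-⊕ u (total us) | loss-⊕ u (total us) = ℕ.+-mono-≤ p (total-≥ ps)

-- The elements of b + P* whose first coordinate is balanced.  The summands can be
-- ordered so that a counter tracking the first coordinate, started at bound, stays
-- within [0 , 2 · bound]; the runs of this counter form a system of equations.
module Counter {d : ℕ} (b : Weight (suc d)) (P : List (Weight (suc d))) (bound : ℕ) where

  Count : Set
  Count = Fin (suc (bound + bound))

  move : ∀ (u : Weight (suc d)) (c c′ : Count) → Dec (toℕ c + gain u ≡ toℕ c′ + loss u)
  move u c c′ = toℕ c + gain u ℕ.≟ toℕ c′ + loss u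

  halt : System d Count
  halt c = guard (toℕ c ℕ.≟ bound) (con 𝟘)

  advance : Weight (suc d) → Count → Count → RE d Count
  advance u c c′ = guard (move u c c′) (con (rest u) · var c′)

  equations : System d Count
  equations c = halt c ∪ ⋃ P λ u → ⋃ (List.allFin _) λ c′ → advance u c c′

  module _ (∈-bound : ∀ {u} → u ∈ b ∷ P → gain u ≤ bound × loss u ≤ bound) (sol : LeastSolution equations) where
    open LeastSolution sol

    -- The invariant of the counter: `w` leads from `c` back to `bound`, written without
    -- subtraction, and the first coordinate is forgotten.
    Run : Count → Subset d
    Run c v = ∃[ w ] Star (_∈ P) w × v ≡ rest w × toℕ c + gain w ≡ bound + loss w

    sound : ∀ c → value c ⊑ Run c
    sound = least λ { c (inj₁ h) → stop c h ; c (inj₂ q) → go c q }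
      where
      stop : ∀ c → ⟦ halt c ⟧ᴿ Run ⊑ Run c
      stop c h with guard⁻ {P? = toℕ c ℕ.≟ bound} h
      ... | e , refl = 𝟘 , [] , refl , cong (_+ 0) e
      go : ∀ c → ⟦ ⋃ P (λ u → ⋃ (List.allFin _) λ c′ → advance u c c′) ⟧ᴿ Run ⊑ Run c
      go c q with ⋃⁻ P q
      ... | u , u∈ , r with ⋃⁻ (List.allFin _) r
      ...   | c′ , _ , r with guard⁻ {P? = move u c c′} r
      ...     | e , (_ , _ , refl , refl , (w , s , refl , e′)) =
        u ⊕ w , u∈ ∷⟨ refl ⟩ s , sym (rest-⊕ u w) , (begin
          toℕ c + gain (u ⊕ w)       ≡⟨ cong (toℕ c +_) (gain-⊕ u w) ⟩
          toℕ c + (gain u + gain w)   ≡⟨ ℕ.+-assoc (toℕ c) _ _ ⟨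
          toℕ c + gain u + gain w     ≡⟨ cong (_+ gain w) e ⟩
          toℕ c′ + loss u + gain w    ≡⟨ xy∙z≈xz∙y (toℕ c′) (loss u) _ ⟩
          toℕ c′ + gain w + loss u    ≡⟨ cong (_+ loss u) e′ ⟩
          bound + loss w + loss u     ≡⟨ xy∙z≈x∙zy bound (loss w) _ ⟩
          bound + (loss u + loss w)   ≡⟨ cong (bound +_) (loss-⊕ u w) ⟨
          bound + loss (u ⊕ w)       ∎)
        where open ≡-Reasoning
              open import Algebra.Properties.CommutativeSemigroup ℕ.+-commutativeSemigroup

    successor : ∀ (u : Weight (suc d)) (c : ℕ) → loss u ≤ c + gain u → c + gain u ∸ loss u ≤ bound + bound →
      ∃[ c′ ] c + gain u ≡ toℕ {suc (bound + bound)} c′ + loss u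
    successor u c h h′ = Fin.fromℕ< (s≤s h′) ,
      trans (sym (ℕ.m∸n+n≡m h)) (cong (_+ loss u) (sym (Fin.toℕ-fromℕ< (s≤s h′))))

    -- While the counter is at most `bound`, some remaining summand does not lower it, since
    -- otherwise the run would end strictly below `bound`; adding this summand raises the counter by
    -- at most `bound`. Above `bound`, symmetrically, some summand does not raise it, and it lowers
    -- the counter by at most `bound`. So the counter never leaves its range. The recursion is on
    -- the number of summands because their order changes.
    greedy : ∀ k us → List.length us ≡ k → All (_∈ P) us → ∀ c →
      toℕ c + gain (total us) ≡ bound + loss (total us) → value c (rest (total us))
    greedy _ [] _ _ c e = closed c (inj₁ (guard⁺ {P? = toℕ c ℕ.≟ bound} (ℕ.+-cancelʳ-≡ 0 (toℕ c) bound e) refl))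
    greedy (suc k) us@(u₀ ∷ us₀) l ps c e = continue choose
      where
      Step : Set
      Step = ∃[ u ] ∃[ us′ ] u ∈ P × All (_∈ P) us′ × total us ≡ u ⊕ total us′ × List.length us ≡ suc (List.length us′)
        × ∃[ c′ ] toℕ c + gain u ≡ toℕ {suc (bound + bound)} c′ + loss u
      strict-< : All {A = Weight (suc d)} (λ u → ¬ loss u ≤ gain u) us → gain (total us) < loss (total us)
      strict-< (q ∷ qs) rewrite gain-⊕ u₀ (total us₀) | loss-⊕ u₀ (total us₀) =
        ℕ.+-mono-<-≤ (ℕ.≰⇒> q) (total-≤ (All.map (ℕ.<⇒≤ ∘ ℕ.≰⇒>) qs))
      strict-> : All {A = Weight (suc d)} (λ u → ¬ gain u ≤ loss u) us → loss (total us) < gain (total us)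
      strict-> (q ∷ qs) rewrite gain-⊕ u₀ (total us₀) | loss-⊕ u₀ (total us₀) =
        ℕ.+-mono-<-≤ (ℕ.≰⇒> q) (total-≥ (All.map (ℕ.<⇒≤ ∘ ℕ.≰⇒>) qs))
      choose : Step
      choose with toℕ c ℕ.≤? bound
      ... | yes c≤ with pick (λ u → loss u ℕ.≤? gain u) us ps
      ...   | inj₂ qs = ⊥-elim (ℕ.<⇒≢ (ℕ.+-mono-≤-< c≤ (strict-< qs)) e)
      ...   | inj₁ (u , us′ , u∈ , q , ps′ , t , l′) = u , us′ , u∈ , ps′ , t , l′ ,
        successor u (toℕ c) (ℕ.≤-trans q (ℕ.m≤n+m _ _))
          (ℕ.≤-trans (ℕ.m∸n≤m _ (loss u)) (ℕ.+-mono-≤ c≤ (proj₁ (∈-bound (there u∈)))))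
      choose | no c≰ with pick (λ u → gain u ℕ.≤? loss u) us ps
      ...   | inj₂ qs = ⊥-elim (ℕ.<⇒≢ (ℕ.+-mono-<-≤ (ℕ.≰⇒> c≰) (ℕ.<⇒≤ (strict-> qs))) (sym e))
      ...   | inj₁ (u , us′ , u∈ , q , ps′ , t , l′) = u , us′ , u∈ , ps′ , t , l′ ,
        successor u (toℕ c) (ℕ.≤-trans (proj₂ (∈-bound (there u∈))) (ℕ.≤-trans (ℕ.<⇒≤ (ℕ.≰⇒> c≰)) (ℕ.m≤m+n _ _)))
          (begin
            toℕ c + gain u ∸ loss u ≤⟨ ℕ.∸-monoˡ-≤ (loss u) (ℕ.+-monoʳ-≤ (toℕ c) q) ⟩
            toℕ c + loss u ∸ loss u ≡⟨ ℕ.m+n∸n≡m (toℕ c) (loss u) ⟩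
            toℕ c                 ≤⟨ ℕ.≤-pred (Fin.toℕ<n c) ⟩
            bound + bound         ∎)
        where open ℕ.≤-Reasoning
      continue : Step → value c (rest (total us))
      continue (u , us′ , u∈ , ps′ , t , l′ , c′ , e′) = closed c (inj₂
        (⋃⁺ u∈ (⋃⁺ (∈.∈-allFin c′) (guard⁺ {P? = move u c c′} e′
          (_ , _ , trans (cong rest t) (rest-⊕ u (total us′)) , refl ,
            greedy k us′ (ℕ.suc-injective (trans (sym l′) l)) ps′ c′ balance)))))
        where
        open ≡-Reasoning
        open import Algebra.Properties.CommutativeSemigroup ℕ.+-commutativeSemigroup
        balance : toℕ c′ + gain (total us′) ≡ bound + loss (total us′)
        balance = ℕ.+-cancelʳ-≡ (loss u) _ _ (begin
          toℕ c′ + gain (total us′) + loss u ≡⟨ xy∙z≈xz∙y (toℕ c′) _ _ ⟩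
          toℕ c′ + loss u + gain (total us′) ≡⟨ cong (_+ gain (total us′)) e′ ⟨
          toℕ c + gain u + gain (total us′)  ≡⟨ ℕ.+-assoc (toℕ c) _ _ ⟩
          toℕ c + (gain u + gain (total us′)) ≡⟨ cong (toℕ c +_) (trans (cong gain t) (gain-⊕ u (total us′))) ⟨
          toℕ c + gain (total us)           ≡⟨ e ⟩
          bound + loss (total us)           ≡⟨ cong (bound +_) (trans (cong loss t) (loss-⊕ u (total us′))) ⟩
          bound + (loss u + loss (total us′)) ≡⟨ x∙yz≈xz∙y bound (loss u) _ ⟩
          bound + loss (total us′) + loss u  ∎)

    start : ∀ (c : Count) → Dec (bound + gain b ≡ toℕ c + loss b)
    start c = bound + gain b ℕ.≟ toℕ c + loss b

    -- The base `b` is charged as the very first move, from `bound` to `c`; this is why the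
    -- hypothesis on `bound` covers `b ∷ P`. A run that ends at `bound` again has total change zero.
    balanced : RE d ⊥
    balanced = ⋃ (List.allFin _) λ c → guard (start c) (con (rest b) · solution c)

    balanced⁻ : ∀ {v} → ⟦ balanced ⟧ᴿ ∅ᵉ v → ∃[ w ] ⟦ b , P ⟧ᴸ w × gain w ≡ loss w × rest w ≡ v
    balanced⁻ p with ⋃⁻ (List.allFin _) p
    ... | c , _ , q with guard⁻ {P? = start c} q
    ...   | e , (_ , _ , refl , refl , r) with sound c r
    ...     | w , s , refl , e′ = b ⊕ w , (_ , _ , refl , refl , s) , balance , rest-⊕ b w
      where
      open ≡-Reasoning
      open import Algebra.Properties.CommutativeSemigroup ℕ.+-commutativeSemigroup
      balance : gain (b ⊕ w) ≡ loss (b ⊕ w)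
      balance = ℕ.+-cancelˡ-≡ bound _ _ (begin
        bound + gain (b ⊕ w)       ≡⟨ cong (bound +_) (gain-⊕ b w) ⟩
        bound + (gain b + gain w)   ≡⟨ ℕ.+-assoc bound _ _ ⟨
        bound + gain b + gain w     ≡⟨ cong (_+ gain w) e ⟩
        toℕ c + loss b + gain w     ≡⟨ xy∙z≈xz∙y (toℕ c) _ _ ⟩
        toℕ c + gain w + loss b     ≡⟨ cong (_+ loss b) e′ ⟩
        bound + loss w + loss b     ≡⟨ xy∙z≈x∙zy bound _ _ ⟩
        bound + (loss b + loss w)   ≡⟨ cong (bound +_) (loss-⊕ b w) ⟨
        bound + loss (b ⊕ w)       ∎)

    balanced⁺ : ∀ {w} → ⟦ b , P ⟧ᴸ w → gain w ≡ loss w → ⟦ balanced ⟧ᴿ ∅ᵉ (rest w)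
    balanced⁺ (_ , w , refl , refl , s) e with toList s
    ... | us , ps , refl with successor b bound
          (ℕ.≤-trans (proj₂ (∈-bound (here refl))) (ℕ.m≤m+n _ _))
          (ℕ.≤-trans (ℕ.m∸n≤m _ (loss b)) (ℕ.+-monoʳ-≤ bound (proj₁ (∈-bound (here refl)))))
    ...   | c , e′ = ⋃⁺ (∈.∈-allFin c) (guard⁺ {P? = start c} e′
      (_ , _ , rest-⊕ b _ , refl , greedy _ us refl ps c balance))
      where
      open ≡-Reasoning
      open import Algebra.Properties.CommutativeSemigroup ℕ.+-commutativeSemigroup
      balance : toℕ c + gain (total us) ≡ bound + loss (total us)
      balance = ℕ.+-cancelʳ-≡ (loss b) _ _ (begin
        toℕ c + gain (total us) + loss b     ≡⟨ xy∙z≈xz∙y (toℕ c) _ _ ⟩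
        toℕ c + loss b + gain (total us)     ≡⟨ cong (_+ gain (total us)) e′ ⟨
        bound + gain b + gain (total us)     ≡⟨ ℕ.+-assoc bound _ _ ⟩
        bound + (gain b + gain (total us))   ≡⟨ cong (bound +_) (trans (sym (gain-⊕ b (total us))) (trans e (loss-⊕ b (total us)))) ⟩
        bound + (loss b + loss (total us))   ≡⟨ x∙yz≈xz∙y bound (loss b) _ ⟩
        bound + loss (total us) + loss b     ∎)

-- A convenient substitute for the maximum of all gains and losses.
sumBound : List (Weight (suc d)) → ℕ
sumBound us = gain (total us) + loss (total us)

≤-sumBound : ∀ {us} {u : Weight (suc d)} → u ∈ us → gain u ≤ sumBound us × loss u ≤ sumBound us
≤-sumBound u∈ = ℕ.≤-trans (proj₁ (go u∈)) (ℕ.m≤m+n _ _) , ℕ.≤-trans (proj₂ (go u∈)) (ℕ.m≤n+m _ _)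
  where
  go : ∀ {us} {u : Weight (suc d)} → u ∈ us → gain u ≤ gain (total us) × loss u ≤ loss (total us)
  go {us = u ∷ us} (here refl) rewrite gain-⊕ u (total us) | loss-⊕ u (total us) = ℕ.m≤m+n _ _ , ℕ.m≤m+n _ _
  go {us = w ∷ us} (there u∈) rewrite gain-⊕ w (total us) | loss-⊕ w (total us) =
    ℕ.≤-trans (proj₁ (go u∈)) (ℕ.m≤n+m _ _) , ℕ.≤-trans (proj₂ (go u∈)) (ℕ.m≤n+m _ _)

abstract
  -- The result is again a regular expression, so its semilinear form can be taken anew before the
  -- next coordinate is eliminated.
  dropCoordinate : ∀ (l : Linear (suc d)) → ∃[ E ]
      (∀ {v} → ⟦ E ⟧ᴿ ∅ᵉ v → ∃[ w ] ⟦ l ⟧ᴸ w × gain w ≡ loss w × rest w ≡ v)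
    × (∀ {w} → ⟦ l ⟧ᴸ w → gain w ≡ loss w → ⟦ E ⟧ᴿ ∅ᵉ (rest w))
  dropCoordinate (b , P) = balanced ≤-sumBound sol , balanced⁻ ≤-sumBound sol , balanced⁺ ≤-sumBound sol
    where
    open Counter b P (sumBound (b ∷ P))
    sol : LeastSolution equations
    sol = solve (Fin-finite _) equations

nonempty? : ∀ (E : RE d ⊥) → Dec (∃ (⟦ E ⟧ᴿ ∅ᵉ))
nonempty? ∅ = no λ ()
nonempty? (con u) = yes (u , refl)
nonempty? (E ∪ F) = map′ (λ { (inj₁ (v , p)) → v , inj₁ p ; (inj₂ (v , p)) → v , inj₂ p })
  (λ { (v , inj₁ p) → inj₁ (v , p) ; (v , inj₂ p) → inj₂ (v , p) }) (nonempty? E ⊎-dec nonempty? F)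
nonempty? (E · F) = map′ (λ ((_ , p) , (_ , q)) → _ , _ , _ , refl , p , q)
  (λ (_ , _ , _ , _ , p , q) → (_ , p) , (_ , q)) (nonempty? E ×-dec nonempty? F)
nonempty? (E *) = yes (𝟘 , [])

Balanced : Weight d → Set
Balanced = VecAll.All λ (a , b) → a ≡ b

balanced? : ∀ (E : RE d ⊥) → Dec (∃[ v ] ⟦ E ⟧ᴿ ∅ᵉ v × Balanced v)
balanced? {zero} E = map′ (λ { ([] , p) → [] , p , VecAll.[] }) (λ (v , p , _) → v , p) (nonempty? E)
balanced? {suc d} E = map′ to from (balanced? E′)
  where
  E′ : RE d ⊥
  E′ = ⋃ (semilinear E) (proj₁ ∘ dropCoordinate)
  to : ∃[ v ] ⟦ E′ ⟧ᴿ ∅ᵉ v × Balanced v → ∃[ v ] ⟦ E ⟧ᴿ ∅ᵉ v × Balanced v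
  to (v , p , bal) with ⋃⁻ (semilinear E) p
  ... | l , l∈ , q with proj₁ (proj₂ (dropCoordinate l)) q
  ...   | (x ∷ w) , r , e , refl = x ∷ w , semilinear⁻ E (_ , l∈ , r) , e VecAll.∷ bal
  from : ∃[ v ] ⟦ E ⟧ᴿ ∅ᵉ v × Balanced v → ∃[ v ] ⟦ E′ ⟧ᴿ ∅ᵉ v × Balanced v
  from (x ∷ v , p , e VecAll.∷ bal) with semilinear⁺ E p
  ... | l , l∈ , q = v , ⋃⁺ l∈ (proj₂ (proj₂ (dropCoordinate l)) q e) , bal

-- Trees and automata


⊤-finite : Finite ⊤
⊤-finite = record { elements = tt ∷ [] ; complete = λ _ → here refl ; _≟_ = λ _ _ → yes refl }

Bool-finite : Finite Bool
Bool-finite = record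
  { elements = true ∷ false ∷ [] ; complete = λ { true → here refl ; false → there (here refl) } ; _≟_ = Bool._≟_ }

Σ-finite : ∀ {A : Set} {B : A → Set} → Finite A → (∀ a → Finite (B a)) → Finite (Σ A B)
Σ-finite finA finB = record
  { elements = List.concatMap (λ a → List.map (a ,_) (elements (finB a))) (elements finA)
  ; complete = λ (a , b) → ∈.∈-concatMap⁺ (λ a → List.map (a ,_) (elements (finB a))) (Any.map (λ { refl → ∈.∈-map⁺ (a ,_) (complete (finB a) b) }) (complete finA a))
  ; _≟_ = Product.≡-dec (_≟_ finA) (λ {a} → _≟_ (finB a)) }
  where open Finite

infixr 4 _×-finite_
_×-finite_ : ∀ {A B : Set} → Finite A → Finite B → Finite (A × B)
finA ×-finite finB = Σ-finite finA λ _ → finB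

Vec-finite : ∀ {A : Set} → Finite A → ∀ n → Finite (Vec A n)
Vec-finite fin zero    = record { elements = [] ∷ [] ; complete = λ { [] → here refl } ; _≟_ = Vec.≡-dec (Finite._≟_ fin) }
Vec-finite fin (suc n) = record
  { elements = List.cartesianProductWith _∷_ (Finite.elements fin) (Finite.elements tail)
  ; complete = λ { (x ∷ xs) → ∈.∈-cartesianProductWith⁺ _∷_ (Finite.complete fin x) (Finite.complete tail xs) }
  ; _≟_ = Vec.≡-dec (Finite._≟_ fin) }
  where tail = Vec-finite fin n

does⁺ : ∀ {P : Set} {P? : Dec P} → P → T (does P?)
does⁺ {P? = yes _} _ = tt
does⁺ {P? = no ¬p} p = ¬p p

does⁻ : ∀ {P : Set} {P? : Dec P} → T (does P?) → P
does⁻ {P? = yes p} _ = p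

does-⇔ : ∀ {P Q : Set} (P? : Dec P) (Q? : Dec Q) → P ⇔ Q → does P? ≡ does Q?
does-⇔ (yes _) (yes _) _ = refl
does-⇔ (yes p) (no ¬q) e = ⊥-elim (¬q (⇒ e p))
does-⇔ (no ¬p) (yes q) e = ⊥-elim (¬p (⇐ e q))
does-⇔ (no _)  (no _)  _ = refl

infix 5 _▹_
-- Unranked trees in curried form: r becomes the first child of the root of l, so
-- that the nodes of the unranked tree are the leaves of the binary tree.
data BTree : Set where
  leaf : BTree
  _▹_  : BTree → BTree → BTree

private variable
  b l r : BTree

data Pos : BTree → Set where
  tip : Pos leaf
  inl : ∀ {l r} → Pos l → Pos (l ▹ r)
  inr : ∀ {l r} → Pos r → Pos (l ▹ r)


inl-injective : ∀ {p q : Pos l} → inl {l} {r} p ≡ inl q → p ≡ q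
inl-injective refl = refl

inr-injective : ∀ {p q : Pos r} → inr {l} {r} p ≡ inr q → p ≡ q
inr-injective refl = refl

infix 4 _≟ᴾ_
_≟ᴾ_ : DecidableEquality (Pos b)
tip   ≟ᴾ tip   = yes refl
inl p ≟ᴾ inl q = map′ (cong inl) inl-injective (p ≟ᴾ q)
inr p ≟ᴾ inr q = map′ (cong inr) inr-injective (p ≟ᴾ q)
inl p ≟ᴾ inr q = no λ ()
inr p ≟ᴾ inl q = no λ ()

top : ∀ b → Pos b
top leaf    = tip
top (l ▹ r) = inl (top l)

isTop : Pos b → Bool
isTop tip     = true
isTop (inl p) = isTop p
isTop (inr _) = false

isTop-top : ∀ b → T (isTop (top b))
isTop-top leaf    = tt
isTop-top (l ▹ r) = isTop-top l

isTop⇒≡top : ∀ {b} (p : Pos b) → T (isTop p) → p ≡ top b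
isTop⇒≡top tip     _ = refl
isTop⇒≡top (inl p) t = cong inl (isTop⇒≡top p t)

consIf : Bool → X → List X → List X
consIf true  x xs = x ∷ xs
consIf false x xs = xs

kids : Pos b → List (Pos b)
kids tip             = []
kids (inl {l} {r} p) = consIf (isTop p) (inr (top r)) (List.map inl (kids p))
kids (inr p)         = List.map inr (kids p)

kids-inl⁺ : ∀ {p q : Pos l} → q ∈ kids p → inl {l} {r} q ∈ kids (inl p)
kids-inl⁺ {p = p} c with isTop p
... | true  = there (∈.∈-map⁺ inl c)
... | false = ∈.∈-map⁺ inl c

kids-top⁺ : ∀ l {r} → inr {l} {r} (top r) ∈ kids (inl (top l))
kids-top⁺ l with isTop (top l) | isTop-top l
... | true | _ = here refl

data Adjacent {X : Set} : List X → X → X → Set where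
  here  : ∀ {x y xs} → Adjacent (x ∷ y ∷ xs) x y
  there : ∀ {x y z xs} → Adjacent xs x y → Adjacent (z ∷ xs) x y

Adjacent-map⁺ : ∀ {f : X → Y} {xs x y} → Adjacent xs x y → Adjacent (List.map f xs) (f x) (f y)
Adjacent-map⁺ here      = here
Adjacent-map⁺ (there a) = there (Adjacent-map⁺ a)

Adjacent-map⁻ : ∀ {f : X → Y} xs {x y} → Adjacent (List.map f xs) x y →
  ∃[ x′ ] ∃[ y′ ] x ≡ f x′ × y ≡ f y′ × Adjacent xs x′ y′
Adjacent-map⁻ (x ∷ y ∷ xs) here      = x , y , refl , refl , here
Adjacent-map⁻ (x ∷ xs)     (there a) with Adjacent-map⁻ xs a
... | x′ , y′ , e , e′ , a′ = x′ , y′ , e , e′ , there a′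

Adjacent-∷⁻ : ∀ {x y z : X} {xs} → Adjacent (x ∷ xs) y z → (y ≡ x × ∃[ ys ] xs ≡ z ∷ ys) ⊎ Adjacent xs y z
Adjacent-∷⁻ here      = inj₁ (refl , _ , refl)
Adjacent-∷⁻ (there a) = inj₂ a

ChildB : Pos b → Pos b → Set
ChildB p q = q ∈ kids p

SiblingB : Pos b → Pos b → Set
SiblingB p q = ∃[ u ] Adjacent (kids u) p q

∃Pos? : ∀ {P : Pos b → Set} → (∀ p → Dec (P p)) → Dec (∃ P)
∃Pos? {leaf}  P? = map′ (tip ,_) (λ { (tip , p) → p }) (P? tip)
∃Pos? {l ▹ r} P? = map′
  (λ { (inj₁ (p , x)) → inl p , x ; (inj₂ (p , x)) → inr p , x })
  (λ { (inl p , x) → inj₁ (p , x) ; (inr p , x) → inj₂ (p , x) })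
  (∃Pos? (P? ∘ inl) ⊎-dec ∃Pos? (P? ∘ inr))

join : (Pos l → X) → (Pos r → X) → Pos (l ▹ r) → X
join f g (inl p) = f p
join f g (inr p) = g p

-- Bottom-up automata on curried trees

record Automaton (X : Set) : Set₁ where
  field
    State  : Set
    finite : Finite State
    init   : X → State
    step   : State → State → State
    accept : State → Bool

  eval : (Pos b → X) → State
  eval {leaf}  ℓ = init (ℓ tip)
  eval {l ▹ r} ℓ = step (eval (ℓ ∘ inl)) (eval (ℓ ∘ inr))

  accepts : (Pos b → X) → Bool
  accepts ℓ = accept (eval ℓ)

  eval-cong : ∀ {ℓ ℓ′ : Pos b → X} → (∀ p → ℓ p ≡ ℓ′ p) → eval ℓ ≡ eval ℓ′
  eval-cong {leaf}  h = cong init (h tip)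
  eval-cong {l ▹ r} h = cong₂ step (eval-cong (h ∘ inl)) (eval-cong (h ∘ inr))

record Nondeterministic (X : Set) : Set₁ where
  field
    State   : Set
    finite  : Finite State
    Init    : X → State → Set
    Step    : State → State → State → Set
    Accept  : State → Set
    init?   : ∀ x q → Dec (Init x q)
    step?   : ∀ q₁ q₂ q → Dec (Step q₁ q₂ q)
    accept? : ∀ q → Dec (Accept q)

  open Finite finite

  Run : (Pos b → X) → State → Set
  Run {leaf}  ℓ q = Init (ℓ tip) q
  Run {l ▹ r} ℓ q = ∃[ q₁ ] ∃[ q₂ ] Run (ℓ ∘ inl) q₁ × Run (ℓ ∘ inr) q₂ × Step q₁ q₂ q

  -- Sets of states are Boolean vectors and not functions: vectors form a finite type with decidable
  -- equality, without functional extensionality.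
  contains : Vec Bool size → State → Bool
  contains S q = lookup S (index q)

  comprehend : (State → Bool) → Vec Bool size
  comprehend f = Vec.tabulate (f ∘ at)

  contains-comprehend : ∀ f q → contains (comprehend f) q ≡ f q
  contains-comprehend f q = trans (Vec.lookup∘tabulate (f ∘ at) (index q)) (cong f (at-index q))

  steps? : ∀ S₁ S₂ q → Dec (∃[ q₁ ] ∃[ q₂ ] T (contains S₁ q₁) × T (contains S₂ q₂) × Step q₁ q₂ q)
  steps? S₁ S₂ q = ∃? λ q₁ → ∃? λ q₂ → T? (contains S₁ q₁) ×-dec T? (contains S₂ q₂) ×-dec step? q₁ q₂ q

  accepts? : ∀ S → Dec (∃[ q ] T (contains S q) × Accept q)
  accepts? S = ∃? λ q → T? (contains S q) ×-dec accept? q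

  determinise : Automaton X
  determinise = record
    { State = Vec Bool size ; finite = Vec-finite Bool-finite size
    ; init   = λ x → comprehend λ q → does (init? x q)
    ; step   = λ S₁ S₂ → comprehend λ q → does (steps? S₁ S₂ q)
    ; accept = λ S → does (accepts? S) }

  run⁻ : ∀ (ℓ : Pos b → X) {q} → T (contains (Automaton.eval determinise ℓ) q) → Run ℓ q
  run⁻ {leaf}  ℓ {q} t = does⁻ {P? = init? (ℓ tip) q} (subst T (contains-comprehend _ q) t)
  run⁻ {l ▹ r} ℓ {q} t with does⁻ {P? = steps? (Automaton.eval determinise (ℓ ∘ inl)) (Automaton.eval determinise (ℓ ∘ inr)) q} (subst T (contains-comprehend _ q) t)
  ... | q₁ , q₂ , t₁ , t₂ , s = q₁ , q₂ , run⁻ (ℓ ∘ inl) t₁ , run⁻ (ℓ ∘ inr) t₂ , s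

  run⁺ : ∀ (ℓ : Pos b → X) {q} → Run ℓ q → T (contains (Automaton.eval determinise ℓ) q)
  run⁺ {leaf}  ℓ {q} i = subst T (sym (contains-comprehend _ q)) (does⁺ {P? = init? (ℓ tip) q} i)
  run⁺ {l ▹ r} ℓ {q} (q₁ , q₂ , r₁ , r₂ , s) = subst T (sym (contains-comprehend _ q))
    (does⁺ {P? = steps? (Automaton.eval determinise (ℓ ∘ inl)) (Automaton.eval determinise (ℓ ∘ inr)) q}
      (q₁ , q₂ , run⁺ (ℓ ∘ inl) r₁ , run⁺ (ℓ ∘ inr) r₂ , s))

  determinise-correct : ∀ (ℓ : Pos b → X) → (∃[ q ] Run ℓ q × Accept q) ⇔ T (Automaton.accepts determinise ℓ)
  determinise-correct ℓ = mk⇔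
    (λ (q , r , a) → does⁺ {P? = accepts? (Automaton.eval determinise ℓ)} (q , run⁺ ℓ r , a))
    (λ t → let q , t′ , a = does⁻ {P? = accepts? (Automaton.eval determinise ℓ)} t in q , run⁻ ℓ t′ , a)

open Automaton

pullback : (Y → X) → Automaton X → Automaton Y
pullback f α = record { Automaton α ; init = init α ∘ f }

eval-pullback : ∀ (f : Y → X) α (ℓ : Pos b → Y) → eval (pullback f α) ℓ ≡ eval α (f ∘ ℓ)
eval-pullback {b = leaf}  f α ℓ = refl
eval-pullback {b = l ▹ r} f α ℓ = cong₂ (step α) (eval-pullback f α (ℓ ∘ inl)) (eval-pullback f α (ℓ ∘ inr))

complement : Automaton X → Automaton X
complement α = record { Automaton α ; accept = not ∘ accept α }

intersect : Automaton X → Automaton X → Automaton X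
intersect α β = record
  { State = State α × State β ; finite = finite α ×-finite finite β
  ; init = λ x → init α x , init β x
  ; step = λ (q₁ , q₂) (q₁′ , q₂′) → step α q₁ q₁′ , step β q₂ q₂′
  ; accept = λ (q₁ , q₂) → accept α q₁ ∧ accept β q₂ }

eval-intersect : ∀ (α β : Automaton X) (ℓ : Pos b → X) → eval (intersect α β) ℓ ≡ (eval α ℓ , eval β ℓ)
eval-intersect {b = leaf}  α β ℓ = refl
eval-intersect {b = l ▹ r} α β ℓ = cong₂ (step (intersect α β)) (eval-intersect α β (ℓ ∘ inl)) (eval-intersect α β (ℓ ∘ inr))

eval-complement : ∀ (α : Automaton X) (ℓ : Pos b → X) → eval (complement α) ℓ ≡ eval α ℓ
eval-complement {b = leaf}  α ℓ = refl
eval-complement {b = l ▹ r} α ℓ = cong₂ (step α) (eval-complement α (ℓ ∘ inl)) (eval-complement α (ℓ ∘ inr))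

somewhere : (X → Bool) → Automaton X
somewhere f = record { State = Bool ; finite = Bool-finite ; init = f ; step = _∨_ ; accept = id }

somewhere-correct : ∀ (f : X → Bool) (ℓ : Pos b → X) → (∃[ p ] T (f (ℓ p))) ⇔ T (accepts (somewhere f) ℓ)
somewhere-correct f ℓ = mk⇔ (λ (p , t) → to ℓ p t) (from ℓ)
  where
  to : ∀ {b} (ℓ : Pos b → _) p → T (f (ℓ p)) → T (eval (somewhere f) ℓ)
  to ℓ tip     t = t
  to ℓ (inl p) t = ⇐ Bool.T-∨ (inj₁ (to (ℓ ∘ inl) p t))
  to ℓ (inr p) t = ⇐ Bool.T-∨ (inj₂ (to (ℓ ∘ inr) p t))
  from : ∀ {b} (ℓ : Pos b → _) → T (eval (somewhere f) ℓ) → ∃[ p ] T (f (ℓ p))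
  from {leaf}  ℓ t = tip , t
  from {_ ▹ _} ℓ t with ⇒ Bool.T-∨ t
  ... | inj₁ t′ = let p , u = from (ℓ ∘ inl) t′ in inl p , u
  ... | inj₂ t′ = let p , u = from (ℓ ∘ inr) t′ in inr p , u

T-∧∨∨ : ∀ a b c d → T (a ∧ b ∨ (c ∨ d)) ⇔ (T a × T b ⊎ T c ⊎ T d)
T-∧∨∨ true  true  c d = mk⇔ (λ _ → inj₁ _) _
T-∧∨∨ true  false c d = mk⇔ (inj₂ ∘ ⇒ Bool.T-∨) λ { (inj₁ (_ , ())) ; (inj₂ t) → ⇐ Bool.T-∨ t }
T-∧∨∨ false b     c d = mk⇔ (inj₂ ∘ ⇒ Bool.T-∨) λ { (inj₁ (() , _)) ; (inj₂ t) → ⇐ Bool.T-∨ t }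

module _ (f g : X → Bool) where

  -- f at the root, g at the root, found
  childAutomaton : Automaton X
  childAutomaton = record
    { State = Bool × Bool × Bool ; finite = Bool-finite ×-finite Bool-finite ×-finite Bool-finite
    ; init = λ x → f x , g x , false
    ; step = λ (f₁ , g₁ , t₁) (f₂ , g₂ , t₂) → f₁ , g₁ , (f₁ ∧ g₂) ∨ (t₁ ∨ t₂)
    ; accept = λ (_ , _ , t) → t }

  child-f : ∀ (ℓ : Pos b → X) → proj₁ (eval childAutomaton ℓ) ≡ f (ℓ (top b))
  child-f {leaf}  ℓ = refl
  child-f {l ▹ r} ℓ = child-f (ℓ ∘ inl)

  child-g : ∀ (ℓ : Pos b → X) → proj₁ (proj₂ (eval childAutomaton ℓ)) ≡ g (ℓ (top b))
  child-g {leaf}  ℓ = refl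
  child-g {l ▹ r} ℓ = child-g (ℓ ∘ inl)

  child-found : ∀ (ℓ : Pos (l ▹ r) → X) → T (accepts childAutomaton ℓ) ⇔
    (T (f (ℓ (inl (top l)))) × T (g (ℓ (inr (top r)))) ⊎ T (accepts childAutomaton (ℓ ∘ inl)) ⊎ T (accepts childAutomaton (ℓ ∘ inr)))
  child-found ℓ with eval childAutomaton (ℓ ∘ inl) | child-f (ℓ ∘ inl) | eval childAutomaton (ℓ ∘ inr) | child-g (ℓ ∘ inr)
  ... | _ , _ , c | refl | _ , _ , d | refl = T-∧∨∨ _ _ c d

  -- f at the root, g at the root, g at the first child of the root, found
  siblingAutomaton : Automaton X
  siblingAutomaton = record
    { State = Bool × Bool × Bool × Bool
    ; finite = Bool-finite ×-finite Bool-finite ×-finite Bool-finite ×-finite Bool-finite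
    ; init = λ x → f x , g x , false , false
    ; step = λ (f₁ , g₁ , h₁ , t₁) (f₂ , g₂ , h₂ , t₂) → f₁ , g₁ , g₂ , (f₂ ∧ h₁) ∨ (t₁ ∨ t₂)
    ; accept = λ (_ , _ , _ , t) → t }

  sibling-f : ∀ (ℓ : Pos b → X) → proj₁ (eval siblingAutomaton ℓ) ≡ f (ℓ (top b))
  sibling-f {leaf}  ℓ = refl
  sibling-f {l ▹ r} ℓ = sibling-f (ℓ ∘ inl)

  sibling-g : ∀ (ℓ : Pos b → X) → proj₁ (proj₂ (eval siblingAutomaton ℓ)) ≡ g (ℓ (top b))
  sibling-g {leaf}  ℓ = refl
  sibling-g {l ▹ r} ℓ = sibling-g (ℓ ∘ inl)

  Related : (∀ {b} → Pos b → Pos b → Set) → (Pos b → X) → Set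
  Related R ℓ = ∃[ p ] ∃[ q ] T (f (ℓ p)) × T (g (ℓ q)) × R p q

  childAutomaton-correct : ∀ (ℓ : Pos b → X) → Related ChildB ℓ ⇔ T (accepts childAutomaton ℓ)
  childAutomaton-correct ℓ = mk⇔ (λ (p , q , t , u , c) → to ℓ p q t u c) (from ℓ)
    where
    to : ∀ {b} (ℓ : Pos b → X) p q → T (f (ℓ p)) → T (g (ℓ q)) → q ∈ kids p → T (accepts childAutomaton ℓ)
    to ℓ (inl p) q t u c with isTop p in e
    to ℓ (inl p) q t u (here refl) | true = ⇐ (child-found ℓ)
      (inj₁ (subst (T ∘ f ∘ ℓ ∘ inl) (isTop⇒≡top p (subst T (sym e) tt)) t , u))
    to ℓ (inl p) q t u (there c) | true with ∈.∈-map⁻ inl c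
    ... | q′ , c′ , refl = ⇐ (child-found ℓ) (inj₂ (inj₁ (to (ℓ ∘ inl) p q′ t u c′)))
    to ℓ (inl p) q t u c | false with ∈.∈-map⁻ inl c
    ... | q′ , c′ , refl = ⇐ (child-found ℓ) (inj₂ (inj₁ (to (ℓ ∘ inl) p q′ t u c′)))
    to ℓ (inr p) q t u c with ∈.∈-map⁻ inr c
    ... | q′ , c′ , refl = ⇐ (child-found ℓ) (inj₂ (inj₂ (to (ℓ ∘ inr) p q′ t u c′)))
    from : ∀ {b} (ℓ : Pos b → X) → T (accepts childAutomaton ℓ) → Related ChildB ℓ
    from {l ▹ r} ℓ t with ⇒ (child-found ℓ) t
    ... | inj₁ (u , v) = inl (top l) , inr (top r) , u , v , kids-top⁺ l
    ... | inj₂ (inj₁ t′) = let p , q , u , v , c = from (ℓ ∘ inl) t′ in inl p , inl q , u , v , kids-inl⁺ {p = p} c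
    ... | inj₂ (inj₂ t′) = let p , q , u , v , c = from (ℓ ∘ inr) t′ in inr p , inr q , u , v , ∈.∈-map⁺ inr c

  data FirstKid : Pos b → Set where
    first : FirstKid {l ▹ r} (inr (top r))

  FirstKid⁻ : ∀ {b} {p : Pos b} {xs} → kids (top b) ≡ p ∷ xs → FirstKid p
  FirstKid⁻ {l ▹ r} e with isTop (top l) | isTop-top l
  FirstKid⁻ {l ▹ r} refl | true | _ = first

  FirstKid⁺ : ∀ {b} {p : Pos b} → FirstKid p → ∃[ xs ] kids (top b) ≡ p ∷ xs
  FirstKid⁺ {l ▹ r} first with isTop (top l) | isTop-top l
  ... | true | _ = _ , refl

  sibling-first⁺ : ∀ (ℓ : Pos b → X) {p} → FirstKid p → T (g (ℓ p)) → T (proj₁ (proj₂ (proj₂ (eval siblingAutomaton ℓ))))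
  sibling-first⁺ ℓ first t = subst T (sym (sibling-g (ℓ ∘ inr))) t

  sibling-first⁻ : ∀ (ℓ : Pos b → X) → T (proj₁ (proj₂ (proj₂ (eval siblingAutomaton ℓ)))) → ∃[ p ] FirstKid p × T (g (ℓ p))
  sibling-first⁻ {l ▹ r} ℓ t = _ , first , subst T (sibling-g (ℓ ∘ inr)) t

  -- Currying puts the root of `r` in front of the children of the root of `l`. The only new
  -- adjacent pair consists of it and the former first child; this is what the third component of
  -- the state remembers.
  sibling-found : ∀ (ℓ : Pos (l ▹ r) → X) → T (accepts siblingAutomaton ℓ) ⇔
    (T (f (ℓ (inr (top r)))) × T (proj₁ (proj₂ (proj₂ (eval siblingAutomaton (ℓ ∘ inl)))))
      ⊎ T (accepts siblingAutomaton (ℓ ∘ inl)) ⊎ T (accepts siblingAutomaton (ℓ ∘ inr)))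
  sibling-found ℓ with eval siblingAutomaton (ℓ ∘ inl) | eval siblingAutomaton (ℓ ∘ inr) | sibling-f (ℓ ∘ inr)
  ... | _ , _ , h , c | _ , _ , _ , d | refl = T-∧∨∨ _ h c d

  siblingAutomaton-correct : ∀ (ℓ : Pos b → X) → Related SiblingB ℓ ⇔ T (accepts siblingAutomaton ℓ)
  siblingAutomaton-correct ℓ = mk⇔ (λ (p , q , t , v , u , a) → to ℓ u p q t v a) (from ℓ)
    where
    found : ∀ {b} → (Pos b → X) → Bool
    found = accepts siblingAutomaton
    to : ∀ {b} (ℓ : Pos b → X) u p q → T (f (ℓ p)) → T (g (ℓ q)) → Adjacent (kids u) p q → T (found ℓ)
    toˡ : ∀ {l r} (ℓ : Pos (l ▹ r) → X) u {p q} → T (f (ℓ p)) → T (g (ℓ q)) → Adjacent (List.map inl (kids u)) p q → T (found ℓ)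
    toˡ ℓ u t v a with Adjacent-map⁻ (kids u) a
    ... | p′ , q′ , refl , refl , a′ = ⇐ (sibling-found ℓ) (inj₂ (inj₁ (to (ℓ ∘ inl) u p′ q′ t v a′)))
    to ℓ (inl u) p q t v a with isTop u in e
    ... | false = toˡ ℓ u t v a
    ... | true with Adjacent-∷⁻ a
    ...   | inj₂ a′ = toˡ ℓ u t v a′
    ...   | inj₁ (refl , _ , e′) with kids u in e″ | e′
    ...     | q′ ∷ _ | refl = ⇐ (sibling-found ℓ) (inj₁ (t ,
      sibling-first⁺ (ℓ ∘ inl) (FirstKid⁻ (trans (cong kids (sym (isTop⇒≡top u (subst T (sym e) tt)))) e″)) v))
    to ℓ (inr u) p q t v a with Adjacent-map⁻ (kids u) a
    ... | p′ , q′ , refl , refl , a′ = ⇐ (sibling-found ℓ) (inj₂ (inj₂ (to (ℓ ∘ inr) u p′ q′ t v a′)))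
    liftˡ : ∀ {l r} {u p q : Pos l} → Adjacent (kids u) p q → Adjacent (kids (inl {l} {r} u)) (inl p) (inl q)
    liftˡ {u = u} a with isTop u
    ... | true  = there (Adjacent-map⁺ a)
    ... | false = Adjacent-map⁺ a
    liftTop : ∀ {l r} {q : Pos l} → FirstKid q → Adjacent (kids (inl {l} {r} (top l))) (inr (top r)) (inl q)
    liftTop {l} k with FirstKid⁺ k | isTop (top l) | isTop-top l
    ... | xs , e | true | _ rewrite e = here
    from : ∀ {b} (ℓ : Pos b → X) → T (found ℓ) → Related SiblingB ℓ
    from {l ▹ r} ℓ t with ⇒ (sibling-found ℓ) t
    ... | inj₁ (t₁ , t₂) = let q , k , v = sibling-first⁻ (ℓ ∘ inl) t₂ in
      inr (top r) , inl q , t₁ , v , inl (top l) , liftTop k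
    ... | inj₂ (inj₁ t′) = let p , q , t₁ , v , u , a = from (ℓ ∘ inl) t′ in inl p , inl q , t₁ , v , inl u , liftˡ {u = u} a
    ... | inj₂ (inj₂ t′) = let p , q , t₁ , v , u , a = from (ℓ ∘ inr) t′ in inr p , inr q , t₁ , v , inr u , Adjacent-map⁺ a

module _ (α : Automaton Y) (put : Bool → X → Y) where
  private module α = Automaton α

  -- The Boolean component of a state records whether the marked node occurs in the subtree.
  markedNode : Nondeterministic X
  markedNode = record
    { State = Bool × α.State ; finite = Bool-finite ×-finite α.finite
    ; Init = λ x (c , q) → α.init (put c x) ≡ q
    ; Step = λ (c₁ , q₁) (c₂ , q₂) (c , q) → c ≡ c₁ ∨ c₂ × T (not (c₁ ∧ c₂)) × α.step q₁ q₂ ≡ q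
    ; Accept = λ (c , q) → T c × T (α.accept q)
    ; init? = λ x (c , q) → _ ≟ q
    ; step? = λ (c₁ , q₁) (c₂ , q₂) (c , q) → c Bool.≟ _ ×-dec T? _ ×-dec _ ≟ q
    ; accept? = λ (c , q) → T? c ×-dec T? _ }
    where open Finite α.finite

  markNode : (Pos b → X) → Pos b → α.State
  markNode ℓ v = α.eval (λ p → put (does (v ≟ᴾ p)) (ℓ p))

  markNone : (Pos b → X) → α.State
  markNone ℓ = α.eval (λ p → put false (ℓ p))

  private module M = Nondeterministic markedNode

  markedNode-run⁻ : ∀ (ℓ : Pos b → X) {c q} → M.Run ℓ (c , q) →
    (c ≡ false × markNone ℓ ≡ q) ⊎ (c ≡ true × ∃[ v ] markNode ℓ v ≡ q)
  markedNode-run⁻ {leaf} ℓ {false} refl = inj₁ (refl , refl)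
  markedNode-run⁻ {leaf} ℓ {true}  refl = inj₂ (refl , tip , refl)
  markedNode-run⁻ {l ▹ r} ℓ (_ , _ , r₁ , r₂ , e , t , refl) with markedNode-run⁻ (ℓ ∘ inl) r₁ | markedNode-run⁻ (ℓ ∘ inr) r₂
  ... | inj₁ (refl , refl)     | inj₁ (refl , refl)     = inj₁ (e , refl)
  ... | inj₁ (refl , refl)     | inj₂ (refl , v , refl) = inj₂ (e , inr v , refl)
  ... | inj₂ (refl , v , refl) | inj₁ (refl , refl)     = inj₂ (e , inl v , refl)
  ... | inj₂ (refl , v , refl) | inj₂ (refl , w , refl) = ⊥-elim t

  markNone-run : ∀ (ℓ : Pos b → X) → M.Run ℓ (false , markNone ℓ)
  markNone-run {leaf}  ℓ = refl
  markNone-run {l ▹ r} ℓ = _ , _ , markNone-run (ℓ ∘ inl) , markNone-run (ℓ ∘ inr) , refl , tt , refl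

  markNode-run : ∀ (ℓ : Pos b → X) v → M.Run ℓ (true , markNode ℓ v)
  markNode-run ℓ tip     = refl
  markNode-run ℓ (inl v) = _ , _ , markNode-run (ℓ ∘ inl) v , markNone-run (ℓ ∘ inr) , refl , tt , refl
  markNode-run ℓ (inr v) = _ , _ , markNone-run (ℓ ∘ inl) , markNode-run (ℓ ∘ inr) v , refl , tt , refl

  someNode : Automaton X
  someNode = M.determinise

  someNode-correct : ∀ (ℓ : Pos b → X) →
    (∃[ v ] T (α.accepts (λ p → put (does (v ≟ᴾ p)) (ℓ p)))) ⇔ T (accepts someNode ℓ)
  someNode-correct ℓ = mk⇔
    (λ (v , t) → ⇒ (M.determinise-correct ℓ) (_ , markNode-run ℓ v , tt , t))
    λ t → let q , r , a = ⇐ (M.determinise-correct ℓ) t in from q r a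
    where
    from : ∀ q → M.Run ℓ q → T (proj₁ q) × T (α.accept (proj₂ q)) → _
    from (c , q) r a with markedNode-run⁻ ℓ r
    from (_ , _) r (() , _) | inj₁ (refl , _)
    from (_ , _) r (_ , t) | inj₂ (refl , v , refl) = v , t

  guessedSet : Nondeterministic X
  guessedSet = record
    { State = α.State ; finite = α.finite
    ; Init = λ x q → ∃[ c ] α.init (put c x) ≡ q
    ; Step = λ q₁ q₂ q → α.step q₁ q₂ ≡ q
    ; Accept = T ∘ α.accept
    ; init? = λ x q → Finite.∃? Bool-finite λ c → _ ≟ q
    ; step? = λ q₁ q₂ q → _ ≟ q
    ; accept? = λ q → T? _ }
    where open Finite α.finite

  private module G = Nondeterministic guessedSet

  guess : (Pos b → X) → (Pos b → Bool) → Pos b → Y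
  guess ℓ S p = put (S p) (ℓ p)

  guessedSet-run⁺ : ∀ (ℓ : Pos b → X) S → G.Run ℓ (α.eval (guess ℓ S))
  guessedSet-run⁺ {leaf}  ℓ S = S tip , refl
  guessedSet-run⁺ {l ▹ r} ℓ S = _ , _ , guessedSet-run⁺ (ℓ ∘ inl) (S ∘ inl) , guessedSet-run⁺ (ℓ ∘ inr) (S ∘ inr) , refl

  guessedSet-run⁻ : ∀ (ℓ : Pos b → X) {q} → G.Run ℓ q → ∃[ S ] α.eval (guess ℓ S) ≡ q
  guessedSet-run⁻ {leaf}  ℓ (c , e) = (λ _ → c) , e
  guessedSet-run⁻ {l ▹ r} ℓ (_ , _ , r₁ , r₂ , refl) with guessedSet-run⁻ (ℓ ∘ inl) r₁ | guessedSet-run⁻ (ℓ ∘ inr) r₂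
  ... | S , refl | S′ , refl = join S S′ , refl

  someSet : Automaton X
  someSet = G.determinise

  someSet-correct : ∀ (ℓ : Pos b → X) → (∃[ S ] T (α.accepts (guess ℓ S))) ⇔ T (accepts someSet ℓ)
  someSet-correct ℓ = mk⇔
    (λ (S , t) → ⇒ (G.determinise-correct ℓ) (_ , guessedSet-run⁺ ℓ S , t))
    λ t → let q , r , a = ⇐ (G.determinise-correct ℓ) t ; S , e = guessedSet-run⁻ ℓ r in
      S , subst (T ∘ α.accept) (sym e) a

-- Monadic second-order logic



-- Set variables live in the labels, where `exSet` adds a Boolean component. `app` changes the
-- labels and substitutes variables at once, which lets a formula be reused over richer colourings.
-- `recognised` admits an automaton as an atom; the class condition, the transducer and
-- connectedness of the sides enter this way.
data Formula : Set → ℕ → Set₁ where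
  test                : (L → Bool) → Fin m → Formula L m
  equal child sibling : Fin m → Fin m → Formula L m
  neg                 : Formula L m → Formula L m
  and                 : Formula L m → Formula L m → Formula L m
  ex                  : Formula L (suc m) → Formula L m
  exSet               : Formula (L × Bool) m → Formula L m
  app                 : (L → L′) → Vec (Fin m) m′ → Formula L′ m′ → Formula L m
  recognised          : Automaton (L × Vec Bool m) → Formula L m

marks : Vec (Pos b) m → Pos b → Vec Bool m
marks ν p = Vec.map (λ v → does (v ≟ᴾ p)) ν

⟦_⟧ : ∀ {b} → Formula L m → (Pos b → L) → Vec (Pos b) m → Set
⟦ test f x ⟧     ℓ ν = T (f (ℓ (lookup ν x)))
⟦ equal x y ⟧    ℓ ν = lookup ν x ≡ lookup ν y
⟦ child x y ⟧    ℓ ν = ChildB (lookup ν x) (lookup ν y)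
⟦ sibling x y ⟧  ℓ ν = SiblingB (lookup ν x) (lookup ν y)
⟦ neg φ ⟧        ℓ ν = ¬ ⟦ φ ⟧ ℓ ν
⟦ and φ ψ ⟧      ℓ ν = ⟦ φ ⟧ ℓ ν × ⟦ ψ ⟧ ℓ ν
⟦ ex φ ⟧         ℓ ν = ∃[ v ] ⟦ φ ⟧ ℓ (v ∷ ν)
⟦_⟧ {b = b} (exSet φ) ℓ ν = Σ (Pos b → Bool) λ S → ⟦ φ ⟧ (λ p → ℓ p , S p) ν
⟦ app g xs φ ⟧   ℓ ν = ⟦ φ ⟧ (g ∘ ℓ) (Vec.map (lookup ν) xs)
⟦ recognised α ⟧ ℓ ν = T (accepts α λ p → ℓ p , marks ν p)

compile : Formula L m → Automaton (L × Vec Bool m)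
compile (test f x)     = somewhere λ (l , μ) → lookup μ x ∧ f l
compile (equal x y)    = somewhere λ (_ , μ) → lookup μ x ∧ lookup μ y
compile (child x y)    = childAutomaton (λ (_ , μ) → lookup μ x) (λ (_ , μ) → lookup μ y)
compile (sibling x y)  = siblingAutomaton (λ (_ , μ) → lookup μ x) (λ (_ , μ) → lookup μ y)
compile (neg φ)        = complement (compile φ)
compile (and φ ψ)      = intersect (compile φ) (compile ψ)
compile (ex φ)         = someNode (compile φ) λ c (l , μ) → l , c ∷ μ
compile (exSet φ)      = someSet (compile φ) λ c (l , μ) → (l , c) , μ
compile (app g xs φ)   = pullback (λ (l , μ) → g l , Vec.map (lookup μ) xs) (compile φ)
compile (recognised α) = α

-- The tree automaton reads the valuation of the free node variables as extra labels.
marked : (Pos b → L) → Vec (Pos b) m → Pos b → L × Vec Bool m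
marked ℓ ν p = ℓ p , marks ν p

module _ (ν : Vec (Pos b) m) where
  mark⁺ : ∀ x → T (lookup (marks ν (lookup ν x)) x)
  mark⁺ x = subst T (sym (Vec.lookup-map x _ ν)) (does⁺ {P? = lookup ν x ≟ᴾ lookup ν x} refl)

  mark⁻ : ∀ x {p} → T (lookup (marks ν p) x) → lookup ν x ≡ p
  mark⁻ x t = does⁻ {P? = lookup ν x ≟ᴾ _} (subst T (Vec.lookup-map x _ ν) t)

  marks-app : ∀ (xs : Vec (Fin m) m′) p → marks (Vec.map (lookup ν) xs) p ≡ Vec.map (lookup (marks ν p)) xs
  marks-app xs p = trans (sym (Vec.map-∘ _ _ xs)) (Vec.map-cong (λ x → sym (Vec.lookup-map x _ ν)) xs)

compile-correct : ∀ (φ : Formula L m) (ℓ : Pos b → L) ν → ⟦ φ ⟧ ℓ ν ⇔ T (accepts (compile φ) (marked ℓ ν))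
compile-correct (test f x) ℓ ν = somewhere-correct _ (marked ℓ ν) ⇔∘ mk⇔
  (λ t → lookup ν x , ⇐ Bool.T-∧ (mark⁺ ν x , t))
  (λ (p , t) → let u , v = ⇒ Bool.T-∧ t in subst (T ∘ f ∘ ℓ) (sym (mark⁻ ν x u)) v)
compile-correct (equal x y) ℓ ν = somewhere-correct _ (marked ℓ ν) ⇔∘ mk⇔
  (λ e → lookup ν x , ⇐ Bool.T-∧ (mark⁺ ν x , subst (λ p → T (lookup (marks ν p) y)) (sym e) (mark⁺ ν y)))
  (λ (p , t) → let u , v = ⇒ Bool.T-∧ t in trans (mark⁻ ν x u) (sym (mark⁻ ν y v)))
compile-correct (child x y) ℓ ν = childAutomaton-correct _ _ (marked ℓ ν) ⇔∘ mk⇔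
  (λ c → _ , _ , mark⁺ ν x , mark⁺ ν y , c)
  (λ (p , q , t , u , c) → subst₂ ChildB (sym (mark⁻ ν x t)) (sym (mark⁻ ν y u)) c)
compile-correct (sibling x y) ℓ ν = siblingAutomaton-correct _ _ (marked ℓ ν) ⇔∘ mk⇔
  (λ c → _ , _ , mark⁺ ν x , mark⁺ ν y , c)
  (λ (p , q , t , u , c) → subst₂ SiblingB (sym (mark⁻ ν x t)) (sym (mark⁻ ν y u)) c)
compile-correct (neg φ) ℓ ν
  rewrite eval-complement (compile φ) (marked ℓ ν) = mk⇔
  (λ ¬s → ⇐ (T-not _) (¬s ∘ ⇐ (compile-correct φ ℓ ν)))
  (λ t s → ⇒ (T-not _) t (⇒ (compile-correct φ ℓ ν) s))
  where
  T-not : ∀ c → T (not c) ⇔ (¬ T c)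
  T-not true  = mk⇔ (λ ()) (λ ¬t → ¬t tt)
  T-not false = mk⇔ (λ _ ()) (λ _ → tt)
compile-correct (and φ ψ) ℓ ν
  rewrite eval-intersect (compile φ) (compile ψ) (marked ℓ ν) = mk⇔
  (λ (s , t) → ⇐ Bool.T-∧ (⇒ (compile-correct φ ℓ ν) s , ⇒ (compile-correct ψ ℓ ν) t))
  (λ t → let u , v = ⇒ Bool.T-∧ t in ⇐ (compile-correct φ ℓ ν) u , ⇐ (compile-correct ψ ℓ ν) v)
compile-correct (ex φ) ℓ ν = someNode-correct (compile φ) (λ c (l , μ) → l , c ∷ μ) (marked ℓ ν) ⇔∘ mk⇔
  (λ (v , s) → v , ⇒ (compile-correct φ ℓ (v ∷ ν)) s)
  (λ (v , t) → v , ⇐ (compile-correct φ ℓ (v ∷ ν)) t)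
compile-correct (exSet φ) ℓ ν = someSet-correct (compile φ) (λ c (l , μ) → (l , c) , μ) (marked ℓ ν) ⇔∘ mk⇔
  (λ (S , s) → S , ⇒ (compile-correct φ (λ p → ℓ p , S p) ν) s)
  (λ (S , t) → S , ⇐ (compile-correct φ (λ p → ℓ p , S p) ν) t)
compile-correct (app g xs φ) ℓ ν
  rewrite eval-pullback (λ (l , μ) → g l , Vec.map (lookup μ) xs) (compile φ) (marked ℓ ν) =
  subst (λ q → T (accepts (compile φ) (marked (g ∘ ℓ) (Vec.map (lookup ν) xs))) ⇔ T (accept (compile φ) q))
    (eval-cong (compile φ) λ p → cong (g (ℓ p) ,_) (marks-app ν xs p)) (⇔-id _)
  ⇔∘ compile-correct φ (g ∘ ℓ) (Vec.map (lookup ν) xs)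
compile-correct (recognised α) ℓ ν = ⇔-id _

-- This licenses the classical encodings of disjunction and universal quantification below.
decide : ∀ (φ : Formula L m) (ℓ : Pos b → L) ν → Dec (⟦ φ ⟧ ℓ ν)
decide φ ℓ ν = map (⇔-sym (compile-correct φ ℓ ν)) (T? _)

-- The detour through the automaton stands in for functional extensionality: evaluation depends on
-- the labelling only pointwise.
⟦⟧-cong : ∀ (φ : Formula L m) {ℓ ℓ′ : Pos b → L} {ν} → (∀ p → ℓ p ≡ ℓ′ p) → ⟦ φ ⟧ ℓ ν → ⟦ φ ⟧ ℓ′ ν
⟦⟧-cong φ {ℓ} {ℓ′} {ν} h s = ⇐ (compile-correct φ ℓ′ ν) (subst (T ∘ accept (compile φ))
  (eval-cong (compile φ) λ p → cong (_, marks ν p) (h p)) (⇒ (compile-correct φ ℓ ν) s))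

orᶠ : Formula L m → Formula L m → Formula L m
orᶠ φ ψ = neg (and (neg φ) (neg ψ))

allᶠ : Formula L (suc m) → Formula L m
allᶠ φ = neg (ex (neg φ))

allSetᶠ : Formula (L × Bool) m → Formula L m
allSetᶠ φ = neg (exSet (neg φ))

module _ {ℓ : Pos b → L} {ν : Vec (Pos b) m} where
  or-correct : ∀ φ ψ → (⟦ φ ⟧ ℓ ν ⊎ ⟦ ψ ⟧ ℓ ν) ⇔ ⟦ orᶠ φ ψ ⟧ ℓ ν
  or-correct φ ψ = mk⇔ (λ { (inj₁ s) (¬s , _) → ¬s s ; (inj₂ t) (_ , ¬t) → ¬t t })
    λ h → decidable-stable (decide φ ℓ ν ⊎-dec decide ψ ℓ ν) λ ¬s → h (¬s ∘ inj₁ , ¬s ∘ inj₂)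

  all-correct : ∀ φ → (∀ v → ⟦ φ ⟧ ℓ (v ∷ ν)) ⇔ ⟦ allᶠ φ ⟧ ℓ ν
  all-correct φ = mk⇔ (λ s (v , ¬s) → ¬s (s v))
    λ h v → decidable-stable (decide φ ℓ (v ∷ ν)) λ ¬s → h (v , ¬s)

  allSet-correct : ∀ φ → (∀ (S : Pos b → Bool) → ⟦ φ ⟧ (λ p → ℓ p , S p) ν) ⇔ ⟦ allSetᶠ φ ⟧ ℓ ν
  allSet-correct φ = mk⇔ (λ s (S , ¬s) → ¬s (s S))
    λ h S → decidable-stable (decide φ (λ p → ℓ p , S p) ν) λ ¬s → h (S , ¬s)

module _ {K : Set} (fin : Finite K) (f : L → K) {P : K → K → Set} (P? : ∀ k k′ → Dec (P k k′)) where
  open Finite fin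

  -- A `test` reads the label of a single node. A relation between two labels is therefore a
  -- disjunction over the possible values `k` at `x`, with `P k` tested at `y`.
  disjuncts : List K → Fin m → Fin m → Formula L m
  disjuncts []       x y = test (λ _ → false) x
  disjuncts (k ∷ ks) x y = orᶠ (and (test (λ l → does (f l ≟ k)) x) (test (does ∘ P? k ∘ f) y)) (disjuncts ks x y)

  abstract
    relate : Fin m → Fin m → Formula L m
    relate = disjuncts elements

    relate⁻ : ∀ {b} {ℓ : Pos b → L} {ν : Vec (Pos b) m} {x y} → ⟦ relate x y ⟧ ℓ ν → P (f (ℓ (lookup ν x))) (f (ℓ (lookup ν y)))
    relate⁻ {ℓ = ℓ} {ν} {x} {y} = go elements
      where
      go : ∀ ks → ⟦ disjuncts ks x y ⟧ ℓ ν → P (f (ℓ (lookup ν x))) (f (ℓ (lookup ν y)))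
      go (k ∷ ks) s with ⇐ (or-correct (and (test (λ l → does (f l ≟ k)) x) (test (does ∘ P? k ∘ f) y)) (disjuncts ks x y)) s
      ... | inj₁ (t , u) with refl ← does⁻ {P? = f (ℓ (lookup ν x)) ≟ k} t = does⁻ {P? = P? _ _} u
      ... | inj₂ s′ = go ks s′

    relate⁺ : ∀ {b} {ℓ : Pos b → L} {ν : Vec (Pos b) m} {x y} → P (f (ℓ (lookup ν x))) (f (ℓ (lookup ν y))) → ⟦ relate x y ⟧ ℓ ν
    relate⁺ {ℓ = ℓ} {ν} {x} {y} t = go (complete (f (ℓ (lookup ν x))))
      where
      go : ∀ {ks} → f (ℓ (lookup ν x)) ∈ ks → ⟦ disjuncts ks x y ⟧ ℓ ν
      go {k ∷ ks} (here refl) = ⇒ (or-correct (and (test (λ l → does (f l ≟ k)) x) (test (does ∘ P? k ∘ f) y)) (disjuncts ks x y))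
        (inj₁ (does⁺ {P? = f (ℓ (lookup ν x)) ≟ k} refl , does⁺ {P? = P? _ _} t))
      go {k ∷ ks} (there k∈) = ⇒ (or-correct (and (test (λ l → does (f l ≟ k)) x) (test (does ∘ P? k ∘ f) y)) (disjuncts ks x y))
        (inj₂ (go k∈))

-- Unranked trees and bipartitions



record Iso (s : Shape) (b : BTree) : Set where
  field
    to      : Node s → Pos b
    from    : Pos b → Node s
    to-from : ∀ p → to (from p) ≡ p
    from-to : ∀ v → from (to v) ≡ v
    to-root : to root ≡ top b
    kids-to : ∀ v → List.map to (children v) ≡ kids (to v)

  to-injective : ∀ {v w} → to v ≡ to w → v ≡ w
  to-injective {v} {w} e = trans (sym (from-to v)) (trans (cong from e) (from-to w))

  child⇔ : ∀ v w → Child v w ⇔ ChildB (to v) (to w)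
  child⇔ v w = mk⇔
    (λ c → subst (to w ∈_) (kids-to v) (∈.∈-map⁺ to c))
    (λ c → let w′ , c′ , e = ∈.∈-map⁻ to (subst (to w ∈_) (sym (kids-to v)) c) in
      subst (_∈ children v) (sym (to-injective e)) c′)

  sibling⇔ : ∀ v w → NextSibling v w ⇔ SiblingB (to v) (to w)
  sibling⇔ v w = mk⇔
    (λ (u , vs , ws , e) → to u , subst (λ xs → Adjacent xs (to v) (to w)) (kids-to u)
      (Adjacent-map⁺ (subst (λ xs → Adjacent xs v w) (sym e) (split⁻ vs))))
    (λ (p , a) → let v′ , w′ , e , e′ , a′ = Adjacent-map⁻ (children (from p))
                       (subst (λ xs → Adjacent xs (to v) (to w)) (sym (trans (kids-to (from p)) (cong kids (to-from p)))) a)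
                     vs , ws , e″ = split⁺ a′ in
      from p , vs , ws , trans e″ (cong₂ (λ x y → vs ++ x ∷ y ∷ ws) (sym (to-injective e)) (sym (to-injective e′))))
    where
    split⁻ : ∀ {X : Set} {x y : X} vs {ws} → Adjacent (vs ++ x ∷ y ∷ ws) x y
    split⁻ []       = here
    split⁻ (_ ∷ vs) = there (split⁻ vs)
    split⁺ : ∀ {X : Set} {x y : X} {xs} → Adjacent xs x y → ∃[ vs ] ∃[ ws ] xs ≡ vs ++ x ∷ y ∷ ws
    split⁺ here      = [] , _ , refl
    split⁺ (there a) = let vs , ws , e = split⁺ a in _ ∷ vs , ws , cong (_ ∷_) e

leafIso : (f : Fin 0 → Shape) → Iso (branch f) leaf
leafIso f = record
  { to = λ _ → tip ; from = λ _ → root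
  ; to-from = λ { tip → refl } ; from-to = λ { root → refl ; (below () _) }
  ; to-root = refl ; kids-to = λ { root → refl ; (below () _) } }

module _ {n} (f : Fin (suc n) → Shape) {l r} (L : Iso (branch (f ∘ suc)) l) (R : Iso (f zero) r) where
  private
    module L = Iso L
    module R = Iso R

    shift : Node (branch (f ∘ suc)) → Node (branch f)
    shift root        = root
    shift (below i v) = below (suc i) v

    toᴺ : Node (branch f) → Pos (l ▹ r)
    toᴺ root              = inl (L.to root)
    toᴺ (below zero v)    = inr (R.to v)
    toᴺ (below (suc i) v) = inl (L.to (below i v))

    toᴺ-shift : ∀ v → toᴺ (shift v) ≡ inl (L.to v)
    toᴺ-shift root        = refl
    toᴺ-shift (below i v) = refl

    fromᴺ : Pos (l ▹ r) → Node (branch f)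
    fromᴺ (inl p) = shift (L.from p)
    fromᴺ (inr p) = below zero (R.from p)

    isTop-root : ∀ v → isTop (L.to v) ≡ true → v ≡ root
    isTop-root v e = L.to-injective (trans (isTop⇒≡top _ (subst T (sym e) tt)) (sym L.to-root))

    isTop-top′ : isTop (L.to root) ≡ true
    isTop-top′ with isTop (L.to root) | subst (T ∘ isTop) (sym L.to-root) (isTop-top l)
    ... | true | _ = refl

    kids-below : ∀ i v → isTop (L.to (below i v)) ≡ false
    kids-below i v with isTop (L.to (below i v)) in e
    ... | false = refl
    ... | true with () ← isTop-root (below i v) e

    kids-toᴺ : ∀ v → List.map toᴺ (children v) ≡ kids (toᴺ v)
    kids-toᴺ root rewrite isTop-top′ = cong₂ _∷_ (cong inr R.to-root) (begin
      List.map toᴺ (List.tabulate λ i → below (suc i) root) ≡⟨ List.map-tabulate _ toᴺ ⟩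
      List.tabulate (λ i → inl (L.to (below i root)))       ≡⟨ List.map-tabulate (λ i → below i root) (inl ∘ L.to) ⟨
      List.map (inl ∘ L.to) (children root)                 ≡⟨ List.map-∘ (children root) ⟩
      List.map inl (List.map L.to (children root))          ≡⟨ cong (List.map inl) (L.kids-to root) ⟩
      List.map inl (kids (L.to root))                       ∎)
      where open ≡-Reasoning
    kids-toᴺ (below zero v) = begin
      List.map toᴺ (List.map (below zero) (children v)) ≡⟨ List.map-∘ (children v) ⟨
      List.map (inr ∘ R.to) (children v)                ≡⟨ List.map-∘ (children v) ⟩
      List.map inr (List.map R.to (children v))         ≡⟨ cong (List.map inr) (R.kids-to v) ⟩
      List.map inr (kids (R.to v))                      ∎
      where open ≡-Reasoning
    kids-toᴺ (below (suc i) v) rewrite kids-below i v = begin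
      List.map toᴺ (List.map (below (suc i)) (children v))               ≡⟨ List.map-∘ (children v) ⟨
      List.map (inl ∘ L.to ∘ below i) (children v)                       ≡⟨ List.map-∘ (children v) ⟩
      List.map (inl ∘ L.to) (children (below {f = f ∘ suc} i v))         ≡⟨ List.map-∘ (children (below {f = f ∘ suc} i v)) ⟩
      List.map inl (List.map L.to (children (below {f = f ∘ suc} i v)))  ≡⟨ cong (List.map inl) (L.kids-to (below i v)) ⟩
      List.map inl (kids (L.to (below i v)))                             ∎
      where open ≡-Reasoning

  consIso : Iso (branch f) (l ▹ r)
  consIso = record
    { to = toᴺ ; from = fromᴺ
    ; to-from = λ { (inl p) → trans (toᴺ-shift (L.from p)) (cong inl (L.to-from p)) ; (inr p) → cong inr (R.to-from p) }
    ; from-to = λ { root → cong shift (L.from-to root) ; (below zero v) → cong (below zero) (R.from-to v)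
                  ; (below (suc i) v) → cong shift (L.from-to (below i v)) }
    ; to-root = cong inl L.to-root ; kids-to = kids-toᴺ }

curried : ∀ s → ∃[ b ] Iso s b
curried (branch f) = go f λ i → curried (f i)
  where
  go : ∀ {n} (f : Fin n → Shape) → (∀ i → ∃[ b ] Iso (f i) b) → ∃[ b ] Iso (branch f) b
  go {zero}  f h = leaf , leafIso f
  go {suc n} f h = _ , consIso f (proj₂ (go (f ∘ suc) (h ∘ suc))) (proj₂ (h zero))

uncurried : ∀ b → ∃[ s ] Iso s b
uncurried leaf = branch {0} (λ ()) , leafIso _
uncurried (l ▹ r) with uncurried l | uncurried r
... | branch f , L | s , R = branch (s ▸ f) , consIso (s ▸ f) L R

-- Good χ says that both colour classes of χ are connected: a class meeting both parts
-- of l ▹ r contains the edge between them.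
Bridge : (Pos (l ▹ r) → Bool) → Bool → Set
Bridge {l} {r} χ c = (∃[ p ] χ (inl p) ≡ c) → (∃[ q ] χ (inr q) ≡ c) → χ (inl (top l)) ≡ c × χ (inr (top r)) ≡ c

Good : (Pos b → Bool) → Set
Good {leaf}  χ = ⊤
Good {l ▹ r} χ = Good (χ ∘ inl) × Good (χ ∘ inr) × Bridge χ true × Bridge χ false

hasColour? : ∀ (χ : Pos b → Bool) c → Dec (∃[ p ] χ p ≡ c)
hasColour? χ c = ∃Pos? λ p → χ p Bool.≟ c

bridge? : ∀ (χ : Pos (l ▹ r) → Bool) c → Dec (Bridge χ c)
bridge? χ c = hasColour? (χ ∘ inl) c →-dec hasColour? (χ ∘ inr) c →-dec (_ Bool.≟ c ×-dec _ Bool.≟ c)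

good? : ∀ (χ : Pos b → Bool) → Dec (Good χ)
good? {leaf}  χ = yes tt
good? {l ▹ r} χ = good? (χ ∘ inl) ×-dec good? (χ ∘ inr) ×-dec bridge? χ true ×-dec bridge? χ false

bridge : ∀ {χ : Pos (l ▹ r) → Bool} → Good χ → ∀ c → Bridge χ c
bridge (_ , _ , t , _) true  = t
bridge (_ , _ , _ , f) false = f

-- colour of the root, occurrence of true, occurrence of false, good
goodAutomaton : Automaton Bool
goodAutomaton = record
  { State = Bool × Bool × Bool × Bool
  ; finite = Bool-finite ×-finite Bool-finite ×-finite Bool-finite ×-finite Bool-finite
  ; init = λ c → c , does (c Bool.≟ true) , does (c Bool.≟ false) , true
  ; step = λ (c , t , f , g) (c′ , t′ , f′ , g′) →
      let br = λ h h′ d → not h ∨ (not h′ ∨ (does (c Bool.≟ d) ∧ does (c′ Bool.≟ d))) in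
      c , t ∨ t′ , f ∨ f′ , g ∧ (g′ ∧ (br t t′ true ∧ br f f′ false))
  ; accept = λ (_ , _ , _ , g) → g }

-- The step function of `goodAutomaton` spells out how `does` computes on the combinators in
-- `hasColour?` and `good?`, whence `refl`.
eval-good : ∀ (χ : Pos b → Bool) →
  eval goodAutomaton χ ≡ (χ (top b) , does (hasColour? χ true) , does (hasColour? χ false) , does (good? χ))
eval-good {leaf}  χ = refl
eval-good {l ▹ r} χ rewrite eval-good (χ ∘ inl) | eval-good (χ ∘ inr) = refl

goodAutomaton-correct : ∀ (χ : Pos b → Bool) → Good χ ⇔ T (accepts goodAutomaton χ)
goodAutomaton-correct χ rewrite eval-good χ = mk⇔ (does⁺ {P? = good? χ}) (does⁻ {P? = good? χ})

-- Connectedness of a colour class, tested by Boolean functions.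
Unseparated : (Pos b → Bool) → Bool → Set
Unseparated {b} χ c = ∀ (h : Pos b → Bool) → (∀ p q → χ p ≡ c → χ q ≡ c → ChildB p q → h p ≡ h q) →
  ∀ p q → χ p ≡ c → χ q ≡ c → h p ≡ h q

∈-kids-inl : ∀ (p : Pos l) {q : Pos (l ▹ r)} → q ∈ kids (inl p) → q ≡ inr (top r) × p ≡ top l ⊎ ∃[ q′ ] q ≡ inl q′ × q′ ∈ kids p
∈-kids-inl p c with isTop p in e
∈-kids-inl p (here refl) | true = inj₁ (refl , isTop⇒≡top p (subst T (sym e) tt))
∈-kids-inl p (there c) | true  = let q′ , c′ , e = ∈.∈-map⁻ inl c in inj₂ (q′ , e , c′)
∈-kids-inl p c         | false = let q′ , c′ , e = ∈.∈-map⁻ inl c in inj₂ (q′ , e , c′)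

-- A test on `l` is extended by its value at `top l` to all of `r`. It stays invariant because the
-- only edge between the two parts ends at `top l`. Paths, in contrast, would have to be cut back
-- into `l`.
unseparated-inl : ∀ {χ : Pos (l ▹ r) → Bool} {c} → Unseparated χ c → Unseparated (χ ∘ inl) c
unseparated-inl {l} {χ = χ} {c} u h inv p q = u h′ inv′ (inl p) (inl q)
  where
  h′ : Pos _ → Bool
  h′ (inl p) = h p
  h′ (inr _) = h (top l)
  inv′ : ∀ p q → χ p ≡ c → χ q ≡ c → ChildB p q → h′ p ≡ h′ q
  inv′ (inl p) q x y e with ∈-kids-inl p e
  ... | inj₁ (refl , refl)     = refl
  ... | inj₂ (q′ , refl , e′) = inv p q′ x y e′
  inv′ (inr p) q x y e with ∈.∈-map⁻ inr e
  ... | _ , _ , refl = refl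

unseparated-inr : ∀ {χ : Pos (l ▹ r) → Bool} {c} → Unseparated χ c → Unseparated (χ ∘ inr) c
unseparated-inr {r = r} {χ} {c} u h inv p q = u h′ inv′ (inr p) (inr q)
  where
  h′ : Pos _ → Bool
  h′ (inl _) = h (top r)
  h′ (inr p) = h p
  inv′ : ∀ p q → χ p ≡ c → χ q ≡ c → ChildB p q → h′ p ≡ h′ q
  inv′ (inl p) q x y e with ∈-kids-inl p e
  ... | inj₁ (refl , refl)    = refl
  ... | inj₂ (q′ , refl , e′) = refl
  inv′ (inr p) q x y e with ∈.∈-map⁻ inr e
  ... | q′ , e′ , refl = inv p q′ x y e′

-- If the connecting edge were not entirely of colour `c`, no edge within the class would cross it,
-- and `isLeft` would separate `p` from `q`.
unseparated-bridge : ∀ {χ : Pos (l ▹ r) → Bool} {c} → Unseparated χ c → Bridge χ c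
unseparated-bridge {l} {r} {χ} {c} u (p , x) (q , y)
  with χ (inl (top l)) Bool.≟ c ×-dec χ (inr (top r)) Bool.≟ c
... | yes e = e
... | no ¬e = ⊥-elim (Bool.not-¬ (u isLeft inv (inl p) (inr q) x y) refl)
  where
  isLeft : Pos _ → Bool
  isLeft (inl _) = true
  isLeft (inr _) = false
  inv : ∀ p q → χ p ≡ c → χ q ≡ c → ChildB p q → isLeft p ≡ isLeft q
  inv (inl p) q x y e with ∈-kids-inl p e
  ... | inj₁ (refl , refl)    = ⊥-elim (¬e (x , y))
  ... | inj₂ (q′ , refl , e′) = refl
  inv (inr p) q x y e with ∈.∈-map⁻ inr e
  ... | q′ , e′ , refl = refl

unseparated⇒good : ∀ (χ : Pos b → Bool) → (∀ c → Unseparated χ c) → Good χ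
unseparated⇒good {leaf}  χ u = tt
unseparated⇒good {l ▹ r} χ u = unseparated⇒good (χ ∘ inl) (unseparated-inl ∘ u) , unseparated⇒good (χ ∘ inr) (unseparated-inr ∘ u) ,
  unseparated-bridge (u true) , unseparated-bridge (u false)

Edge : (Pos b → Bool) → Bool → Pos b → Pos b → Set
Edge χ c p q = χ p ≡ c × χ q ≡ c × ChildB p q

good⇒path : ∀ {χ : Pos b → Bool} → Good χ → ∀ c p q → χ p ≡ c → χ q ≡ c → EqClosure (Edge χ c) p q
good⇒path {leaf} g c tip tip x y = Eq.reflexive _
good⇒path {l ▹ r} {χ} g@(gˡ , gʳ , _) c = path
  where
  pathˡ : ∀ p q → χ (inl p) ≡ c → χ (inl q) ≡ c → EqClosure (Edge χ c) (inl p) (inl q)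
  pathˡ p q x y = Eq.gmap inl (λ {p} (x , y , e) → x , y , kids-inl⁺ {p = p} e) (good⇒path gˡ c p q x y)
  pathʳ : ∀ p q → χ (inr p) ≡ c → χ (inr q) ≡ c → EqClosure (Edge χ c) (inr p) (inr q)
  pathʳ p q x y = Eq.gmap inr (λ (x , y , e) → x , y , ∈.∈-map⁺ inr e) (good⇒path gʳ c p q x y)
  across : ∀ p q → χ (inl p) ≡ c → χ (inr q) ≡ c → EqClosure (Edge χ c) (inl p) (inr q)
  across p q x y = let u , v = bridge {χ = χ} g c (p , x) (q , y) in
    Eq.transitive _ (pathˡ p (top l) x u)
      (Eq.transitive _ (Eq.return (u , v , kids-top⁺ l)) (pathʳ (top r) q v y))
  path : ∀ p q → χ p ≡ c → χ q ≡ c → EqClosure (Edge χ c) p q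
  path (inl p) (inl q) x y = pathˡ p q x y
  path (inl p) (inr q) x y = across p q x y
  path (inr p) (inl q) x y = Eq.symmetric _ (across q p y x)
  path (inr p) (inr q) x y = pathʳ p q x y

-- A cut selects any subtree of the curried tree. It is a full subtree of the unranked tree when the
-- path ends with `inR`, as in the proper cuts of `good⇒cut`; a general subtree is a node with a
-- suffix of its children.
data Cut : BTree → Set where
  whole : Cut b
  inL   : Cut l → Cut (l ▹ r)
  inR   : Cut r → Cut (l ▹ r)

inside : Cut b → Pos b → Bool
inside whole   p       = true
inside (inL c) (inl p) = inside c p
inside (inL c) (inr p) = false
inside (inR c) (inl p) = false
inside (inR c) (inr p) = inside c p

Bicoloured : Cut b → (Pos b → Bool) → Bool → Set
Bicoloured c χ s = ∀ p → χ p ≡ (if inside c p then s else not s)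

not⇒≡ : ∀ {x y} → x ≢ not y → x ≡ y
not⇒≡ {true}  {true}  h = refl
not⇒≡ {true}  {false} h = ⊥-elim (h refl)
not⇒≡ {false} {true}  h = ⊥-elim (h refl)
not⇒≡ {false} {false} h = refl

private
  monochrome : ∀ (χ : Pos b → Bool) → ¬ (∃[ p ] χ p ≡ not (χ (top b))) → ∀ p → χ p ≡ χ (top b)
  monochrome χ h p = not⇒≡ λ e → h (p , e)

-- The descent follows the colour that the root lacks. `Bridge` forbids it to occur in both `l` and
-- `r`, since it would then also be the colour of the root. The descent stops at the first edge
-- whose lower end has this colour; by `Bridge` again, everything below is monochromatic.
good⇒cut : ∀ {χ : Pos b → Bool} → Good χ → ∃[ c ] ∃[ s ] Bicoloured {b} c χ s
good⇒cut {b} {χ} g with hasColour? χ (not (χ (top b)))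
-- One of the two parts may be empty; then the cut is the whole tree.
... | no h  = whole , χ (top b) , monochrome χ h
... | yes h = let c , e = go χ g h in
  c , not (χ (top b)) , λ p → trans (e p) (cong (λ d → if inside c p then not (χ (top b)) else d) (sym (Bool.not-involutive _)))
  where
  go : ∀ {b} (χ : Pos b → Bool) → Good χ → ∃[ p ] χ p ≡ not (χ (top b)) →
    ∃[ c ] ∀ p → χ p ≡ (if inside {b} c p then not (χ (top b)) else χ (top b))
  go {leaf} χ g (tip , e) = ⊥-elim (Bool.not-¬ refl e)
  go {l ▹ r} χ g@(gˡ , gʳ , _) h with hasColour? (χ ∘ inl) (not (χ (inl (top l))))
  go {l ▹ r} χ g@(gˡ , gʳ , _) h | yes hˡ = inL (proj₁ cut) , λ { (inl p) → proj₂ cut p ; (inr q) → not⇒≡ (right q) }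
    where
    cut = go (χ ∘ inl) gˡ hˡ
    right : ∀ q → χ (inr q) ≢ not (χ (inl (top l)))
    right q e = Bool.not-¬ refl (proj₁ (bridge {χ = χ} g _ hˡ (q , e)))
  go {l ▹ r} χ g@(gˡ , gʳ , _) h | no ¬hˡ with χ (inr (top r)) Bool.≟ χ (inl (top l))
  ... | no d = inR whole , λ { (inl p) → monochrome (χ ∘ inl) ¬hˡ p ; (inr q) → flipped q }
    where
    flipped : ∀ q → χ (inr q) ≡ not (χ (inl (top l)))
    flipped q with χ (inr q) Bool.≟ χ (inl (top l))
    ... | yes e = ⊥-elim (d (proj₂ (bridge {χ = χ} g _ (top l , refl) (q , e))))
    ... | no ¬e = not⇒≡ λ e → ¬e (trans e (Bool.not-involutive _))
  go {l ▹ r} χ g@(gˡ , gʳ , _) (inl p , e) | no ¬hˡ | yes d = ⊥-elim (¬hˡ (p , e))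
  go {l ▹ r} χ g@(gˡ , gʳ , _) (inr q , e) | no ¬hˡ | yes d = inR (proj₁ cut) ,
    λ { (inl p) → monochrome (χ ∘ inl) ¬hˡ p
      ; (inr p) → trans (proj₂ cut p) (cong (λ c → if inside (proj₁ cut) p then not c else c) d) }
    where cut = go (χ ∘ inr) gʳ (q , trans e (cong not (sym d)))

-- Eliminating the equivalence relation



≢-≢⇒≡ : ∀ {x y z : Bool} → x ≢ z → y ≢ z → x ≡ y
≢-≢⇒≡ {true}  {true}          h h′ = refl
≢-≢⇒≡ {true}  {false} {true}  h h′ = ⊥-elim (h refl)
≢-≢⇒≡ {true}  {false} {false} h h′ = ⊥-elim (h′ refl)
≢-≢⇒≡ {false} {true}  {true}  h h′ = ⊥-elim (h′ refl)
≢-≢⇒≡ {false} {true}  {false} h h′ = ⊥-elim (h refl)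
≢-≢⇒≡ {false} {false}         h h′ = refl

module _ (α : Automaton X) where

  evalInside : Cut b → (Pos b → X) → State α
  evalInside whole   ℓ = eval α ℓ
  evalInside (inL c) ℓ = evalInside c (ℓ ∘ inl)
  evalInside (inR c) ℓ = evalInside c (ℓ ∘ inr)

  evalOutside : Cut b → (Pos b → X) → State α → State α
  evalOutside whole   ℓ q = q
  evalOutside (inL c) ℓ q = step α (evalOutside c (ℓ ∘ inl) q) (eval α (ℓ ∘ inr))
  evalOutside (inR c) ℓ q = step α (eval α (ℓ ∘ inl)) (evalOutside c (ℓ ∘ inr) q)

  eval-cut : ∀ (c : Cut b) ℓ → eval α ℓ ≡ evalOutside c ℓ (evalInside c ℓ)
  eval-cut whole   ℓ = refl
  eval-cut (inL c) ℓ = cong (λ q → step α q (eval α (ℓ ∘ inr))) (eval-cut c (ℓ ∘ inl))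
  eval-cut (inR c) ℓ = cong (step α (eval α (ℓ ∘ inl))) (eval-cut c (ℓ ∘ inr))

  evalInside-cong : ∀ (c : Cut b) {ℓ ℓ′} → (∀ p → inside c p ≡ true → ℓ p ≡ ℓ′ p) → evalInside c ℓ ≡ evalInside c ℓ′
  evalInside-cong whole   h = eval-cong α λ p → h p refl
  evalInside-cong (inL c) h = evalInside-cong c (h ∘ inl)
  evalInside-cong (inR c) h = evalInside-cong c (h ∘ inr)

  evalOutside-cong : ∀ (c : Cut b) {ℓ ℓ′} → (∀ p → inside c p ≡ false → ℓ p ≡ ℓ′ p) → ∀ q → evalOutside c ℓ q ≡ evalOutside c ℓ′ q
  evalOutside-cong whole   h q = refl
  evalOutside-cong (inL c) h q = cong₂ (step α) (evalOutside-cong c (h ∘ inl) q) (eval-cong α λ p → h (inr p) refl)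
  evalOutside-cong (inR c) h q = cong₂ (step α) (eval-cong α λ p → h (inl p) refl) (evalOutside-cong c (h ∘ inr) q)

  open Finite (finite α)

  -- One type serves both sides of the cut: the outside is a transformer of states, and the inside,
  -- a single state, is stored as a constant transformer.
  Trace : Set
  Trace = Vec (State α) size

  -- The behaviour of the side of y when labelled by ℓ, as seen from the other side of the cut.
  trace : Cut b → (Pos b → X) → Pos b → Trace
  trace c ℓ y = Vec.tabulate λ i → if inside c y then evalInside c ℓ else evalOutside c ℓ (at i)

  -- The labellings `ℓ` and `ℓ′` are those from which the traces were computed, and `M` and `M′` are
  -- the actual ones, which may carry further marks across the cut. Equal traces make the own sides
  -- interchangeable, and the far sides agree by hypothesis.
  eval-trace : ∀ (c : Cut b) {y y′ ℓ ℓ′ M M′} → inside c y ≡ inside c y′ → trace c ℓ y ≡ trace c ℓ′ y′ →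
    (∀ p → inside c p ≡ inside c y → M p ≡ ℓ p) → (∀ p → inside c p ≡ inside c y → M′ p ≡ ℓ′ p) →
    (∀ p → inside c p ≢ inside c y → M p ≡ M′ p) → eval α M ≡ eval α M′
  eval-trace c {y} {y′} {ℓ} {ℓ′} {M} {M′} e t own own′ other
    rewrite eval-cut c M | eval-cut c M′ with inside c y | inside c y′
  eval-trace c {ℓ = ℓ} {ℓ′} {M} {M′} refl t own own′ other | true | _ = begin
    evalOutside c M (evalInside c M)   ≡⟨ evalOutside-cong c (λ p e → other p (λ e′ → Bool.not-¬ (trans (sym e) e′) refl)) _ ⟩
    evalOutside c M′ (evalInside c M)  ≡⟨ cong (evalOutside c M′) (begin
      evalInside c M   ≡⟨ evalInside-cong c own ⟩
      -- A constant vector determines its value only if it has an entry; the index of the state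
      -- itself provides one.
      evalInside c ℓ   ≡⟨ Vec.lookup∘tabulate _ (index (evalInside c ℓ)) ⟨
      lookup (Vec.tabulate λ _ → evalInside c ℓ) (index (evalInside c ℓ))  ≡⟨ cong (λ v → lookup v _) t ⟩
      lookup (Vec.tabulate λ _ → evalInside c ℓ′) (index (evalInside c ℓ)) ≡⟨ Vec.lookup∘tabulate _ (index (evalInside c ℓ)) ⟩
      evalInside c ℓ′  ≡⟨ evalInside-cong c own′ ⟨
      evalInside c M′  ∎) ⟩
    evalOutside c M′ (evalInside c M′) ∎
    where open ≡-Reasoning
  eval-trace c {ℓ = ℓ} {ℓ′} {M} {M′} refl t own own′ other | false | _ = begin
    evalOutside c M (evalInside c M)   ≡⟨ cong (evalOutside c M) (evalInside-cong c λ p e → other p (λ e′ → Bool.not-¬ (trans (sym e) e′) refl)) ⟩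
    evalOutside c M q                  ≡⟨ evalOutside-cong c own q ⟩
    evalOutside c ℓ q                  ≡⟨ cong (evalOutside c ℓ) (at-index q) ⟨
    evalOutside c ℓ (at (index q))     ≡⟨ Vec.lookup∘tabulate _ (index q) ⟨
    lookup (Vec.tabulate (evalOutside c ℓ ∘ at)) (index q)  ≡⟨ cong (λ v → lookup v (index q)) t ⟩
    lookup (Vec.tabulate (evalOutside c ℓ′ ∘ at)) (index q) ≡⟨ Vec.lookup∘tabulate _ (index q) ⟩
    evalOutside c ℓ′ (at (index q))    ≡⟨ cong (evalOutside c ℓ′) (at-index q) ⟩
    evalOutside c ℓ′ q                 ≡⟨ evalOutside-cong c own′ q ⟨
    evalOutside c M′ q                 ∎
    where open ≡-Reasoning
          q = evalInside c M′

-- A bipartite data tree together with its curried form.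
record Instance (A : Set) : Set₁ where
  infix 4 _∼_ _∼ᴾ_
  field
    shape            : Shape
    label            : Labelling A shape
    _∼_              : Rel (Node shape) 0ℓ
    ∼-isDec : IsDecEquivalence _∼_
    tree             : BTree
    iso              : Iso shape tree
    side             : Pos tree → Bool
    good             : Good side
    unique           : ∀ p q → Iso.from iso p ∼ Iso.from iso q → side p ≡ side q → p ≡ q

  open Iso iso public
  module ∼ = IsDecEquivalence ∼-isDec

  _∼ᴾ_ : Pos tree → Pos tree → Set
  p ∼ᴾ q = from p ∼ from q

  partner? : ∀ p → Dec (∃[ q ] q ≢ p × p ∼ᴾ q)
  partner? p = ∃Pos? λ q → ¬? (q ≟ᴾ p) ×-dec (from p ∼.≟ from q)

  matched : Pos tree → Bool
  matched p = does (partner? p)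

  ∼⇒sides-differ : ∀ {p q} → p ∼ᴾ q → p ≢ q → side p ≢ side q
  ∼⇒sides-differ h p≢q e = p≢q (unique _ _ h e)

  node-∼ : ∀ {v w} → v ∼ w → to v ∼ᴾ to w
  node-∼ h = subst₂ _∼_ (sym (from-to _)) (sym (from-to _)) h

  node-∼⁻ : ∀ {v w} → to v ∼ᴾ to w → v ∼ w
  node-∼⁻ h = subst₂ _∼_ (from-to _) (from-to _) h

-- letter, side, whether some other node has the same class, colour
Lab : Set → Set → Set
Lab A K = A × Bool × Bool × K

recolour : ∀ {K K′ : Set} → (K → K′) → Lab A K → Lab A K′
recolour f (a , s , u , k) = a , s , u , f k

module _ (d : Instance A) {K : Set} (κ : Pos (Instance.tree d) → K) where
  open Instance d

  lab : Pos tree → Lab A K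
  lab p = label (from p) , side p , matched p , κ p

  Respects : Set
  Respects = ∀ p q → p ∼ᴾ q → κ p ≡ κ q

Query : Set → ℕ → Set₁
Query A m = (d : Instance A) → Vec (Node (Instance.shape d)) m → Set

-- R is expressed by a formula which does not use ∼, over trees with a valid colouring
-- that is constant on classes.
record Capture {A m} (R : Query A m) : Set₁ where
  field
    Colour        : Set
    colour-finite : Finite Colour
    valid         : Formula (Lab A Colour) 0
    formula       : Formula (Lab A Colour) m

  Proper : (d : Instance A) → (Pos (Instance.tree d) → Colour) → Set
  Proper d κ = ⟦ valid ⟧ (lab d κ) [] × Respects d κ

  field
    colourable : ∀ d → ∃ (Proper d)
    correct    : ∀ d κ → Proper d κ → ∀ ν → R d ν ⇔ ⟦ formula ⟧ (lab d κ) (Vec.map (Instance.to d) ν)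

Capture-cong : ∀ {R R′ : Query A m} → (∀ d ν → R d ν ⇔ R′ d ν) → Capture R → Capture R′
Capture-cong h C = record { Capture C ; correct = λ d κ proper ν →
  mk⇔ (⇒ (Capture.correct C d κ proper ν) ∘ ⇐ (h d ν)) (⇒ (h d ν) ∘ ⇐ (Capture.correct C d κ proper ν)) }

Same Other : Query A 3 → Query A 1
Same  R d (x ∷ []) = let open Instance d in ∃[ y ] ∃[ z ] y ∼ z × R d (x ∷ y ∷ z ∷ [])
Other R d (x ∷ []) = let open Instance d in ∃[ y ] ∃[ z ] ¬ y ∼ z × R d (x ∷ y ∷ z ∷ [])

-- Equally coloured nodes y and y′ on one side are made indistinguishable by φ from the other
-- side.  Hence, as far as φ is concerned, ∼ between the two sides may be replaced by
-- equality of colours.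
module Typed {A : Set} {R : Query A 3} (C : Capture R) where
  open Capture C

  φ : Formula (Lab A Colour) 3
  φ = formula

  α : Automaton (Lab A Colour × Vec Bool 3)
  α = compile φ

  Type : Set
  Type = Trace α × Trace α

  Type-finite : Finite Type
  Type-finite = Vec-finite (finite α) _ ×-finite Vec-finite (finite α) _

  -- The types of the nodes of a class on the two sides.
  Colour′ : Set
  Colour′ = Colour × Type × Type

  abstract
   Colour′-finite : Finite Colour′
   Colour′-finite = colour-finite ×-finite Type-finite ×-finite Type-finite

  Info : Set
  Info = Bool × Bool × Colour′

  Info-finite : Finite Info
  Info-finite = Bool-finite ×-finite Bool-finite ×-finite Colour′-finite

  private
    infix 4 _≟ᶜ_
    _≟ᶜ_ = Finite._≟_ Colour′-finite

  opposite? : ∀ (i j : Info) → Dec (proj₁ i ≢ proj₁ j)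
  opposite? (s , _) (s′ , _) = ¬? (s Bool.≟ s′)

  alike? : ∀ (i j : Info) → Dec (proj₁ i ≡ proj₁ j × proj₂ (proj₂ i) ≡ proj₂ (proj₂ j))
  alike? (s , _ , k) (s′ , _ , k′) = s Bool.≟ s′ ×-dec k ≟ᶜ k′

  -- The surrogate for being equivalent and distinct that can be read off the labels alone.
  compatible? : ∀ (i j : Info) → Dec (proj₁ i ≢ proj₁ j × T (proj₁ (proj₂ i)) × T (proj₁ (proj₂ j)) × proj₂ (proj₂ i) ≡ proj₂ (proj₂ j))
  compatible? (s , u , k) (s′ , u′ , k′) = ¬? (s Bool.≟ s′) ×-dec T? u ×-dec T? u′ ×-dec k ≟ᶜ k′

  opposite alike compatible : Fin m → Fin m → Formula (Lab A Colour′) m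
  opposite   = relate Info-finite proj₂ opposite?
  alike      = relate Info-finite proj₂ alike?
  compatible = relate Info-finite proj₂ compatible?

  φ[_,_,_] : Fin m → Fin m → Fin m → Formula (Lab A Colour′) m
  φ[ x , y , z ] = app (recolour proj₁) (x ∷ y ∷ z ∷ []) φ

  -- Variables 0 and 1 are the alike nodes y and y′; variables 2 and 3 are x and the remaining
  -- argument, both on the other side.
  distinguished : Formula (Lab A Colour′) 4 → Formula (Lab A Colour′) 4 → Formula (Lab A Colour′) 0
  distinguished ψ ψ′ = ex (ex (ex (ex
    (and (alike 0F 1F) (and (opposite 2F 0F) (and (opposite 3F 0F) (and ψ (neg ψ′))))))))

  -- Only the consequence of equal types is demanded: alike nodes cannot be told apart from the
  -- other side. Both argument positions occur, since either y or z may be the node to be exchanged.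
  valid′ : Formula (Lab A Colour′) 0
  valid′ = and (app (recolour proj₁) [] valid) (and
    (neg (distinguished φ[ 2F , 0F , 3F ] φ[ 2F , 1F , 3F ]))
    (neg (distinguished φ[ 2F , 3F , 0F ] φ[ 2F , 3F , 1F ])))

  -- Labels cannot tell whether compatible y and z are equivalent. For `other`, a twin decides: if
  -- z′ ≢ z is alike z and x is on the other side, z and z′ are interchangeable for φ, and y is
  -- equivalent to at most one of them. Conversely, if y and z are compatible but not equivalent,
  -- the true partner of y is such a twin of z. As x is opposite to y or to z, one of the two
  -- symmetric disjuncts applies.
  same other : Formula (Lab A Colour′) 1
  same = ex (ex (and φ[ 2F , 1F , 0F ] (orᶠ (equal 1F 0F) (compatible 1F 0F))))
  other = ex (ex (and φ[ 2F , 1F , 0F ] (and (neg (equal 1F 0F))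
    (orᶠ (neg (compatible 1F 0F)) (orᶠ
      (and (opposite 2F 0F) (ex (and (neg (equal 0F 1F)) (alike 1F 0F))))
      (and (opposite 2F 1F) (ex (and (neg (equal 0F 2F)) (alike 2F 0F)))))))))

  module _ (d : Instance A) (κ : Pos (Instance.tree d) → Colour′) where
    open Instance d

    Φ : Pos tree → Pos tree → Pos tree → Set
    Φ x y z = ⟦ φ ⟧ (lab d (proj₁ ∘ κ)) (x ∷ y ∷ z ∷ [])

    Alike Compatible : Pos tree → Pos tree → Set
    Alike p q = side p ≡ side q × κ p ≡ κ q
    Compatible p q = side p ≢ side q × T (matched p) × T (matched q) × κ p ≡ κ q

    module _ {m} (μ : Vec (Pos tree) m) (x y : Fin m) where
      opposite⇔ : side (lookup μ x) ≢ side (lookup μ y) ⇔ ⟦ opposite x y ⟧ (lab d κ) μ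
      opposite⇔ = mk⇔ (relate⁺ Info-finite proj₂ opposite?) (relate⁻ Info-finite proj₂ opposite?)

      alike⇔ : Alike (lookup μ x) (lookup μ y) ⇔ ⟦ alike x y ⟧ (lab d κ) μ
      alike⇔ = mk⇔ (relate⁺ Info-finite proj₂ alike?) (relate⁻ Info-finite proj₂ alike?)

      compatible⇔ : Compatible (lookup μ x) (lookup μ y) ⇔ ⟦ compatible x y ⟧ (lab d κ) μ
      compatible⇔ = mk⇔ (relate⁺ Info-finite proj₂ compatible?) (relate⁻ Info-finite proj₂ compatible?)

    Indistinguishable : Set
    Indistinguishable = ∀ {y y′ x z} → Alike y y′ → side x ≢ side y → side z ≢ side y →
      (Φ x y z → Φ x y′ z) × (Φ x z y → Φ x z y′)

    valid′⁻ : ⟦ valid′ ⟧ (lab d κ) [] → ⟦ valid ⟧ (lab d (proj₁ ∘ κ)) [] × Indistinguishable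
    valid′⁻ (v , h , h′) = v , λ {y} {y′} {x} {z} a o o′ →
      let μ = y ∷ y′ ∷ x ∷ z ∷ [] in
      (λ s → decidable-stable (decide φ _ _) λ ¬s → h (z , x , y′ , y , ⇒ (alike⇔ μ 0F 1F) a , ⇒ (opposite⇔ μ 2F 0F) o , ⇒ (opposite⇔ μ 3F 0F) o′ , s , ¬s)) ,
      (λ s → decidable-stable (decide φ _ _) λ ¬s → h′ (z , x , y′ , y , ⇒ (alike⇔ μ 0F 1F) a , ⇒ (opposite⇔ μ 2F 0F) o , ⇒ (opposite⇔ μ 3F 0F) o′ , s , ¬s))

    valid′⁺ : ⟦ valid ⟧ (lab d (proj₁ ∘ κ)) [] → Indistinguishable → ⟦ valid′ ⟧ (lab d κ) []
    valid′⁺ v h = v ,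
      (λ (z , x , y′ , y , a , o , o′ , s , ¬s) → let μ = y ∷ y′ ∷ x ∷ z ∷ [] in
        ¬s (proj₁ (h (⇐ (alike⇔ μ 0F 1F) a) (⇐ (opposite⇔ μ 2F 0F) o) (⇐ (opposite⇔ μ 3F 0F) o′)) s)) ,
      (λ (z , x , y′ , y , a , o , o′ , s , ¬s) → let μ = y ∷ y′ ∷ x ∷ z ∷ [] in
        ¬s (proj₂ (h (⇐ (alike⇔ μ 0F 1F) a) (⇐ (opposite⇔ μ 2F 0F) o) (⇐ (opposite⇔ μ 3F 0F) o′)) s))

    module _ (indist : Indistinguishable) (respects : Respects d κ) where

      ∼⇒compatible : ∀ {p q} → p ∼ᴾ q → p ≢ q → Compatible p q
      ∼⇒compatible {p} {q} h p≢q = ∼⇒sides-differ h p≢q ,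
        does⁺ {P? = partner? p} (q , p≢q ∘ sym , h) , does⁺ {P? = partner? q} (p , p≢q , ∼.sym h) , respects p q h

      partnerOf : ∀ {p q} → Compatible p q → ∃[ q′ ] p ∼ᴾ q′ × p ≢ q′ × Alike q q′
      partnerOf {p} {q} (o , u , _ , e) with does⁻ {P? = partner? p} u
      ... | q′ , q′≢p , h = q′ , h , q′≢p ∘ sym ,
        ≢-≢⇒≡ (o ∘ sym) (∼⇒sides-differ h (q′≢p ∘ sym) ∘ sym) , trans (sym e) (respects p q′ h)

      Compatible-sym : ∀ {p q} → Compatible p q → Compatible q p
      Compatible-sym (o , u , u′ , e) = o ∘ sym , u′ , u , sym e

      Φ-∼ : Pos tree → Set
      Φ-∼ x = ∃[ y ] ∃[ z ] y ∼ᴾ z × Φ x y z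

      Φ-≁ : Pos tree → Set
      Φ-≁ x = ∃[ y ] ∃[ z ] (¬ y ∼ᴾ z) × Φ x y z

      -- Whichever of y and z is opposite to x is replaced by the true partner of the other one;
      -- equal colours and sides make this partner alike the node that it replaces.
      compatible⇒∼ : ∀ {x y z} → Φ x y z → Compatible y z → Φ-∼ x
      compatible⇒∼ {x} {y} {z} s c with side x Bool.≟ side z
      ... | no o = let z′ , h , _ , a = partnerOf c in y , z′ , h , proj₂ (indist a o (proj₁ c)) s
      ... | yes e = let y′ , h , _ , a = partnerOf (Compatible-sym c) in
        y′ , z , ∼.sym h , proj₁ (indist a (λ e′ → proj₁ c (trans (sym e′) e)) (proj₁ c ∘ sym)) s

      twin⇒≁ : ∀ {x y z z′} → Φ x y z → y ≢ z → side x ≢ side z → z′ ≢ z → Alike z z′ → Φ-≁ x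
      twin⇒≁ {x} {y} {z} {z′} s y≢z o z′≢z a with from y ∼.≟ from z
      ... | no ¬h = y , z , ¬h , s
      ... | yes h = y , z′ , (λ h′ → z′≢z (unique z′ z (∼.trans (∼.sym h′) h) (sym (proj₁ a)))) ,
        proj₂ (indist a o (∼⇒sides-differ h y≢z)) s

      twin⇒≁′ : ∀ {x y z y′} → Φ x y z → y ≢ z → side x ≢ side y → y′ ≢ y → Alike y y′ → Φ-≁ x
      twin⇒≁′ {x} {y} {z} {y′} s y≢z o y′≢y a with from y ∼.≟ from z
      ... | no ¬h = y , z , ¬h , s
      ... | yes h = y′ , z , (λ h′ → y′≢y (unique y′ y (∼.trans h′ (∼.sym h)) (sym (proj₁ a)))) ,
        proj₁ (indist a o (∼⇒sides-differ h y≢z ∘ sym)) s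

      same-correct : ∀ x → Φ-∼ x ⇔ ⟦ same ⟧ (lab d κ) (x ∷ [])
      same-correct x = mk⇔ to′ from′
        where
        disj : ∀ y z → (y ≡ z ⊎ ⟦ compatible 1F 0F ⟧ (lab d κ) (z ∷ y ∷ x ∷ [])) ⇔ _
        disj y z = or-correct (equal 1F 0F) (compatible 1F 0F)
        to′ : Φ-∼ x → ⟦ same ⟧ (lab d κ) (x ∷ [])
        to′ (y , z , h , s) with y ≟ᴾ z
        ... | yes e  = y , z , s , ⇒ (disj y z) (inj₁ e)
        ... | no y≢z = y , z , s , ⇒ (disj y z) (inj₂ (⇒ (compatible⇔ (z ∷ y ∷ x ∷ []) 1F 0F) (∼⇒compatible h y≢z)))
        from′ : ⟦ same ⟧ (lab d κ) (x ∷ []) → Φ-∼ x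
        from′ (y , z , s , t) with ⇐ (disj y z) t
        ... | inj₁ refl = y , y , ∼.refl , s
        ... | inj₂ c    = compatible⇒∼ s (⇐ (compatible⇔ (z ∷ y ∷ x ∷ []) 1F 0F) c)

      other-correct : ∀ x → Φ-≁ x ⇔ ⟦ other ⟧ (lab d κ) (x ∷ [])
      other-correct x = mk⇔ to′ from′
        where
        ψ₁ ψ₂ ψ₃ : Formula (Lab A Colour′) 3
        ψ₁ = neg (compatible 1F 0F)
        ψ₂ = and (opposite 2F 0F) (ex (and (neg (equal 0F 1F)) (alike 1F 0F)))
        ψ₃ = and (opposite 2F 1F) (ex (and (neg (equal 0F 2F)) (alike 2F 0F)))
        to′ : Φ-≁ x → ⟦ other ⟧ (lab d κ) (x ∷ [])
        to′ (y , z , ¬h , s) = y , z , s , (λ { refl → ¬h ∼.refl }) , ⇒ (or-correct ψ₁ (orᶠ ψ₂ ψ₃)) cases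
          where
          μ = z ∷ y ∷ x ∷ []
          cases : ⟦ ψ₁ ⟧ (lab d κ) μ ⊎ ⟦ orᶠ ψ₂ ψ₃ ⟧ (lab d κ) μ
          cases with decide (compatible 1F 0F) (lab d κ) μ
          ... | no ¬c = inj₁ ¬c
          ... | yes c = inj₂ (⇒ (or-correct ψ₂ ψ₃) twins)
            where
            c′ : Compatible y z
            c′ = ⇐ (compatible⇔ μ 1F 0F) c
            twins : ⟦ ψ₂ ⟧ (lab d κ) μ ⊎ ⟦ ψ₃ ⟧ (lab d κ) μ
            twins with side x Bool.≟ side z
            ... | no o = let z′ , h , _ , a = partnerOf c′ in
              inj₁ (⇒ (opposite⇔ μ 2F 0F) o , z′ , (λ e → ¬h (subst (y ∼ᴾ_) e h)) , ⇒ (alike⇔ (z′ ∷ μ) 1F 0F) a)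
            ... | yes e = let y′ , h , _ , a = partnerOf (Compatible-sym c′) in
              inj₂ (⇒ (opposite⇔ μ 2F 1F) (λ e′ → proj₁ c′ (trans (sym e′) e)) ,
                y′ , (λ e → ¬h (∼.sym (subst (z ∼ᴾ_) e h))) , ⇒ (alike⇔ (y′ ∷ μ) 2F 0F) a)
        from′ : ⟦ other ⟧ (lab d κ) (x ∷ []) → Φ-≁ x
        from′ (y , z , s , y≢z , t) = [ case₁ , [ case₂ , case₃ ]′ ∘ ⇐ (or-correct ψ₂ ψ₃) ]′ (⇐ (or-correct ψ₁ (orᶠ ψ₂ ψ₃)) t)
          where
          μ = z ∷ y ∷ x ∷ []
          case₁ : ⟦ ψ₁ ⟧ (lab d κ) μ → Φ-≁ x
          case₁ ¬c = y , z , (λ h → ¬c (⇒ (compatible⇔ μ 1F 0F) (∼⇒compatible h y≢z))) , s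
          case₂ : ⟦ ψ₂ ⟧ (lab d κ) μ → Φ-≁ x
          case₂ (o , z′ , z′≢z , a) = twin⇒≁ s y≢z (⇐ (opposite⇔ μ 2F 0F) o) z′≢z (⇐ (alike⇔ (z′ ∷ μ) 1F 0F) a)
          case₃ : ⟦ ψ₃ ⟧ (lab d κ) μ → Φ-≁ x
          case₃ (o , y′ , y′≢y , a) = twin⇒≁′ s y≢z (⇐ (opposite⇔ μ 2F 1F) o) y′≢y (⇐ (alike⇔ (y′ ∷ μ) 2F 0F) a)

  module _ (d : Instance A) where
    open Instance d

    private
      κ₀ : Pos tree → Colour
      κ₀ = proj₁ (colourable d)

      cut = good⇒cut good
      c = proj₁ cut

      inside-≡ : ∀ {p q} → side p ≡ side q → inside c p ≡ inside c q
      inside-≡ {p} {q} e with inside c p | proj₂ (proj₂ cut) p | inside c q | proj₂ (proj₂ cut) q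
      ... | true  | _  | true  | _  = refl
      ... | true  | e₁ | false | e₂ = ⊥-elim (Bool.not-¬ refl (trans (sym e₁) (trans e e₂)))
      ... | false | e₁ | true  | e₂ = ⊥-elim (Bool.not-¬ refl (trans (sym e₂) (trans (sym e) e₁)))
      ... | false | _  | false | _  = refl

      inside-≢ : ∀ {p q} → side p ≢ side q → inside c p ≢ inside c q
      inside-≢ {p} {q} h e = h (trans (proj₂ (proj₂ cut) p)
        (trans (cong (λ i → if i then proj₁ (proj₂ cut) else not (proj₁ (proj₂ cut))) e) (sym (proj₂ (proj₂ cut) q))))

      -- In an exchange the other two variables lie across the cut, so on this side only the
      -- exchanged variable leaves a mark, in the second or in the third position.
      markY markZ : Pos tree → Pos tree → Lab A Colour × Vec Bool 3
      markY y p = lab d κ₀ p , false ∷ does (y ≟ᴾ p) ∷ false ∷ []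
      markZ z p = lab d κ₀ p , false ∷ false ∷ does (z ≟ᴾ p) ∷ []

      type : Pos tree → Type
      type y = trace α c (markY y) y , trace α c (markZ y) y

      partner : Pos tree → Pos tree
      partner p with partner? p
      ... | yes (q , _) = q
      -- A default: an unmatched node merely records its own type twice.
      ... | no _        = p

      partner-≡ : ∀ {p q} → p ∼ᴾ q → p ≢ q → partner p ≡ q
      partner-≡ {p} {q} h p≢q with partner? p
      ... | no ¬m = ⊥-elim (¬m (q , p≢q ∘ sym , h))
      ... | yes (q′ , q′≢p , h′) = unique q′ q (∼.trans (∼.sym h′) h)
        (≢-≢⇒≡ (∼⇒sides-differ h′ (q′≢p ∘ sym) ∘ sym) (∼⇒sides-differ h p≢q ∘ sym))

      -- The pair is ordered by side and not by owner, so that partners receive the same colour; the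
      -- side then tells which component is the node's own type.
      types : Bool → Pos tree → Type × Type
      types true  p = type p , type (partner p)
      types false p = type (partner p) , type p

      κ : Pos tree → Colour′
      κ p = κ₀ p , types (side p) p

      own-type : ∀ s {p q} → types s p ≡ types s q → type p ≡ type q
      own-type true  e = cong proj₁ e
      own-type false e = cong proj₂ e

      types-∼ : ∀ p q s s′ → s ≢ s′ → partner p ≡ q → partner q ≡ p → types s p ≡ types s′ q
      types-∼ p q true  true  h e e′ = ⊥-elim (h refl)
      types-∼ p q true  false h e e′ = cong₂ _,_ (cong type (sym e′)) (cong type e)
      types-∼ p q false true  h e e′ = cong₂ _,_ (cong type e) (cong type (sym e′))
      types-∼ p q false false h e e′ = ⊥-elim (h refl)

      respects : Respects d κ
      respects p q h with p ≟ᴾ q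
      ... | yes refl = refl
      ... | no p≢q   = cong₂ _,_ (proj₂ (proj₂ (colourable d)) p q h)
        (types-∼ p q _ _ (∼⇒sides-differ h p≢q) (partner-≡ h p≢q) (partner-≡ (∼.sym h) (p≢q ∘ sym)))

      unmarked : ∀ {x p} → inside c p ≢ inside c x → does (x ≟ᴾ p) ≡ false
      unmarked {x} {p} h = dec-false (x ≟ᴾ p) λ { refl → h refl }

      indistinguishable : Indistinguishable d κ
      indistinguishable {y} {y′} {x} {z} (e , k) o o′ = transfer s₁ , transfer s₂
        where
        t : type y ≡ type y′
        t = own-type (side y′) (trans (cong (λ s → types s y) (sym e)) (cong proj₂ k))
        away : ∀ {w p} → side w ≢ side y → inside c p ≡ inside c y → does (w ≟ᴾ p) ≡ false
        away h i = unmarked λ j → inside-≢ h (trans (sym j) i)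
        near : ∀ {w p} → side w ≡ side y → inside c p ≢ inside c y → does (w ≟ᴾ p) ≡ false
        near h i = unmarked λ j → i (trans j (inside-≡ h))
        transfer : ∀ {μ μ′ : Vec (Pos tree) 3} → eval α (marked (lab d κ₀) μ) ≡ eval α (marked (lab d κ₀) μ′) →
          ⟦ φ ⟧ (lab d κ₀) μ → ⟦ φ ⟧ (lab d κ₀) μ′
        transfer e s = ⇐ (compile-correct φ _ _) (subst (T ∘ accept α) e (⇒ (compile-correct φ _ _) s))
        triple : ∀ {u u′ v v′ w w′ : Bool} {ℓ : Lab A Colour} → u ≡ u′ → v ≡ v′ → w ≡ w′ →
          _≡_ {A = Lab A Colour × Vec Bool 3} (ℓ , u ∷ v ∷ w ∷ []) (ℓ , u′ ∷ v′ ∷ w′ ∷ [])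
        triple refl refl refl = refl
        s₁ : eval α (marked (lab d κ₀) (x ∷ y ∷ z ∷ [])) ≡ eval α (marked (lab d κ₀) (x ∷ y′ ∷ z ∷ []))
        s₁ = eval-trace α c (inside-≡ e) (cong proj₁ t)
          (λ p i → triple (away o i) refl (away o′ i))
          (λ p i → triple (away o i) refl (away o′ i))
          (λ p i → triple refl (trans (near refl i) (sym (near (sym e) i))) refl)
        s₂ : eval α (marked (lab d κ₀) (x ∷ z ∷ y ∷ [])) ≡ eval α (marked (lab d κ₀) (x ∷ z ∷ y′ ∷ []))
        s₂ = eval-trace α c (inside-≡ e) (cong proj₂ t)
          (λ p i → triple (away o i) (away o′ i) refl)
          (λ p i → triple (away o i) (away o′ i) refl)
          (λ p i → triple refl refl (trans (near refl i) (sym (near (sym e) i))))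

    colourable′ : ∃[ κ ] ⟦ valid′ ⟧ (lab d κ) [] × Respects d κ
    colourable′ = κ , valid′⁺ d κ (proj₁ (proj₂ (colourable d))) indistinguishable , respects

  module _ (d : Instance A) (κ : Pos (Instance.tree d) → Colour′) (proper : ⟦ valid′ ⟧ (lab d κ) [] × Respects d κ) where
    open Instance d
    private
      base : Proper d (proj₁ ∘ κ)
      base = proj₁ (valid′⁻ d κ (proj₁ proper)) , λ p q h → cong proj₁ (proj₂ proper p q h)

      R⇔Φ : ∀ x y z → R d (x ∷ y ∷ z ∷ []) ⇔ Φ d κ (to x) (to y) (to z)
      R⇔Φ x y z = correct d (proj₁ ∘ κ) base (x ∷ y ∷ z ∷ [])

      indist = proj₂ (valid′⁻ d κ (proj₁ proper))

      fromPos : ∀ x {p q} → Φ d κ (to x) p q → R d (x ∷ from p ∷ from q ∷ [])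
      fromPos x s = ⇐ (R⇔Φ x _ _) (subst₂ (Φ d κ (to x)) (sym (to-from _)) (sym (to-from _)) s)

    same-captured : ∀ x → Same R d (x ∷ []) ⇔ ⟦ same ⟧ (lab d κ) (to x ∷ [])
    same-captured x = mk⇔
      (λ (y , z , h , s) → ⇒ (same-correct d κ indist (proj₂ proper) (to x)) (to y , to z , node-∼ h , ⇒ (R⇔Φ x y z) s))
      (λ t → nodes (⇐ (same-correct d κ indist (proj₂ proper) (to x)) t))
      where
      nodes : Φ-∼ d κ indist (proj₂ proper) (to x) → Same R d (x ∷ [])
      nodes (p , q , h , s) = from p , from q , h , fromPos x s

    other-captured : ∀ x → Other R d (x ∷ []) ⇔ ⟦ other ⟧ (lab d κ) (to x ∷ [])
    other-captured x = mk⇔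
      (λ (y , z , h , s) → ⇒ (other-correct d κ indist (proj₂ proper) (to x)) (to y , to z , h ∘ node-∼⁻ , ⇒ (R⇔Φ x y z) s))
      (λ t → nodes (⇐ (other-correct d κ indist (proj₂ proper) (to x)) t))
      where
      nodes : Φ-≁ d κ indist (proj₂ proper) (to x) → Other R d (x ∷ [])
      nodes (p , q , h , s) = from p , from q , h , fromPos x s

capture-same : ∀ {R : Query A 3} → Capture R → Capture (Same R)
capture-same C = record
  { Colour = Colour′ ; colour-finite = Colour′-finite ; valid = valid′ ; formula = same ; colourable = colourable′
  ; correct = λ { d κ proper (x ∷ []) → same-captured d κ proper x } }
  where open Typed C

capture-other : ∀ {R : Query A 3} → Capture R → Capture (Other R)
capture-other C = record
  { Colour = Colour′ ; colour-finite = Colour′-finite ; valid = valid′ ; formula = other ; colourable = colourable′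
  ; correct = λ { d κ proper (x ∷ []) → other-captured d κ proper x } }
  where open Typed C

-- XPath queries


-- An iterated product instead of a dependent function, so that colours have decidable equality and
-- pointwise equal families give equal tuples.
Tuple : (Fin g → Set) → Set
Tuple {zero}  K = ⊤
Tuple {suc g} K = K zero × Tuple (K ∘ suc)

component : ∀ {K : Fin g → Set} i → Tuple K → K i
component zero    (x , _)  = x
component (suc i) (_ , xs) = component i xs

tuple : ∀ {K : Fin g → Set} → (∀ i → K i) → Tuple K
tuple {zero}  f = tt
tuple {suc g} f = f zero , tuple (f ∘ suc)

component-tuple : ∀ {K : Fin g → Set} (f : ∀ i → K i) i → component {K = K} i (tuple f) ≡ f i
component-tuple f zero    = refl
component-tuple f (suc i) = component-tuple (f ∘ suc) i

tuple-cong : ∀ {K : Fin g → Set} {f f′ : ∀ i → K i} → (∀ i → f i ≡ f′ i) → tuple {K = K} f ≡ tuple f′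
tuple-cong {zero}  h = refl
tuple-cong {suc g} h = cong₂ _,_ (h zero) (tuple-cong (h ∘ suc))

Tuple-finite : ∀ {K : Fin g → Set} → (∀ i → Finite (K i)) → Finite (Tuple K)
Tuple-finite {zero}  fin = ⊤-finite
Tuple-finite {suc g} fin = fin zero ×-finite Tuple-finite (fin ∘ suc)

conjunction : ∀ {L} → (Fin g → Formula L 0) → Formula L 0
-- Without free variables no atom for truth is at hand, so a trivial universal sentence takes its
-- place.
conjunction {zero}  φ = allᶠ (equal zero zero)
conjunction {suc g} φ = and (φ zero) (conjunction (φ ∘ suc))

module _ {L : Set} {b} {ℓ : Pos b → L} where
  conjunction⁺ : ∀ (φ : Fin g → Formula L 0) → (∀ i → ⟦ φ i ⟧ ℓ []) → ⟦ conjunction φ ⟧ ℓ []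
  conjunction⁺ {zero}  φ h (_ , ¬e) = ¬e refl
  conjunction⁺ {suc g} φ h = h zero , conjunction⁺ (φ ∘ suc) (h ∘ suc)

  conjunction⁻ : ∀ (φ : Fin g → Formula L 0) → ⟦ conjunction φ ⟧ ℓ [] → ∀ i → ⟦ φ i ⟧ ℓ []
  conjunction⁻ φ (s , _) zero    = s
  conjunction⁻ φ (_ , s) (suc i) = conjunction⁻ (φ ∘ suc) s i

module _ {L : Set} (letterOf : L → Fin σ) (predicate : Fin g → Formula L 1) where

  extend : ∀ {k} → (L × Vec Bool k) × Bool → L × Vec Bool (suc k)
  extend ((l , w) , c) = l , c ∷ w

  -- Set variables become Boolean components of the labels.
  translate : MSO σ g m k → Formula (L × Vec Bool k) m
  translate (letter a x)      = test (λ (l , _) → does (letterOf l Fin.≟ a)) x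
  translate (pred i x)        = app proj₁ (x ∷ []) (predicate i)
  translate (child x y)       = child x y
  translate (nextSibling x y) = sibling x y
  translate (equal x y)       = equal x y
  translate (member x X)      = test (λ (_ , w) → lookup w X) x
  translate (neg φ)           = neg (translate φ)
  translate (and φ ψ)         = and (translate φ) (translate ψ)
  translate (or φ ψ)          = orᶠ (translate φ) (translate ψ)
  translate (ex φ)            = ex (translate φ)
  translate (all φ)           = allᶠ (translate φ)
  -- `extend` moves the quantified set from the new label component to the front of the vector;
  -- `Vec.allFin` is the identity substitution on node variables.
  translate (exSet φ)         = exSet (app extend (Vec.allFin _) (translate φ))
  translate (allSet φ)        = allSetᶠ (app extend (Vec.allFin _) (translate φ))

  module _ {s b} (iso : Iso s b) (label : Labelling (Fin σ) s) (P : Fin g → Node s → Set) (ℓ : Pos b → L)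
    (letter-correct : ∀ v → letterOf (ℓ (Iso.to iso v)) ≡ label v)
    (predicate-correct : ∀ i v → P i v ⇔ ⟦ predicate i ⟧ ℓ (Iso.to iso v ∷ [])) where
    open Iso iso

    valuation : Vec (NodeSet s) k → Pos b → L × Vec Bool k
    valuation μ p = ℓ p , Vec.map (λ X → X (from p)) μ

    Correct : MSO σ g m k → Vec (Node s) m → Vec (NodeSet s) k → Set
    Correct φ ν μ = Sat label P φ ν μ ⇔ ⟦ translate φ ⟧ (valuation μ) (Vec.map to ν)

    module _ (φ : MSO σ g m (suc k)) (ν : Vec (Node s) m) (μ : Vec (NodeSet s) k) (IH : ∀ X → Correct φ ν (X ∷ μ)) where
      private ψ = app extend (Vec.allFin m) (translate φ)

      set⇒ : ∀ X → Sat label P φ ν (X ∷ μ) → ⟦ ψ ⟧ (λ p → valuation μ p , X (from p)) (Vec.map to ν)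
      set⇒ X s = subst (⟦ translate φ ⟧ (valuation (X ∷ μ))) (sym (Vec.map-lookup-allFin (Vec.map to ν))) (⇒ (IH X) s)

      set⇐ : ∀ S → ⟦ ψ ⟧ (λ p → valuation μ p , S p) (Vec.map to ν) → Sat label P φ ν ((S ∘ to) ∷ μ)
      set⇐ S s = ⇐ (IH (S ∘ to)) (⟦⟧-cong (translate φ)
        (λ p → cong (λ c → ℓ p , c ∷ Vec.map (λ X → X (from p)) μ) (cong S (sym (to-from p))))
        (subst (⟦ translate φ ⟧ (λ p → ℓ p , S p ∷ Vec.map (λ X → X (from p)) μ)) (Vec.map-lookup-allFin (Vec.map to ν)) s))

    translate-correct : ∀ (φ : MSO σ g m k) ν μ → Correct φ ν μ
    translate-correct (letter a x) ν μ rewrite Vec.lookup-map x to ν = mk⇔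
      (λ e → does⁺ {P? = letterOf (ℓ (to (lookup ν x))) Fin.≟ a} (trans (letter-correct _) e))
      (λ t → trans (sym (letter-correct _)) (does⁻ {P? = letterOf (ℓ (to (lookup ν x))) Fin.≟ a} t))
    translate-correct (pred i x) ν μ rewrite Vec.lookup-map x to ν = predicate-correct i (lookup ν x)
    translate-correct (child x y) ν μ rewrite Vec.lookup-map x to ν | Vec.lookup-map y to ν = child⇔ _ _
    translate-correct (nextSibling x y) ν μ rewrite Vec.lookup-map x to ν | Vec.lookup-map y to ν = sibling⇔ _ _
    translate-correct (equal x y) ν μ rewrite Vec.lookup-map x to ν | Vec.lookup-map y to ν = mk⇔ (cong to) to-injective
    translate-correct (member x X) ν μ
      rewrite Vec.lookup-map x to ν | Vec.lookup-map X (λ Y → Y (from (to (lookup ν x)))) μ | from-to (lookup ν x) = mk⇔ id id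
    translate-correct (neg φ) ν μ = mk⇔ (_∘ ⇐ (translate-correct φ ν μ)) (_∘ ⇒ (translate-correct φ ν μ))
    translate-correct (and φ ψ) ν μ = mk⇔
      (λ (s , t) → ⇒ (translate-correct φ ν μ) s , ⇒ (translate-correct ψ ν μ) t)
      (λ (s , t) → ⇐ (translate-correct φ ν μ) s , ⇐ (translate-correct ψ ν μ) t)
    translate-correct (or φ ψ) ν μ = mk⇔
      (λ { (inj₁ s) → ⇒ disj (inj₁ (⇒ (translate-correct φ ν μ) s)) ; (inj₂ s) → ⇒ disj (inj₂ (⇒ (translate-correct ψ ν μ) s)) })
      (λ s → [ inj₁ ∘ ⇐ (translate-correct φ ν μ) , inj₂ ∘ ⇐ (translate-correct ψ ν μ) ]′ (⇐ disj s))
      where disj = or-correct {ℓ = valuation μ} {Vec.map to ν} (translate φ) (translate ψ)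
    translate-correct (ex φ) ν μ = mk⇔
      (λ (v , s) → to v , ⇒ (translate-correct φ (v ∷ ν) μ) s)
      (λ (p , s) → from p , ⇐ (translate-correct φ (from p ∷ ν) μ)
        (subst (λ q → ⟦ translate φ ⟧ (valuation μ) (q ∷ Vec.map to ν)) (sym (to-from p)) s))
    translate-correct (all φ) ν μ = mk⇔
      (λ s → ⇒ (all-correct {ν = Vec.map to ν} (translate φ)) λ p → subst (λ q → ⟦ translate φ ⟧ (valuation μ) (q ∷ Vec.map to ν)) (to-from p)
        (⇒ (translate-correct φ (from p ∷ ν) μ) (s (from p))))
      (λ s v → ⇐ (translate-correct φ (v ∷ ν) μ) (⇐ (all-correct {ν = Vec.map to ν} (translate φ)) s (to v)))
    translate-correct (exSet φ) ν μ = mk⇔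
      (λ (X , s) → X ∘ from , set⇒ φ ν μ (λ Y → translate-correct φ ν (Y ∷ μ)) X s)
      (λ (S , s) → S ∘ to , set⇐ φ ν μ (λ Y → translate-correct φ ν (Y ∷ μ)) S s)
    translate-correct (allSet φ) ν μ = mk⇔
      (λ s → ⇒ (allSet-correct {ν = Vec.map to ν} (app extend (Vec.allFin _) (translate φ))) λ S →
        ⟦⟧-cong (app extend (Vec.allFin _) (translate φ)) {ν = Vec.map to ν} (λ p → cong (valuation μ p ,_) (cong S (to-from p)))
          (set⇒ φ ν μ (λ Y → translate-correct φ ν (Y ∷ μ)) (S ∘ to) (s (S ∘ to))))
      (λ s X → Sat-ext X (set⇐ φ ν μ (λ Y → translate-correct φ ν (Y ∷ μ)) (X ∘ from)
        (⇐ (allSet-correct {ν = Vec.map to ν} (app extend (Vec.allFin _) (translate φ))) s (X ∘ from))))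
      where
      -- The two sets agree only pointwise. Truth is carried from one to the other through the
      -- translation, where `⟦⟧-cong` is available.
      Sat-ext : ∀ X → Sat label P φ ν ((X ∘ from ∘ to) ∷ μ) → Sat label P φ ν (X ∷ μ)
      Sat-ext X s = ⇐ (translate-correct φ ν (X ∷ μ)) (⟦⟧-cong (translate φ)
        (λ p → cong (λ c → ℓ p , c ∷ Vec.map (λ Y → Y (from p)) μ) (cong X (from-to (from p))))
        (⇒ (translate-correct φ ν ((X ∘ from ∘ to) ∷ μ)) s))

capture-mso : ∀ {R : Fin g → Query (Fin σ) 1} → (∀ i → Capture (R i)) → (φ : MSO σ g m 0) →
  Capture {Fin σ} {m} λ d ν → Sat (Instance.label d) (λ i v → R i d (v ∷ [])) φ ν []
capture-mso {R = R} C φ = record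
  { Colour = Tuple (Colour ∘ C)
  ; colour-finite = Tuple-finite (colour-finite ∘ C)
  ; valid = conjunction λ i → app (recolour (component i)) [] (valid (C i))
  ; formula = app (_, []) (Vec.allFin _) (translate proj₁ predicate φ)
  ; colourable = λ d →
      (λ p → tuple λ i → proj₁ (colourable (C i) d) p)
    , conjunction⁺ (λ i → app (recolour (component i)) [] (valid (C i))) (λ i → ⟦⟧-cong (valid (C i))
        (λ p → cong (λ c → _ , _ , _ , c) (sym (component-tuple (λ i → proj₁ (colourable (C i) d) p) i)))
        (proj₁ (proj₂ (colourable (C i) d))))
    , λ p q h → tuple-cong λ i → proj₂ (proj₂ (colourable (C i) d)) p q h
  ; correct = λ d κ (v , respects) ν → let open Instance d in
      subst (λ μ → Sat label (λ i v → R i d (v ∷ [])) φ ν [] ⇔ ⟦ translate proj₁ predicate φ ⟧ (λ p → lab d κ p , []) μ) (sym (Vec.map-lookup-allFin (Vec.map to ν)))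
        (translate-correct proj₁ predicate iso label _ (lab d κ) (λ v → cong label (from-to v))
          (λ i v′ → correct (C i) d (component i ∘ κ)
            ( conjunction⁻ (λ i → app (recolour (component i)) [] (valid (C i))) v i
            , (λ p q h → cong (component i) (respects p q h))) (v′ ∷ [])) φ ν []) }
  where
  open Capture
  predicate : Fin _ → Formula (Lab (Fin _) (Tuple (Colour ∘ C))) 1
  predicate i = app (recolour (component i)) (zero ∷ []) (formula (C i))

underlying : ∀ {A} → (A → Fin σ) → Instance A → DataTree σ
underlying f d = record { shape = shape ; label = f ∘ label ; _∼_ = _∼_ ; isDecEquivalence = ∼-isDec }
  where open Instance d

capture-xpath : ∀ (φ : XPath σ m) → Capture λ d ν → Holds (underlying id d) φ ν
capture-xpath (mso Γ φ)   = capture-mso (λ i → capture-xpath (Γ i)) φ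
capture-xpath (exSame φ)  = Capture-cong (λ { d (x ∷ []) → mk⇔ id id }) (capture-same (capture-xpath φ))
capture-xpath (exOther φ) = Capture-cong (λ { d (x ∷ []) → mk⇔ id id }) (capture-other (capture-xpath φ))

-- Emptiness



sumWeights : (Pos b → Weight d) → Weight d
sumWeights {leaf}  w = w tip
sumWeights {l ▹ r} w = sumWeights (w ∘ inl) ⊕ sumWeights (w ∘ inr)

module _ (α : Automaton X) (X-finite : Finite X) (w : X → Weight d) where
  private
    module α = Automaton α
    module X = Finite X-finite
    module Q = Finite α.finite

    leafRule : α.State → X → RE d α.State
    leafRule q x = guard (α.init x Q.≟ q) (con (w x))

    nodeRule : α.State → α.State → α.State → RE d α.State
    nodeRule q q₁ q₂ = guard (α.step q₁ q₂ Q.≟ q) (var q₁ · var q₂)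

    grammar : System d α.State
    grammar q = ⋃ X.elements (leafRule q) ∪ ⋃ Q.elements λ q₁ → ⋃ Q.elements (nodeRule q q₁)

    Yield : α.State → Subset d
    Yield q v = ∃[ b ] Σ (Pos b → X) λ ℓ → α.eval ℓ ≡ q × v ≡ sumWeights (w ∘ ℓ)

    module _ (sol : LeastSolution grammar) where
      open LeastSolution sol

      -- By leastness of the solution, this recovers an actual tree from every weight that the
      -- grammar derives.
      yield-closed : Closed grammar Yield
      yield-closed q (inj₁ p) with ⋃⁻ X.elements p
      ... | x , _ , p′ with guard⁻ {P? = α.init x Q.≟ q} p′
      ...   | e , refl = leaf , (λ _ → x) , e , refl
      yield-closed q (inj₂ p) with ⋃⁻ Q.elements p
      ... | q₁ , _ , p₁ with ⋃⁻ Q.elements p₁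
      ...   | q₂ , _ , p₂ with guard⁻ {P? = α.step q₁ q₂ Q.≟ q} p₂
      ...     | e , (_ , _ , refl , (l , ℓ , refl , refl) , (r , ℓ′ , refl , refl)) = l ▹ r , join ℓ ℓ′ , e , refl

      yield⊑value : ∀ {b} (ℓ : Pos b → X) → value (α.eval ℓ) (sumWeights (w ∘ ℓ))
      yield⊑value {leaf} ℓ = closed _ (inj₁ (⋃⁺ (X.complete (ℓ tip)) (guard⁺ {P? = _ Q.≟ _} refl refl)))
      yield⊑value {l ▹ r} ℓ = closed _ (inj₂ (⋃⁺ (Q.complete (α.eval (ℓ ∘ inl))) (⋃⁺ (Q.complete (α.eval (ℓ ∘ inr)))
        (guard⁺ {P? = _ Q.≟ _} refl (_ , _ , refl , yield⊑value (ℓ ∘ inl) , yield⊑value (ℓ ∘ inr))))))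

      accepted : RE d ⊥
      accepted = ⋃ Q.elements λ q → guard (T? (α.accept q)) (solution q)

      accepted⇒tree : ∃[ v ] ⟦ accepted ⟧ᴿ ∅ᵉ v × Balanced v →
        ∃[ b ] Σ (Pos b → X) λ ℓ → T (α.accepts ℓ) × Balanced (sumWeights (w ∘ ℓ))
      accepted⇒tree (v , p , bal) with ⋃⁻ Q.elements p
      ... | q , _ , p′ with guard⁻ {P? = T? (α.accept q)} p′
      ...   | t , s with least yield-closed q s
      ...     | b , ℓ , refl , refl = b , ℓ , t , bal

      tree⇒accepted : ∃[ b ] (Σ (Pos b → X) λ ℓ → T (α.accepts ℓ) × Balanced (sumWeights (w ∘ ℓ))) →
        ∃[ v ] ⟦ accepted ⟧ᴿ ∅ᵉ v × Balanced v
      tree⇒accepted (b , ℓ , t , bal) = _ , ⋃⁺ (Q.complete (α.eval ℓ)) (guard⁺ {P? = T? (α.accept (α.eval ℓ))} t (yield⊑value ℓ)) , bal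

  -- Parikh's theorem turns this into a question about regular expressions.
  balancedTree? : Dec (∃[ b ] Σ (Pos b → X) λ ℓ → T (α.accepts ℓ) × Balanced (sumWeights (w ∘ ℓ)))
  balancedTree? = map′ (accepted⇒tree sol) (tree⇒accepted sol) (balanced? (accepted sol))
    where
    sol : LeastSolution grammar
    sol = solve α.finite grammar

-- Counting and ranking nodes

indicator : Bool → ℕ
indicator true  = 1
indicator false = 0

count : (Pos b → Bool) → ℕ
count {leaf}  f = indicator (f tip)
count {l ▹ r} f = count (f ∘ inl) + count (f ∘ inr)

-- Together with `select`, a bijection between the nodes that satisfy `f` and `Fin (count f)`; it
-- will pair nodes across the two sides.
rank : ∀ (f : Pos b → Bool) p → T (f p) → Fin (count f)
rank f tip t with f tip
... | true = zero
rank f (inl p) t = rank (f ∘ inl) p t ↑ˡ _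
rank f (inr p) t = count (f ∘ inl) ↑ʳ rank (f ∘ inr) p t

select : ∀ (f : Pos b → Bool) → Fin (count f) → ∃[ p ] T (f p)
select {leaf}  f i = tip , holds (f tip) i
  where
  holds : ∀ c → Fin (indicator c) → T c
  holds true _ = tt
select {l ▹ r} f i with Fin.splitAt (count (f ∘ inl)) i
... | inj₁ j = let p , t = select (f ∘ inl) j in inl p , t
... | inj₂ j = let p , t = select (f ∘ inr) j in inr p , t

rank-irrelevant : ∀ (f : Pos b → Bool) {p p′} (t : T (f p)) (t′ : T (f p′)) → p ≡ p′ → rank f p t ≡ rank f p′ t′
rank-irrelevant f {p} t t′ refl = cong (rank f p) (Bool.T-irrelevant t t′)

select-rank : ∀ (f : Pos b → Bool) p t → proj₁ (select f (rank f p t)) ≡ p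
select-rank f tip t = refl
select-rank f (inl p) t rewrite Fin.splitAt-↑ˡ (count (f ∘ inl)) (rank (f ∘ inl) p t) (count (f ∘ inr)) = cong inl (select-rank (f ∘ inl) p t)
select-rank f (inr p) t rewrite Fin.splitAt-↑ʳ (count (f ∘ inl)) (count (f ∘ inr)) (rank (f ∘ inr) p t) = cong inr (select-rank (f ∘ inr) p t)

rank-select : ∀ (f : Pos b → Bool) i → rank f (proj₁ (select f i)) (proj₂ (select f i)) ≡ i
rank-select {leaf} f i = irrelevant (f tip) _ i
  where
  irrelevant : ∀ c (i j : Fin (indicator c)) → i ≡ j
  irrelevant true zero zero = refl
rank-select {l ▹ r} f i with Fin.splitAt (count (f ∘ inl)) i in e
... | inj₁ j = trans (cong (_↑ˡ _) (rank-select (f ∘ inl) j)) (Fin.splitAt⁻¹-↑ˡ e)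
... | inj₂ j = trans (cong (count (f ∘ inl) ↑ʳ_) (rank-select (f ∘ inr) j)) (Fin.splitAt⁻¹-↑ʳ e)

rank-injective : ∀ (f : Pos b → Bool) {p p′} t t′ → rank f p t ≡ rank f p′ t′ → p ≡ p′
rank-injective f t t′ e = trans (sym (select-rank f _ t)) (trans (cong (proj₁ ∘ select f) e) (select-rank f _ t′))

count-≤ : ∀ (f g : Pos b → Bool) (h : ∀ p → T (f p) → Pos b) → (∀ p t → T (g (h p t))) →
  (∀ {p p′} t t′ → h p t ≡ h p′ t′ → p ≡ p′) → count f ≤ count g
count-≤ f g h into inj = Fin.injective⇒≤ {f = λ i → let p , t = select f i in rank g (h p t) (into p t)} λ {i} {j} e →
  trans (sym (rank-select f i)) (trans (rank-irrelevant f _ _ (inj _ _ (rank-injective g _ _ e))) (rank-select f j))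

-- Balanced colours and matchings

module _ {K : Set} (K-finite : Finite K) where
  open Finite K-finite

  chosen : Bool → K → Lab A K → Bool
  chosen s k (_ , s′ , u , k′) = u ∧ (does (k′ ≟ k) ∧ does (s′ Bool.≟ s))

  chosen⁺ : ∀ {s k} (i : Lab A K) → T (proj₁ (proj₂ (proj₂ i))) → proj₂ (proj₂ (proj₂ i)) ≡ k → proj₁ (proj₂ i) ≡ s → T (chosen s k i)
  chosen⁺ {s = s} {k} (_ , s′ , _ , k′) t e e′ = ⇐ Bool.T-∧ (t , ⇐ Bool.T-∧ (does⁺ {P? = k′ ≟ k} e , does⁺ {P? = s′ Bool.≟ s} e′))

  chosen⁻ : ∀ {s k} (i : Lab A K) → T (chosen s k i) → T (proj₁ (proj₂ (proj₂ i))) × proj₂ (proj₂ (proj₂ i)) ≡ k × proj₁ (proj₂ i) ≡ s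
  chosen⁻ {s = s} {k} (_ , s′ , _ , k′) t = let t₁ , t′ = ⇒ Bool.T-∧ t ; t₂ , t₃ = ⇒ Bool.T-∧ t′ in
    t₁ , does⁻ {P? = k′ ≟ k} t₂ , does⁻ {P? = s′ Bool.≟ s} t₃

  -- One coordinate for each listed colour, comparing its matched nodes on the two sides. A colour
  -- that is listed twice only repeats an equation.
  weight : Lab A K → Weight size
  weight i = Vec.tabulate λ j → indicator (chosen true (at j) i) , indicator (chosen false (at j) i)

  lookup-sumWeights : ∀ (ℓ : Pos b → Lab A K) j → lookup (sumWeights (weight ∘ ℓ)) j ≡ (count (chosen true (at j) ∘ ℓ) , count (chosen false (at j) ∘ ℓ))
  lookup-sumWeights {leaf}  ℓ j = Vec.lookup∘tabulate _ j
  lookup-sumWeights {l ▹ r} ℓ j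
    rewrite Vec.lookup-zipWith addPair j (sumWeights (weight ∘ ℓ ∘ inl)) (sumWeights (weight ∘ ℓ ∘ inr))
          | lookup-sumWeights (ℓ ∘ inl) j | lookup-sumWeights (ℓ ∘ inr) j = refl

  balanced⇔ : ∀ (ℓ : Pos b → Lab A K) → Balanced (sumWeights (weight ∘ ℓ)) ⇔ (∀ k → count (chosen true k ∘ ℓ) ≡ count (chosen false k ∘ ℓ))
  balanced⇔ ℓ = mk⇔
    (λ bal k → subst (λ k → count (chosen true k ∘ ℓ) ≡ count (chosen false k ∘ ℓ)) (at-index k)
      (subst (λ (m , n) → m ≡ n) (lookup-sumWeights ℓ (index k)) (VecAll.lookup⁺ bal (index k))))
    (λ h → VecAll.lookup⁻ λ j → subst (λ (m , n) → m ≡ n) (sym (lookup-sumWeights ℓ j)) (h (at j)))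

  module _ (d : Instance A) (κ : Pos (Instance.tree d) → K) (respects : Respects d κ) where
    open Instance d

    -- Partners have equal colours and opposite sides. Passing to the partner is injective, since
    -- two nodes with a common partner are equivalent and on the same side.
    count-matched-≤ : ∀ s k → count (chosen s k ∘ lab d κ) ≤ count (chosen (not s) k ∘ lab d κ)
    count-matched-≤ s k = count-≤ _ _ mate mate-chosen mate-injective
      where
      partner : ∀ p → T (chosen s k (lab d κ p)) → ∃[ q ] q ≢ p × p ∼ᴾ q
      partner p t = does⁻ {P? = partner? p} (proj₁ (chosen⁻ {s = s} {k} (lab d κ p) t))
      mate : ∀ p → T (chosen s k (lab d κ p)) → Pos tree
      mate p t = proj₁ (partner p t)
      mate-chosen : ∀ p t → T (chosen (not s) k (lab d κ (mate p t)))
      mate-chosen p t with partner p t | chosen⁻ {s = s} {k} (lab d κ p) t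
      ... | q , q≢p , h | _ , refl , refl = chosen⁺ (lab d κ q) (does⁺ {P? = partner? q} (p , q≢p ∘ sym , ∼.sym h))
        (sym (respects p q h)) (not⇒≡ λ e → ∼⇒sides-differ h (q≢p ∘ sym) (sym (trans e (Bool.not-involutive _))))
      mate-injective : ∀ {p p′} t t′ → mate p t ≡ mate p′ t′ → p ≡ p′
      mate-injective {p} {p′} t t′ e with partner p t | partner p′ t′ | chosen⁻ {s = s} {k} (lab d κ p) t | chosen⁻ {s = s} {k} (lab d κ p′) t′
      mate-injective {p} {p′} t t′ refl | q , _ , h | _ , _ , h′ | _ , _ , e | _ , _ , e′ =
        unique p p′ (∼.trans h (∼.sym h′)) (trans e (sym e′))

    instance-balanced : Balanced (sumWeights (weight ∘ lab d κ))
    instance-balanced = ⇐ (balanced⇔ (lab d κ)) λ k → ℕ.≤-antisym (count-matched-≤ true k) (count-matched-≤ false k)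

  -- Matching the nodes of equal colour and equal rank on the two sides.
  module Matching {b} (ℓ : Pos b → Lab A K) (good : Good (λ p → proj₁ (proj₂ (ℓ p))))
    (equinumerous : ∀ k → count (chosen true k ∘ ℓ) ≡ count (chosen false k ∘ ℓ)) where

    letterOf : Pos b → A
    letterOf p = proj₁ (ℓ p)

    sideOf matchedOf : Pos b → Bool
    sideOf p = proj₁ (proj₂ (ℓ p))
    matchedOf p = proj₁ (proj₂ (proj₂ (ℓ p)))

    colourOf : Pos b → K
    colourOf p = proj₂ (proj₂ (proj₂ (ℓ p)))

    -- Classes are the fibres of `key`, which makes ∼ a decidable equivalence at once. Ranks are
    -- stored as natural numbers because the types `Fin (count f)` of ranks on the two sides differ.
    Key : Set
    Key = Pos b ⊎ (K × ℕ)

    own : ∀ p → T (matchedOf p) → T (chosen (sideOf p) (colourOf p) (ℓ p))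
    own p t = chosen⁺ (ℓ p) t refl refl

    key : Pos b → Key
    key p with T? (matchedOf p)
    ... | yes t = inj₂ (colourOf p , toℕ (rank (chosen (sideOf p) (colourOf p) ∘ ℓ) p (own p t)))
    ... | no _  = inj₁ p

    _≟ᵏ_ : DecidableEquality Key
    _≟ᵏ_ = Sum.≡-dec _≟ᴾ_ (Product.≡-dec _≟_ ℕ._≟_)

    rank-unique : ∀ {p q s s′ k k′} (t : T (chosen s k (ℓ p))) (t′ : T (chosen s′ k′ (ℓ q))) → s ≡ s′ → k ≡ k′ →
      toℕ (rank (chosen s k ∘ ℓ) p t) ≡ toℕ (rank (chosen s′ k′ ∘ ℓ) q t′) → p ≡ q
    rank-unique t t′ refl refl e = rank-injective _ t t′ (Fin.toℕ-injective e)

    key-unique : ∀ p q → key p ≡ key q → sideOf p ≡ sideOf q → p ≡ q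
    key-unique p q e s with T? (matchedOf p) | T? (matchedOf q)
    ... | yes t | yes u = let k , n = Product.,-injective (Sum.inj₂-injective e) in rank-unique (own p t) (own q u) s k n
    ... | no _  | no _  = Sum.inj₁-injective e

    key-colour : ∀ p q → key p ≡ key q → colourOf p ≡ colourOf q
    key-colour p q e with T? (matchedOf p) | T? (matchedOf q)
    ... | yes t | yes u = Product.,-injectiveˡ (Sum.inj₂-injective e)
    ... | no _  | no _  = cong colourOf (Sum.inj₁-injective e)

    key-matched : ∀ p q → key p ≡ key q → q ≢ p → T (matchedOf p)
    key-matched p q e q≢p with T? (matchedOf p) | T? (matchedOf q)
    ... | yes t | _    = t
    ... | no _  | no _ = ⊥-elim (q≢p (sym (Sum.inj₁-injective e)))

    equinumerous′ : ∀ s k → count (chosen s k ∘ ℓ) ≡ count (chosen (not s) k ∘ ℓ)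
    equinumerous′ true  k = equinumerous k
    equinumerous′ false k = sym (equinumerous k)

    rank-transport : ∀ {q s s′ k k′} (t : T (chosen s k (ℓ q))) (t′ : T (chosen s′ k′ (ℓ q))) → s ≡ s′ → k ≡ k′ →
      toℕ (rank (chosen s k ∘ ℓ) q t) ≡ toℕ (rank (chosen s′ k′ ∘ ℓ) q t′)
    rank-transport {q} {s} {_} {k} t t′ refl refl = cong (toℕ ∘ rank (chosen s k ∘ ℓ) q) (Bool.T-irrelevant t t′)

    key-≡ : ∀ q (t : T (matchedOf q)) → key q ≡ inj₂ (colourOf q , toℕ (rank (chosen (sideOf q) (colourOf q) ∘ ℓ) q (own q t)))
    key-≡ q t with T? (matchedOf q)
    ... | yes t′ = cong (λ t → inj₂ (colourOf q , toℕ (rank (chosen (sideOf q) (colourOf q) ∘ ℓ) q (own q t)))) (Bool.T-irrelevant t′ t)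
    ... | no ¬t  = ⊥-elim (¬t t)

    partner : ∀ p → T (matchedOf p) → ∃[ q ] q ≢ p × key p ≡ key q
    partner p t = q , (λ e → Bool.not-¬ refl (trans (sym (cong sideOf e)) s)) , (begin
      key p                                                           ≡⟨ key-≡ p t ⟩
      inj₂ (colour , toℕ i)                                                ≡⟨ cong (λ n → inj₂ (colour , n)) (begin
        toℕ i                                              ≡⟨ Fin.toℕ-cast (equinumerous′ (sideOf p) colour) i ⟨
        toℕ j                                              ≡⟨ cong toℕ (rank-select (chosen (not (sideOf p)) colour ∘ ℓ) j) ⟨
        toℕ (rank (chosen (not (sideOf p)) colour ∘ ℓ) q u)     ≡⟨ rank-transport u (own q v) (sym s) (sym c) ⟩
        toℕ (rank (chosen (sideOf q) (colourOf q) ∘ ℓ) q (own q v)) ∎) ⟩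
      inj₂ (colour , toℕ (rank (chosen (sideOf q) (colourOf q) ∘ ℓ) q (own q v))) ≡⟨ cong (λ x → inj₂ (x , toℕ (rank (chosen (sideOf q) (colourOf q) ∘ ℓ) q (own q v)))) (sym c) ⟩
      inj₂ (colourOf q , toℕ (rank (chosen (sideOf q) (colourOf q) ∘ ℓ) q (own q v))) ≡⟨ key-≡ q v ⟨
      key q                                                           ∎)
      where
      open ≡-Reasoning
      colour = colourOf p
      i = rank (chosen (sideOf p) colour ∘ ℓ) p (own p t)
      -- The same rank, read among the nodes of this colour on the opposite side.
      j = Fin.cast (equinumerous′ (sideOf p) colour) i
      q = proj₁ (select (chosen (not (sideOf p)) colour ∘ ℓ) j)
      u : T (chosen (not (sideOf p)) colour (ℓ q))
      u = proj₂ (select (chosen (not (sideOf p)) colour ∘ ℓ) j)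
      facts = chosen⁻ {s = not (sideOf p)} {colour} (ℓ q) u
      v = proj₁ facts
      c = proj₁ (proj₂ facts)
      s = proj₂ (proj₂ facts)

    iso = proj₂ (uncurried b)
    open Iso iso using (to; from; to-from)

    matching : Instance A
    matching = record
      { shape = proj₁ (uncurried b)
      ; label = letterOf ∘ to
      ; _∼_ = λ v w → key (to v) ≡ key (to w)
      ; ∼-isDec = record
        { isEquivalence = record { refl = refl ; sym = sym ; trans = trans }
        ; _≟_ = λ v w → key (to v) ≟ᵏ key (to w) }
      ; tree = b ; iso = iso ; side = sideOf ; good = good
      ; unique = λ p q e → key-unique p q (subst₂ (λ x y → key x ≡ key y) (to-from p) (to-from q) e) }

    open Instance matching using (matched; partner?; _∼ᴾ_)

    ∼ᴾ⇒key : ∀ {p q} → p ∼ᴾ q → key p ≡ key q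
    ∼ᴾ⇒key = subst₂ (λ x y → key x ≡ key y) (to-from _) (to-from _)

    key⇒∼ᴾ : ∀ {p q} → key p ≡ key q → p ∼ᴾ q
    key⇒∼ᴾ = subst₂ (λ x y → key x ≡ key y) (sym (to-from _)) (sym (to-from _))

    -- The flags of `ℓ` are merely guessed labels. They turn out true because equal counts give
    -- every flagged node a partner, while an unflagged node is alone with its key.
    matched-≡ : ∀ p → matched p ≡ matchedOf p
    matched-≡ p = does-⇔ (partner? p) (T? (matchedOf p)) (mk⇔
      (λ (q , q≢p , h) → key-matched p q (∼ᴾ⇒key h) q≢p)
      (λ t → let q , q≢p , e = partner p t in q , q≢p , key⇒∼ᴾ e))

    lab-≡ : ∀ p → lab matching colourOf p ≡ ℓ p
    lab-≡ p = cong₂ (λ x u → x , sideOf p , u , colourOf p) (cong letterOf (to-from p)) (matched-≡ p)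

    matching-respects : Respects matching colourOf
    matching-respects p q h = key-colour p q (∼ᴾ⇒key h)

-- A coloured tree that passes the automaton and is balanced yields some matching, to which
-- `correct` applies because it holds for every proper colouring; `colourable` serves the converse
-- direction.
emptiness : ∀ {A} → Finite A → {R : Query A 0} → Capture R → Dec (∃[ d ] R d [])
emptiness {A} A-finite {R} C = map′ sound complete
  (balancedTree? α (A-finite ×-finite Bool-finite ×-finite Bool-finite ×-finite colour-finite) (weight colour-finite))
  where
  open Capture C
  goodSides : Formula (Lab A Colour) 0
  goodSides = recognised (pullback (λ ((_ , s , _) , _) → s) goodAutomaton)
  goodSides-correct : ∀ {b} (ℓ : Pos b → Lab A Colour) → Good (λ p → proj₁ (proj₂ (ℓ p))) ⇔ ⟦ goodSides ⟧ ℓ []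
  goodSides-correct ℓ rewrite eval-pullback (λ ((_ , s , _) , _) → s) goodAutomaton (marked ℓ []) = goodAutomaton-correct _
  φ : Formula (Lab A Colour) 0
  φ = and goodSides (and valid formula)
  α : Automaton (Lab A Colour)
  α = pullback (_, []) (compile φ)
  α-correct : ∀ {b} (ℓ : Pos b → Lab A Colour) → ⟦ φ ⟧ ℓ [] ⇔ T (accepts α ℓ)
  α-correct ℓ rewrite eval-pullback (_, []) (compile φ) ℓ = compile-correct φ ℓ []
  sound : ∃[ b ] (Σ (Pos b → Lab A Colour) λ ℓ → T (accepts α ℓ) × Balanced (sumWeights (weight colour-finite ∘ ℓ))) → ∃[ d ] R d []
  sound (b , ℓ , t , bal) = build (⇐ (α-correct ℓ) t)
    where
    build : ⟦ φ ⟧ ℓ [] → ∃[ d ] R d []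
    build (g , v , s) = M.matching , ⇐ (correct M.matching M.colourOf
        (⟦⟧-cong valid (sym ∘ M.lab-≡) v , M.matching-respects) []) (⟦⟧-cong formula (sym ∘ M.lab-≡) s)
      where module M = Matching colour-finite ℓ (⇐ (goodSides-correct ℓ) g) (⇒ (balanced⇔ colour-finite ℓ) bal)
  complete : ∃[ d ] R d [] → ∃[ b ] (Σ (Pos b → Lab A Colour) λ ℓ → T (accepts α ℓ) × Balanced (sumWeights (weight colour-finite ∘ ℓ)))
  complete (d , h) with colourable d
  ... | κ , proper = Instance.tree d , lab d κ ,
    ⇒ (α-correct (lab d κ)) (⇒ (goodSides-correct (lab d κ)) (Instance.good d) , proj₁ proper , ⇒ (correct d κ proper []) h) ,
    instance-balanced colour-finite d κ (proj₂ proper)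

-- Class automata



map-kids-inl : ∀ (ρ : Pos (l ▹ r) → X) p → isTop p ≡ false → List.map ρ (kids (inl p)) ≡ List.map (ρ ∘ inl) (kids p)
map-kids-inl ρ p e rewrite e = sym (List.map-∘ (kids p))

map-kids-inr : ∀ (ρ : Pos (l ▹ r) → X) p → List.map ρ (kids (inr p)) ≡ List.map (ρ ∘ inr) (kids p)
map-kids-inr ρ p = sym (List.map-∘ (kids p))

map-kids-top : ∀ (ρ : Pos (l ▹ r) → X) → List.map ρ (kids (top (l ▹ r))) ≡ ρ (inr (top r)) ∷ List.map (ρ ∘ inl) (kids (top l))
map-kids-top {l} ρ with isTop (top l) | isTop-top l
... | true | _ = cong (_ ∷_) (sym (List.map-∘ (kids (top l))))

module _ (A-finite : Finite A) (H : TreeAutomaton A) where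
  open TreeAutomaton H
  private module W a q = WordAutomaton (horizontal a q)

  Guess : Set
  Guess = Σ A λ a → Σ (Fin states) λ q → Fin (W.states a q)

  -- A state guesses the letter and the state of the root and the state of its horizontal
  -- automaton before the children read so far, which form a suffix of all children.
  stepwise : Nondeterministic A
  stepwise = record
    { State = Guess
    ; finite = Σ-finite A-finite λ a → Σ-finite (Fin-finite _) λ q → Fin-finite _
    ; Init = λ x (a , q , h) → x ≡ a × T (W.final a q h)
    ; Step = λ (a , q , h) (a′ , q′ , h′) s → T (W.initial a′ q′ h′) × ∃[ i ] s ≡ (a , q , i) × T (W.step a q i q′ h)
    ; Accept = λ (a , q , h) → T (W.initial a q h) × T (accepting q)
    ; init? = λ x (a , q , h) → Finite._≟_ A-finite x a ×-dec T? _
    ; step? = λ (a , q , h) (a′ , q′ , h′) s → T? _ ×-dec Finite.∃? (Fin-finite _) λ i →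
        Finite._≟_ (Σ-finite A-finite λ a → Σ-finite (Fin-finite _) λ q → Fin-finite _) s (a , q , i) ×-dec T? _
    ; accept? = λ (a , q , h) → T? _ ×-dec T? _ }

  private module N = Nondeterministic stepwise

  Word : (Pos b → A) → (Pos b → Fin states) → Pos b → Set
  Word ℓ ρ p = W.AcceptsWord (ℓ p) (ρ p) (List.map ρ (kids p))

  -- The top node is exempt because further uses of `▹` still add children in front of its word.
  BelowTop : (Pos b → A) → (Pos b → Fin states) → Set
  BelowTop ℓ ρ = ∀ p → isTop p ≡ false → Word ℓ ρ p

  -- Only the suffix of the children seen so far is accounted for, from the guessed horizontal state
  -- `h` on. The word of a node is complete once its tree becomes the right part of `▹`, and there
  -- `h` must be initial.
  Partial : (Pos b → A) → (ρ : Pos b → Fin states) → Guess → Set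
  Partial {b} ℓ ρ s = ∃[ h ] s ≡ (ℓ (top b) , ρ (top b) , h) × W.AcceptsFrom (ℓ (top b)) (ρ (top b)) h (List.map ρ (kids (top b)))

  run⇒partial : ∀ (ℓ : Pos b → A) s → N.Run ℓ s → Σ (Pos b → Fin states) λ ρ → BelowTop ℓ ρ × Partial ℓ ρ s
  run⇒partial {leaf} ℓ (a , q , h) (refl , t) = (λ _ → q) , (λ { tip () }) , h , refl , t
  run⇒partial {l ▹ r} ℓ s (s₁ , s₂ , r₁ , r₂ , st) with run⇒partial (ℓ ∘ inl) s₁ r₁ | run⇒partial (ℓ ∘ inr) s₂ r₂
  run⇒partial {l ▹ r} ℓ s (s₁ , s₂ , r₁ , r₂ , t , i , refl , u)
    | ρ₁ , lower₁ , h₁ , refl , acc₁ | ρ₂ , lower₂ , h₂ , refl , acc₂ =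
    ρ , lower′ , i , refl , subst (W.AcceptsFrom _ _ i) (sym (map-kids-top ρ)) (h₁ , u , acc₁)
    where
    ρ : Pos (l ▹ r) → Fin states
    ρ = join ρ₁ ρ₂
    lower′ : BelowTop ℓ ρ
    lower′ (inl p) e = subst (W.AcceptsWord _ _) (sym (map-kids-inl ρ p e)) (lower₁ p e)
    lower′ (inr p) _ with isTop p in e
    ... | false = subst (W.AcceptsWord _ _) (sym (map-kids-inr ρ p)) (lower₂ p e)
    ... | true with refl ← isTop⇒≡top p (subst T (sym e) tt) =
      subst (W.AcceptsWord _ _) (sym (map-kids-inr ρ p)) (h₂ , t , acc₂)

  partial⇒run : ∀ (ℓ : Pos b → A) ρ → BelowTop ℓ ρ → ∀ {h} →
    W.AcceptsFrom (ℓ (top b)) (ρ (top b)) h (List.map ρ (kids (top b))) → N.Run ℓ (ℓ (top b) , ρ (top b) , h)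
  partial⇒run {leaf} ℓ ρ lower acc = refl , acc
  partial⇒run {l ▹ r} ℓ ρ lower {h} acc with subst (W.AcceptsFrom _ _ h) (map-kids-top ρ) acc
  ... | h₁ , u , acc₁ with subst (W.AcceptsWord _ _) (map-kids-inr ρ (top r)) (lower (inr (top r)) refl)
  ...   | h₂ , t , acc₂ = _ , _ ,
    partial⇒run (ℓ ∘ inl) (ρ ∘ inl) (λ p e → subst (W.AcceptsWord _ _) (map-kids-inl ρ p e) (lower (inl p) e)) acc₁ ,
    partial⇒run (ℓ ∘ inr) (ρ ∘ inr) (λ p e → subst (W.AcceptsWord _ _) (map-kids-inr ρ p) (lower (inr p) refl)) acc₂ ,
    t , h , refl , u

  curriedAutomaton : Automaton A
  curriedAutomaton = N.determinise

  module _ {s b} (iso : Iso s b) {ℓ : Labelling A s} {ℓᴮ : Pos b → A} (ℓ-≡ : ∀ v → ℓᴮ (Iso.to iso v) ≡ ℓ v) where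
    open Iso iso

    curriedAutomaton-correct : AcceptsTree ℓ ⇔ T (accepts curriedAutomaton ℓᴮ)
    curriedAutomaton-correct = mk⇔
      (λ (ρ , run , acc) → forth ρ run acc)
      (λ t → let s , r , a = ⇐ (N.determinise-correct ℓᴮ) t ; ρ , lower , part = run⇒partial ℓᴮ s r in back s ρ lower part a)
      where
      word : ∀ {a a′ q q′ w w′} → a ≡ a′ → q ≡ q′ → w ≡ w′ → W.AcceptsWord a q w → W.AcceptsWord a′ q′ w′
      word refl refl refl x = x
      forth : ∀ ρ → IsRun ℓ ρ → T (accepting (ρ root)) → T (accepts curriedAutomaton ℓᴮ)
      forth ρ run acc = found (everywhere (top b))
        where
        everywhere : ∀ p → Word ℓᴮ (ρ ∘ from) p
        everywhere p = word (trans (sym (ℓ-≡ (from p))) (cong ℓᴮ (to-from p))) refl (begin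
          List.map ρ (children (from p))                        ≡⟨ List.map-cong (λ v → cong ρ (sym (from-to v))) (children (from p)) ⟩
          List.map (ρ ∘ from ∘ to) (children (from p))          ≡⟨ List.map-∘ (children (from p)) ⟩
          List.map (ρ ∘ from) (List.map to (children (from p))) ≡⟨ cong (List.map (ρ ∘ from)) (trans (kids-to (from p)) (cong kids (to-from p))) ⟩
          List.map (ρ ∘ from) (kids p)                          ∎) (run (from p))
          where open ≡-Reasoning
        found : Word ℓᴮ (ρ ∘ from) (top b) → T (accepts curriedAutomaton ℓᴮ)
        found (h , i , acc′) = ⇒ (N.determinise-correct ℓᴮ)
          (_ , partial⇒run ℓᴮ (ρ ∘ from) (λ p _ → everywhere p) acc′ , i ,
            subst (T ∘ accepting ∘ ρ) (sym (trans (cong from (sym to-root)) (from-to root))) acc)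
      back : ∀ s ρ → BelowTop ℓᴮ ρ → Partial ℓᴮ ρ s → N.Accept s → AcceptsTree ℓ
      back s ρ lower (h , refl , acc) (i , a) = ρ ∘ to , run , subst (T ∘ accepting ∘ ρ) (sym to-root) a
        where
        everywhere : ∀ p → Word ℓᴮ ρ p
        everywhere p with isTop p in e
        ... | false = lower p e
        ... | true with refl ← isTop⇒≡top p (subst T (sym e) tt) = h , i , acc
        run : IsRun ℓ (ρ ∘ to)
        run v = word (ℓ-≡ v) refl (trans (cong (List.map ρ) (sym (kids-to v))) (sym (List.map-∘ (children v)))) (everywhere (to v))

module _ {σ} (𝓐 : ClassAutomaton σ) where
  open ClassAutomaton 𝓐

  Letter : Set
  Letter = Fin σ × Fin γ

  Letter-finite : Finite Letter
  Letter-finite = Fin-finite σ ×-finite Fin-finite γ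

  abstract
    transducerᴮ : Automaton Letter
    transducerᴮ = curriedAutomaton Letter-finite transducer

    transducerᴮ-correct : ∀ {s b} (iso : Iso s b) {ℓ : Labelling Letter s} {ℓᴮ : Pos b → Letter} → (∀ v → ℓᴮ (Iso.to iso v) ≡ ℓ v) →
      TreeAutomaton.AcceptsTree transducer ℓ ⇔ T (accepts transducerᴮ ℓᴮ)
    transducerᴮ-correct = curriedAutomaton-correct Letter-finite transducer

    classConditionᴮ : Automaton (Fin γ × Bool)
    classConditionᴮ = curriedAutomaton (Fin-finite γ ×-finite Bool-finite) classCondition

    classConditionᴮ-correct : ∀ {s b} (iso : Iso s b) {ℓ : Labelling (Fin γ × Bool) s} {ℓᴮ : Pos b → Fin γ × Bool} → (∀ v → ℓᴮ (Iso.to iso v) ≡ ℓ v) →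
      TreeAutomaton.AcceptsTree classCondition ℓ ⇔ T (accepts classConditionᴮ ℓᴮ)
    classConditionᴮ-correct = curriedAutomaton-correct (Fin-finite γ ×-finite Bool-finite) classCondition

  work : (d : Instance Letter) → Labelling (Fin γ) (Instance.shape d)
  work d = proj₂ ∘ Instance.label d

  ClassAccepted : (d : Instance Letter) → (Pos (Instance.tree d) → Bool) → Set
  ClassAccepted d S = T (accepts classConditionᴮ (λ p → work d (Instance.from d p) , S p))

  AcceptedLabelling : Query Letter 0
  AcceptedLabelling d _ = TreeAutomaton.AcceptsTree transducer label
    × (∀ v → TreeAutomaton.AcceptsTree classCondition (work d ⊗ λ w → does (v ∼.≟ w)))
    where open Instance d

  -- `Same` takes a ternary query, so x is tied to y. The marked set is built from y and z alone;
  -- thus the query itself does not mention ∼, and `Same` restricts it to pairs that really form a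
  -- class.
  RejectedPair : Query Letter 3
  RejectedPair d (x ∷ y ∷ z ∷ []) = to x ≡ to y × to y ≢ to z × ¬ ClassAccepted d (λ p → does (to y ≟ᴾ p) ∨ does (to z ≟ᴾ p))
    where open Instance d

  classFormula : ∀ {K m} → (Vec Bool m → Bool) → Formula (Lab Letter K) m
  classFormula f = recognised (pullback (λ (((_ , c) , _) , μ) → c , f μ) classConditionᴮ)

  classFormula-correct : ∀ {K m} f (d : Instance Letter) (κ : Pos (Instance.tree d) → K) (ν : Vec (Pos (Instance.tree d)) m) →
    ClassAccepted d (f ∘ marks ν) ⇔ ⟦ classFormula f ⟧ (lab d κ) ν
  classFormula-correct f d κ ν rewrite eval-pullback (λ (((_ , c) , _) , μ) → c , f μ) classConditionᴮ (marked (lab d κ) ν) = mk⇔ id id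

  capture-rejectedPair : Capture RejectedPair
  capture-rejectedPair = record
    { Colour = ⊤ ; colour-finite = ⊤-finite
    ; valid = conjunction {g = 0} λ ()
    ; formula = and (equal 0F 1F) (and (neg (equal 1F 2F)) (neg (classFormula pair)))
    ; colourable = λ d → (λ _ → tt) , conjunction⁺ {L = Lab Letter ⊤} {ℓ = lab d _} {g = 0} (λ ()) (λ ()) , λ _ _ _ → refl
    ; correct = λ { d κ _ (x ∷ y ∷ z ∷ []) → let ν = Vec.map (Instance.to d) (x ∷ y ∷ z ∷ []) in mk⇔
        (λ (e , ne , ¬c) → e , ne , ¬c ∘ ⇐ (classFormula-correct pair d κ ν))
        (λ (e , ne , ¬c) → e , ne , ¬c ∘ ⇒ (classFormula-correct pair d κ ν)) } }
    where
    pair : Vec Bool 3 → Bool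
    pair μ = lookup μ 1F ∨ lookup μ 2F

  module _ (d : Instance Letter) where
    open Instance d

    accepted-cong : ∀ {S S′} → (∀ p → S p ≡ S′ p) → ClassAccepted d S → ClassAccepted d S′
    accepted-cong h = subst (T ∘ accept classConditionᴮ) (eval-cong classConditionᴮ λ p → cong (work d (from p) ,_) (h p))

    class⇔ : ∀ v → TreeAutomaton.AcceptsTree classCondition (work d ⊗ λ w → does (v ∼.≟ w)) ⇔ ClassAccepted d (λ p → does (v ∼.≟ from p))
    class⇔ v = classConditionᴮ-correct iso
      λ w → cong (λ u → work d u , does (v ∼.≟ u)) (from-to w)

    class-pair : ∀ {y z} → y ∼ z → to y ≢ to z → ∀ p → does (y ∼.≟ from p) ≡ does (to y ≟ᴾ p) ∨ does (to z ≟ᴾ p)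
    class-pair {y} {z} h y≢z p = does-⇔ (y ∼.≟ from p) ((to y ≟ᴾ p) ⊎-dec (to z ≟ᴾ p)) (mk⇔ to′ from′)
      where
      to′ : y ∼ from p → to y ≡ p ⊎ to z ≡ p
      to′ h′ with to y ≟ᴾ p
      ... | yes e  = inj₁ e
      ... | no y≢p = inj₂ (unique (to z) p (subst (_∼ from p) (sym (from-to z)) (∼.trans (∼.sym h) h′))
        (≢-≢⇒≡ (∼⇒sides-differ (node-∼ h) y≢z ∘ sym) (∼⇒sides-differ (subst (_∼ from p) (sym (from-to y)) h′) y≢p ∘ sym)))
      from′ : to y ≡ p ⊎ to z ≡ p → y ∼ from p
      from′ (inj₁ refl) = subst (y ∼_) (sym (from-to y)) ∼.refl
      from′ (inj₂ refl) = subst (y ∼_) (sym (from-to z)) h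

    class-single : ∀ {y} → ¬ T (matched (to y)) → ∀ p → does (y ∼.≟ from p) ≡ does (to y ≟ᴾ p)
    class-single {y} ¬m p = does-⇔ (y ∼.≟ from p) (to y ≟ᴾ p) (mk⇔ to′ λ { refl → subst (y ∼_) (sym (from-to y)) ∼.refl })
      where
      to′ : y ∼ from p → to y ≡ p
      to′ h with to y ≟ᴾ p
      ... | yes e  = e
      ... | no y≢p = ⊥-elim (¬m (does⁺ {P? = partner? (to y)} (p , y≢p ∘ sym , subst (_∼ from p) (sym (from-to y)) h)))

    -- The class of v is {v} or consists of v and its partner.
    classes⇔ : (∀ v → TreeAutomaton.AcceptsTree classCondition (work d ⊗ λ w → does (v ∼.≟ w))) ⇔
      ((∀ v → ¬ Same RejectedPair d (v ∷ [])) × (∀ p → ¬ T (matched p) → ClassAccepted d (λ q → does (p ≟ᴾ q))))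
    classes⇔ = mk⇔ (λ h → pairs h , singles h) (λ (h , h′) v → ⇐ (class⇔ v) (back h h′ v))
      where
      pairs : _ → ∀ v → ¬ Same RejectedPair d (v ∷ [])
      pairs h v (y , z , y∼z , _ , y≢z , ¬c) = ¬c (accepted-cong (class-pair y∼z y≢z) (⇒ (class⇔ y) (h y)))
      singles : _ → ∀ p → ¬ T (matched p) → ClassAccepted d (λ q → does (p ≟ᴾ q))
      singles h p ¬m = subst (λ p′ → ClassAccepted d (λ q → does (p′ ≟ᴾ q))) (to-from p)
        (accepted-cong (class-single (subst (¬_ ∘ T ∘ matched) (sym (to-from p)) ¬m)) (⇒ (class⇔ (from p)) (h (from p))))
      back : (∀ v → ¬ Same RejectedPair d (v ∷ [])) → (∀ p → ¬ T (matched p) → ClassAccepted d (λ q → does (p ≟ᴾ q))) →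
        ∀ v → ClassAccepted d (λ p → does (v ∼.≟ from p))
      back h h′ v with T? (matched (to v))
      ... | no ¬m = accepted-cong (sym ∘ class-single ¬m) (h′ (to v) ¬m)
      ... | yes m = decidable-stable (T? _) λ ¬c → paired ¬c (does⁻ {P? = partner? (to v)} m)
        where
        paired : ¬ ClassAccepted d (λ p → does (v ∼.≟ from p)) → ¬ (∃[ q ] q ≢ to v × to v ∼ᴾ q)
        paired ¬c (q , q≢v , v∼q) = h v (v , from q , v∼ , refl , v≢ , ¬c ∘ accepted-cong (sym ∘ class-pair v∼ v≢))
          where
          v∼ : v ∼ from q
          v∼ = subst (_∼ from q) (from-to v) v∼q
          v≢ : to v ≢ to (from q)
          v≢ e = q≢v (sym (trans e (to-from q)))

  abstract
    capture-sameRejected : Capture (Same RejectedPair)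
    capture-sameRejected = capture-same capture-rejectedPair

  -- Singleton classes are visible in the labels as unmatched nodes and are tested directly; only
  -- classes of two nodes require the elimination of ∼.
  capture-accepted : Capture AcceptedLabelling
  capture-accepted = record
    { Capture C using (Colour; colour-finite; valid; colourable)
    ; formula = and run (and (neg (ex C.formula)) (neg (ex single)))
    ; correct = λ { d κ proper [] → mk⇔ (to′ d κ proper) (from′ d κ proper) } }
    where
    C : Capture (Same RejectedPair)
    C = capture-sameRejected
    module C = Capture C
    run : Formula (Lab Letter C.Colour) 0
    run = recognised (pullback (λ ((a , _) , _) → a) transducerᴮ)
    single : Formula (Lab Letter C.Colour) 1
    single = and (neg (test (λ (_ , _ , u , _) → u) 0F)) (neg (classFormula Vec.head))
    module _ (d : Instance Letter) (κ : Pos (Instance.tree d) → C.Colour) (proper : C.Proper d κ) where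
      open Instance d
      run⇔ : TreeAutomaton.AcceptsTree transducer label ⇔ ⟦ run ⟧ (lab d κ) []
      run⇔ rewrite eval-pullback (λ ((a , _) , _) → a) transducerᴮ (marked (lab d κ) []) =
        transducerᴮ-correct iso λ v → cong label (from-to v)
      to′ : AcceptedLabelling d [] → ⟦ and run (and (neg (ex C.formula)) (neg (ex single))) ⟧ (lab d κ) []
      to′ (t , c) = ⇒ run⇔ t ,
        (λ (p , s) → proj₁ (⇒ (classes⇔ d) c) (from p)
          (⇐ (C.correct d κ proper (from p ∷ [])) (subst (λ q → ⟦ C.formula ⟧ (lab d κ) (q ∷ [])) (sym (to-from p)) s))) ,
        (λ (p , ¬m , ¬s) → ¬s (⇒ (classFormula-correct Vec.head d κ (p ∷ [])) (proj₂ (⇒ (classes⇔ d) c) p ¬m)))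
      from′ : ⟦ and run (and (neg (ex C.formula)) (neg (ex single))) ⟧ (lab d κ) [] → AcceptedLabelling d []
      from′ (t , ¬s , ¬u) = ⇐ run⇔ t , ⇐ (classes⇔ d)
        ( (λ v s → ¬s (to v , ⇒ (C.correct d κ proper (v ∷ [])) s))
        , (λ p ¬m → decidable-stable (T? _) λ ¬c → ¬u (p , ¬m , ¬c ∘ ⇐ (classFormula-correct Vec.head d κ (p ∷ [])))))

-- Bipartite data trees as instances

module _ (t : DataTree σ) where
  open DataTree t

  module _ (bipartite : Bipartite t) where
    private
      part : NodeSet shape
      part = proj₁ bipartite
      tree : BTree
      tree = proj₁ (curried shape)
      iso : Iso shape tree
      iso = proj₂ (curried shape)
      open Iso iso

      connected⇒unseparated : ∀ c (P : Node shape → Set) → (∀ v → P v ⇔ part v ≡ c) →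
        (∀ v w → P v → P w → Eq.EqClosure (λ x y → P x × P y × Child x y) v w) → Unseparated (part ∘ from) c
      connected⇒unseparated c P P⇔ connected h inv p q x y = begin
        h p             ≡⟨ cong h (to-from p) ⟨
        h (to (from p)) ≡⟨ Eq.gfold isEquivalence (h ∘ to) edge (connected (from p) (from q) (⇐ (P⇔ _) x) (⇐ (P⇔ _) y)) ⟩
        h (to (from q)) ≡⟨ cong h (to-from q) ⟩
        h q             ∎
        where
        open ≡-Reasoning
        at-to : ∀ {v} → P v → part (from (to v)) ≡ c
        at-to {v} x = trans (cong part (from-to v)) (⇒ (P⇔ v) x)
        edge : ∀ {v w} → P v × P w × Child v w → h (to v) ≡ h (to w)
        edge {v} {w} (x , y , e) = inv (to v) (to w) (at-to x) (at-to y) (⇒ (child⇔ v w) e)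

      sides-good : Good (part ∘ from)
      sides-good = unseparated⇒good (part ∘ from) λ
        { true  → connected⇒unseparated true (T ∘ part) (λ _ → Bool.T-≡) (proj₁ (proj₁ (proj₂ bipartite)))
        ; false → connected⇒unseparated false (T ∘ not ∘ part) (λ _ → Bool.T-not-≡) (proj₁ (proj₂ (proj₂ bipartite))) }

      sides-unique : ∀ p q → from p ∼ from q → part (from p) ≡ part (from q) → p ≡ q
      sides-unique p q h e = trans (sym (to-from p)) (trans (cong to (nodes (part (from p)) refl)) (to-from q))
        where
        nodes : ∀ c → part (from p) ≡ c → from p ≡ from q
        nodes true  e′ = proj₂ (proj₁ (proj₂ bipartite)) _ _ h (⇐ Bool.T-≡ e′) (⇐ Bool.T-≡ (trans (sym e) e′))
        nodes false e′ = proj₂ (proj₂ (proj₂ bipartite)) _ _ h (⇐ Bool.T-not-≡ e′) (⇐ Bool.T-not-≡ (trans (sym e) e′))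

    fromBipartite : Labelling A shape → Instance A
    fromBipartite ℓ = record
      { shape = shape ; label = ℓ ; _∼_ = _∼_ ; ∼-isDec = isDecEquivalence ; tree = tree ; iso = iso
      ; side = part ∘ from ; good = sides-good ; unique = sides-unique }

underlying-bipartite : ∀ (f : A → Fin σ) d → Bipartite (underlying f d)
underlying-bipartite f d = side ∘ to ,
  (connected true (λ _ → Bool.T-≡) , λ v w h x y → unique′ h (trans (⇒ Bool.T-≡ x) (sym (⇒ Bool.T-≡ y)))) ,
  (connected false (λ _ → Bool.T-not-≡) , λ v w h x y → unique′ h (trans (⇒ Bool.T-not-≡ x) (sym (⇒ Bool.T-not-≡ y))))
  where
  open Instance d
  unique′ : ∀ {v w} → v ∼ w → side (to v) ≡ side (to w) → v ≡ w
  unique′ h e = to-injective (unique _ _ (node-∼ h) e)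
  connected : ∀ c {P : Node shape → Set} → (∀ v → P v ⇔ side (to v) ≡ c) →
    ∀ v w → P v → P w → Eq.EqClosure (λ x y → P x × P y × Child x y) v w
  connected c {P} P⇔ v w x y = subst₂ (Eq.EqClosure _) (from-to v) (from-to w)
    (Eq.gmap from edge (good⇒path good c (to v) (to w) (⇒ (P⇔ v) x) (⇒ (P⇔ w) y)))
    where
    at-from : ∀ p → side p ≡ c → P (from p)
    at-from p e = ⇐ (P⇔ (from p)) (trans (cong side (to-from p)) e)
    edge : ∀ {p q} → Edge side c p q → P (from p) × P (from q) × Child (from p) (from q)
    edge {p} {q} (x , y , e) = at-from p x , at-from q y ,
      ⇐ (child⇔ (from p) (from q)) (subst₂ ChildB (sym (to-from p)) (sym (to-from q)) e)

-- The output of the transducer is made part of the label of the instance, so that its existential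
-- choice is absorbed into the search for a tree.
acceptance? : ∀ σ (𝓐 : ClassAutomaton σ) → Dec (∃[ t ] Bipartite t × ClassAutomaton.Accepts 𝓐 t)
acceptance? σ 𝓐 = map′
  (λ (d , run , classes) → underlying proj₁ d , underlying-bipartite proj₁ d , work 𝓐 d , run , classes)
  (λ (t , bip , ℓ , run , classes) → fromBipartite t bip (DataTree.label t ⊗ ℓ) , run , classes)
  (emptiness (Letter-finite 𝓐) (capture-accepted 𝓐))

satisfiability? : ∀ σ (φ : XPath σ 0) → Dec (∃[ t ] Bipartite t × Holds t φ [])
satisfiability? σ φ = map′
  (λ (d , h) → underlying id d , underlying-bipartite id d , h)
  (λ (t , bip , h) → fromBipartite t bip (DataTree.label t) , h)
  (emptiness (Fin-finite σ) (capture-xpath φ))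

theorem5 : (∀ (σ : ℕ) (A : ClassAutomaton σ) →
    Dec (∃[ t ] Bipartite t × ClassAutomaton.Accepts A t))
    × (∀ (σ : ℕ) (φ : XPath σ 0) →
    Dec (∃[ t ] Bipartite t × Holds t φ []))
    × (∀ (σ : ℕ) (φ : XPath σ 1) →
    Dec (∃[ t ] Bipartite t × (∃[ v ] Holds t φ (v ∷ []))))
-- A unary query selects a node exactly when its existential closure, with the query as the only
-- predicate, holds as a boolean query.
theorem5 = acceptance? , satisfiability? , λ σ φ → satisfiability? σ (mso {g = 1} (λ _ → φ) (ex (pred 0F 0F)))
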